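{- Fix positive integers $a$ and $b$. Every subset $A\subseteq[n]$ containing no nontrivial solution (with $x_1,\dots,x_5\in A$) to the equation $a x_1+a x_2+b x_3=a x_4+(a+b)x_5$ has size $o(\sqrt n)$ as $n\to\infty$. Here a solution is trivial if it is of the form $(x_1,\dots,x_5)=(x,y,y,x,y)$ or $(y,x,y,x,y)$, or, when $a=b$, also $(y,y,x,x,y)$, for some $x,y\in\mathbb Z$.
   Context: $[n]=\{1,\dots,n\}$. -}

module Defs where

open import Data.Nat using (ℕ; suc; _+_; _*_)
open import Data.Fin using (Fin; toℕ)
open import Data.Fin.Subset using (Subset; _∈_)
open import Data.Product using (_×_)
open import Data.Sum using (_⊎_)
open import Relation.Binary.PropositionalEquality using (_≡_)

-- The element of [n] = {1,…,n} represented by i : Fin n (i ↦ i+1).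
elem : {n : ℕ} → Fin n → ℕ
elem i = suc (toℕ i)

Solution : (a b x₁ x₂ x₃ x₄ x₅ : ℕ) → Set
Solution a b x₁ x₂ x₃ x₄ x₅ = a * x₁ + a * x₂ + b * x₃ ≡ a * x₄ + (a + b) * x₅

Trivial : (a b x₁ x₂ x₃ x₄ x₅ : ℕ) → Set
Trivial a b x₁ x₂ x₃ x₄ x₅ =
  (x₁ ≡ x₄ × x₂ ≡ x₃ × x₃ ≡ x₅)
  ⊎ (x₂ ≡ x₄ × x₁ ≡ x₃ × x₃ ≡ x₅)
  ⊎ (a ≡ b × x₁ ≡ x₂ × x₂ ≡ x₅ × x₃ ≡ x₄)

SolutionFree : (a b : ℕ) {n : ℕ} → Subset n → Set
SolutionFree a b {n} A =
  (x₁ x₂ x₃ x₄ x₅ : Fin n) →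
  x₁ ∈ A → x₂ ∈ A → x₃ ∈ A → x₄ ∈ A → x₅ ∈ A →
  Solution a b (elem x₁) (elem x₂) (elem x₃) (elem x₄) (elem x₅) →
  Trivial a b (elem x₁) (elem x₂) (elem x₃) (elem x₄) (elem x₅)

{-# OPTIONS --safe #-}

-- Work modulo N = 3(a+b)n and let m = |A|. Solutions with x₃ = x₅ show that A, and its dilates by a, b
-- and a+b, are Sidon sets; hence if n < k²m² then A+A has positive density. Let T(s) count the
-- solutions in A of a x₁ + a x₂ + b x₃ − a x₄ − (a+b) x₅ ≡ s, so T(0) ≤ 3m² counts trivial solutions
-- only, whereas the average of T has order m³. Cauchy–Schwarz and the Sidon property make |T(s) −
-- T(0)| small compared with m³ when s is an almost period of H = 1_{aA} * 1_{aA} * 1_{aA} * 1_{−aA},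
-- and sampling A+A yields a positive proportion of almost periods. Consequently T(0) is close to the
-- number of solutions weighted by the smoothing of 1_A along any set of almost periods. The energy of
-- such a smoothing stays bounded because A is a Sidon set, so some smoothing barely loses energy when
-- it is smoothed once more along coarser almost periods; it is then nearly constant at the coarser
-- scale, where it has many weighted solutions. This forces T(0) to have order m³, so m is bounded.

module Submission where

open import Defs

-- The obstacle is sparseness: `A` has only about √n elements, so nothing can be counted in it
-- directly. Density is replaced by N being at most a constant times m², which bounds the smoothed
-- functions in mean square. Almost periods play the part of Bohr sets in a Fourier argument: a sum
-- of two of them is again one, at the price of a factor 4 in quality, and so are the integer
-- combinations that the equation needs. `H` has four factors because the squared norm of F(· - s) -
-- F, with F the threefold convolution that enters T, is the inner product of the corresponding
-- differences of `H` and of 1_X * 1_X. The scales depend on each other in one direction. The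
-- density of the coarse periods fixes a constant c, and the finer smoothing must then be so
-- accurate that c (T(s) - T(0)) is negligible against m³. The levels are therefore defined from the
-- coarsest up, while the descent starts at the finest. All quantities stay integral: averages are
-- sums with denominators cleared, and energy is measured in a unit that makes every decrement at
-- least 1.

module Proof where

  open import Algebra using (CommutativeRing)
  open import Algebra.Structures using (IsCommutativeRing)
  open import Data.Bool using (true; false)
  open import Data.Empty using (⊥; ⊥-elim)
  open import Data.Fin using (Fin; zero; suc)
  import Data.Fin.Properties as Fin
  open import Data.Fin.Subset using (Subset) renaming (_∈_ to _∈ₛ_; ∣_∣ to size)
  open import Data.Integer as ℤ using (ℤ; +_)
  import Data.Integer.Properties as ℤ
  open import Data.Integer.Divisibility.Signed
    using (_∣_; _∣?_; divides; ∣m∣n⇒∣m+n; ∣m⇒∣-m; ∣n⇒∣m*n; ∣⇒∣ᵤ; ∣-refl)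
  open import Data.Integer.Tactic.RingSolver using () renaming (solve-∀ to solve-ℤ)
  open import Data.List using (List; []; _∷_; _++_; map; filter; cartesianProduct; cartesianProductWith)
  open import Data.List.Membership.Propositional using (_∈_)
  open import Data.List.Membership.Propositional.Properties
    using (∈-++⁻; ∈-map⁻; ∈-filter⁻; ∈-cartesianProduct⁻; ∈-cartesianProductWith⁻)
  open import Data.List.Properties using (map-id; map-cong)
  open import Data.List.Relation.Unary.All as All using (All; []; _∷_)
  open import Data.List.Relation.Unary.AllPairs as AllPairs using (AllPairs; []; _∷_)
  import Data.List.Relation.Unary.AllPairs.Properties as AllPairs
  open import Data.List.Relation.Unary.Any using (here; there)
  open import Data.Maybe using (just; nothing)
  open import Data.Nat as ℕ using (ℕ; zero; suc)
  import Data.Nat.Divisibility as ℕ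
  import Data.Nat.Properties as ℕ
  open import Data.Nat.Tactic.RingSolver using () renaming (solve-∀ to solve-ℕ)
  open import Data.Product using (_×_; _,_; ∃-syntax; proj₁; proj₂)
  open import Data.Sum using (_⊎_; inj₁; inj₂)
  open import Data.Vec using ([]; _∷_; here; there)
  open import Function using (_∘_)
  open import Level using (0ℓ)
  open import Relation.Binary.Bundles using (Poset)
  import Relation.Binary.Reasoning.PartialOrder
  open import Relation.Binary.PropositionalEquality
    using (_≡_; refl; sym; trans; cong; cong₂; subst; subst₂; isEquivalence; module ≡-Reasoning)
  open import Relation.Nullary using (¬_; Dec; yes; no)
  open import Relation.Unary using (Decidable)
  open import Tactic.RingSolver using (solve-∀)
  open import Tactic.RingSolver.Core.AlmostCommutativeRing using (AlmostCommutativeRing; fromCommutativeRing)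

  -- A copy of ℤ whose operations are stuck on variables: the operations of ℤ itself unfold to sign
  -- and absolute value, which defeats unification.
  data R : Set where
    int : ℤ → R

  infixl 7 _*_
  infixl 6 _+_ _-_
  infix 8 -_
  -_ : R → R
  - (int x) = int (ℤ.- x)
  _+_ _*_ _-_ : R → R → R
  int x + int y = int (x ℤ.+ y)
  int x * int y = int (x ℤ.* y)
  x - y = x + - y

  nat : ℕ → R
  nat n = int (+ n)
  0# 1# : R
  0# = nat 0
  1# = nat 1

  isCommutativeRing : IsCommutativeRing _≡_ _+_ _*_ (-_) 0# 1#
  isCommutativeRing = record
    { isRing = record
      { +-isAbelianGroup = record
        { isGroup = record
          { isMonoid = record
            { isSemigroup = record
              { isMagma = record { isEquivalence = isEquivalence ; ∙-cong = cong₂ _+_ }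
              ; assoc = λ { (int x) (int y) (int z) → cong int (ℤ.+-assoc x y z) } }
            ; identity = (λ { (int x) → cong int (ℤ.+-identityˡ x) }) , (λ { (int x) → cong int (ℤ.+-identityʳ x) }) }
          ; inverse = (λ { (int x) → cong int (ℤ.+-inverseˡ x) }) , (λ { (int x) → cong int (ℤ.+-inverseʳ x) })
          ; ⁻¹-cong = cong (λ x → - x) }
        ; comm = λ { (int x) (int y) → cong int (ℤ.+-comm x y) } }
      ; *-cong = cong₂ _*_
      ; *-assoc = λ { (int x) (int y) (int z) → cong int (ℤ.*-assoc x y z) }
      ; *-identity = (λ { (int x) → cong int (ℤ.*-identityˡ x) }) , (λ { (int x) → cong int (ℤ.*-identityʳ x) })
      ; distrib = (λ { (int x) (int y) (int z) → cong int (ℤ.*-distribˡ-+ x y z) }) ,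
          (λ { (int x) (int y) (int z) → cong int (ℤ.*-distribʳ-+ x y z) })
      }
    ; *-comm = λ { (int x) (int y) → cong int (ℤ.*-comm x y) }
    }
  commutativeRing : CommutativeRing 0ℓ 0ℓ
  commutativeRing = record { isCommutativeRing = isCommutativeRing }

  open CommutativeRing commutativeRing using (*-comm; *-identityˡ; *-identityʳ; zeroʳ)

  ring : AlmostCommutativeRing 0ℓ 0ℓ
  ring = fromCommutativeRing commutativeRing (λ { (int (+ 0)) → just refl; _ → nothing })

  -- The order on `R` and inequalities proved from ring identities

  data _≤_ : R → R → Set where
    int≤ : ∀ {i j} → i ℤ.≤ j → int i ≤ int j

  infix 4 _≤_ _≤?_

  ≤-reflexive : ∀ {x y} → x ≡ y → x ≤ y
  ≤-reflexive {int x} refl = int≤ ℤ.≤-refl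

  ≤-refl : ∀ {x} → x ≤ x
  ≤-refl = ≤-reflexive refl

  ≤-trans : ∀ {x y z} → x ≤ y → y ≤ z → x ≤ z
  ≤-trans (int≤ p) (int≤ q) = int≤ (ℤ.≤-trans p q)

  ≤-antisym : ∀ {x y} → x ≤ y → y ≤ x → x ≡ y
  ≤-antisym (int≤ p) (int≤ q) = cong int (ℤ.≤-antisym p q)

  ≤-total : ∀ x y → x ≤ y ⊎ y ≤ x
  ≤-total (int x) (int y) with ℤ.≤-total x y
  ... | inj₁ p = inj₁ (int≤ p)
  ... | inj₂ p = inj₂ (int≤ p)

  _≤?_ : ∀ x y → Dec (x ≤ y)
  int x ≤? int y with x ℤ.≤? y
  ... | yes p = yes (int≤ p)
  ... | no ¬p = no (λ { (int≤ p) → ¬p p })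

  ≤-poset : Poset 0ℓ 0ℓ 0ℓ
  ≤-poset = record
    { isPartialOrder = record
      { isPreorder = record { isEquivalence = isEquivalence ; reflexive = ≤-reflexive ; trans = ≤-trans }
      ; antisym = ≤-antisym } }

  module ≤-Reasoning = Relation.Binary.Reasoning.PartialOrder ≤-poset

  ≰⇒1+≤ : ∀ {x y} → ¬ x ≤ y → 1# + y ≤ x
  ≰⇒1+≤ {int x} {int y} h = int≤ (ℤ.i<j⇒suc[i]≤j (ℤ.≰⇒> (λ p → h (int≤ p))))

  +-mono : ∀ {x y u v} → x ≤ y → u ≤ v → x + u ≤ y + v
  +-mono (int≤ p) (int≤ q) = int≤ (ℤ.+-mono-≤ p q)

  nat-mono : ∀ {m n} → m ℕ.≤ n → nat m ≤ nat n
  nat-mono p = int≤ (ℤ.+≤+ p)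

  nat-cancel : ∀ {m n} → nat m ≤ nat n → m ℕ.≤ n
  nat-cancel (int≤ p) = ℤ.drop‿+≤+ p

  nat-* : ∀ m n → nat (m ℕ.* n) ≡ nat m * nat n
  nat-* m n = cong int (ℤ.pos-* m n)

  0≤nat : ∀ {n} → 0# ≤ nat n
  0≤nat = nat-mono ℕ.z≤n

  1≰0 : ¬ 1# ≤ 0#
  1≰0 (int≤ (ℤ.+≤+ ()))

  0≤1 : 0# ≤ 1#
  0≤1 = 0≤nat

  gap : ∀ {x y} → x ≤ y → 0# ≤ y - x
  gap (int≤ p) = int≤ (ℤ.i≤j⇒0≤j-i p)

  ≤by : ∀ {x y} e → y - x ≡ e → 0# ≤ e → x ≤ y
  ≤by {int x} {int y} e refl (int≤ p) = int≤ (ℤ.0≤i-j⇒j≤i p)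

  0≤+ : ∀ {x y} → 0# ≤ x → 0# ≤ y → 0# ≤ x + y
  0≤+ (int≤ p) (int≤ q) = int≤ (ℤ.+-mono-≤ p q)

  0≤* : ∀ {x y} → 0# ≤ x → 0# ≤ y → 0# ≤ x * y
  0≤* {int (+ m)} {int (+ n)} p q = subst (0# ≤_) (nat-* m n) 0≤nat
  0≤* {int ℤ.-[1+ _ ]} (int≤ ()) _
  0≤* {int (+ _)} {int ℤ.-[1+ _ ]} _ (int≤ ())

  0≤sq : ∀ x → 0# ≤ x * x
  0≤sq (int (+ n)) = 0≤* {nat n} {nat n} 0≤nat 0≤nat
  0≤sq (int ℤ.-[1+ n ]) = 0≤nat

  *-monoˡ : ∀ {c x y} → 0# ≤ c → x ≤ y → c * x ≤ c * y
  *-monoˡ {c} {x} {y} p q = ≤by (c * (y - x)) (eq c x y) (0≤* p (gap q))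
    where
    eq : ∀ c x y → c * y - c * x ≡ c * (y - x)
    eq = solve-∀ ring

  *-monoʳ : ∀ {c x y} → 0# ≤ c → x ≤ y → x * c ≤ y * c
  *-monoʳ {c} {x} {y} p q = subst₂ _≤_ (*-comm c x) (*-comm c y) (*-monoˡ p q)

  *-mono : ∀ {x y u v} → 0# ≤ x → 0# ≤ u → x ≤ y → u ≤ v → x * u ≤ y * v
  *-mono {x} {y} {u} {v} 0≤x 0≤u p q = ≤-trans (*-monoˡ 0≤x q) (*-monoʳ (≤-trans 0≤u q) p)

  sq-mono : ∀ {x y} → 0# ≤ x → x ≤ y → x * x ≤ y * y
  sq-mono p q = *-mono p p q q

  1≤⇒0≤ : ∀ {c} → 1# ≤ c → 0# ≤ c
  1≤⇒0≤ = ≤-trans 0≤1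

  1≤* : ∀ {x y} → 1# ≤ x → 1# ≤ y → 1# ≤ x * y
  1≤* = *-mono 0≤1 0≤1

  cancel : ∀ {c x y} → 1# ≤ c → c * x ≤ c * y → x ≤ y
  cancel {int (+ suc c)} {int x} {int y} _ (int≤ q) = int≤ (ℤ.*-cancelˡ-≤-pos x y (+ suc c) q)
  cancel {int (+ zero)} (int≤ (ℤ.+≤+ ()))
  cancel {int ℤ.-[1+ _ ]} (int≤ ())

  sq+ : ∀ x y → (x + y) * (x + y) ≤ nat 2 * (x * x + y * y)
  sq+ x y = ≤by ((x - y) * (x - y)) (eq x y) (0≤sq (x - y))
    where
    eq : ∀ x y → nat 2 * (x * x + y * y) - (x + y) * (x + y) ≡ (x - y) * (x - y)
    eq = solve-∀ ring

  -- Finite sums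

  module _ {I : Set} where

    ∑ : List I → (I → R) → R
    ∑ [] f = 0#
    ∑ (x ∷ xs) f = f x + ∑ xs f

    len : List I → R
    len xs = ∑ xs (λ _ → 1#)

    ∑-cong∈ : ∀ xs {f g : I → R} → (∀ x → x ∈ xs → f x ≡ g x) → ∑ xs f ≡ ∑ xs g
    ∑-cong∈ [] h = refl
    ∑-cong∈ (x ∷ xs) h = cong₂ _+_ (h x (here refl)) (∑-cong∈ xs (λ y p → h y (there p)))

    ∑-cong : ∀ xs {f g : I → R} → (∀ x → f x ≡ g x) → ∑ xs f ≡ ∑ xs g
    ∑-cong xs h = ∑-cong∈ xs (λ x _ → h x)

    ∑-mono∈ : ∀ xs {f g : I → R} → (∀ x → x ∈ xs → f x ≤ g x) → ∑ xs f ≤ ∑ xs g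
    ∑-mono∈ [] h = ≤-refl
    ∑-mono∈ (x ∷ xs) h = +-mono (h x (here refl)) (∑-mono∈ xs (λ y p → h y (there p)))

    ∑-mono : ∀ xs {f g : I → R} → (∀ x → f x ≤ g x) → ∑ xs f ≤ ∑ xs g
    ∑-mono xs h = ∑-mono∈ xs (λ x _ → h x)

    ∑-0 : ∀ xs → ∑ xs (λ _ → 0#) ≡ 0#
    ∑-0 [] = refl
    ∑-0 (x ∷ xs) = cong₂ _+_ refl (∑-0 xs)

    0≤∑ : ∀ xs {f : I → R} → (∀ x → 0# ≤ f x) → 0# ≤ ∑ xs f
    0≤∑ xs {f} h = subst (_≤ ∑ xs f) (∑-0 xs) (∑-mono xs h)

    0≤len : ∀ xs → 0# ≤ len xs
    0≤len xs = 0≤∑ xs (λ _ → 0≤nat)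

    ∑-+ : ∀ xs (f g : I → R) → ∑ xs (λ x → f x + g x) ≡ ∑ xs f + ∑ xs g
    ∑-+ [] f g = refl
    ∑-+ (x ∷ xs) f g = trans (cong₂ _+_ refl (∑-+ xs f g)) (eq (f x) (g x) (∑ xs f) (∑ xs g))
      where
      eq : ∀ a b c d → a + b + (c + d) ≡ a + c + (b + d)
      eq = solve-∀ ring

    ∑-* : ∀ xs c (f : I → R) → ∑ xs (λ x → c * f x) ≡ c * ∑ xs f
    ∑-* [] c f = eq c
      where
      eq : ∀ c → 0# ≡ c * 0#
      eq = solve-∀ ring
    ∑-* (x ∷ xs) c f = trans (cong₂ _+_ refl (∑-* xs c f)) (eq c (f x) (∑ xs f))
      where
      eq : ∀ c a b → c * a + c * b ≡ c * (a + b)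
      eq = solve-∀ ring

    ∑-*ʳ : ∀ xs c (f : I → R) → ∑ xs (λ x → f x * c) ≡ ∑ xs f * c
    ∑-*ʳ xs c f = trans (∑-cong xs (λ x → *-comm (f x) c)) (trans (∑-* xs c f) (*-comm c _))

    ∑-neg : ∀ xs (f : I → R) → ∑ xs (λ x → - f x) ≡ - ∑ xs f
    ∑-neg [] f = refl
    ∑-neg (x ∷ xs) f = trans (cong₂ _+_ refl (∑-neg xs f)) (eq (f x) (∑ xs f))
      where
      eq : ∀ a b → - a + - b ≡ - (a + b)
      eq = solve-∀ ring

    ∑-- : ∀ xs (f g : I → R) → ∑ xs (λ x → f x - g x) ≡ ∑ xs f - ∑ xs g
    ∑-- xs f g = trans (∑-+ xs f (λ x → - g x)) (cong₂ _+_ refl (∑-neg xs g))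

    ∑-const : ∀ xs c → ∑ xs (λ _ → c) ≡ len xs * c
    ∑-const xs c = trans (∑-cong xs (λ _ → eq c)) (∑-*ʳ xs c (λ _ → 1#))
      where
      eq : ∀ c → c ≡ 1# * c
      eq = solve-∀ ring

    ∑-≤const∈ : ∀ xs {f : I → R} {c} → (∀ x → x ∈ xs → f x ≤ c) → ∑ xs f ≤ len xs * c
    ∑-≤const∈ xs {f} {c} h = subst (∑ xs f ≤_) (∑-const xs c) (∑-mono∈ xs h)

    ∑-++ : ∀ xs ys (f : I → R) → ∑ (xs ++ ys) f ≡ ∑ xs f + ∑ ys f
    ∑-++ [] ys f = eq (∑ ys f)
      where
      eq : ∀ c → c ≡ 0# + c
      eq = solve-∀ ring
    ∑-++ (x ∷ xs) ys f = trans (cong₂ _+_ refl (∑-++ xs ys f)) (eq (f x) (∑ xs f) (∑ ys f))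
      where
      eq : ∀ a b c → a + (b + c) ≡ a + b + c
      eq = solve-∀ ring

    ∑-averaging : ∀ xs (f : I → R) → 1# ≤ len xs → ∃[ x ] (x ∈ xs × ∑ xs f ≤ len xs * f x)
    ∑-averaging [] f h = ⊥-elim (1≰0 h)
    ∑-averaging (x ∷ []) f _ = x , here refl , ≤-reflexive (eq (f x))
      where
      eq : ∀ a → a + 0# ≡ (1# + 0#) * a
      eq = solve-∀ ring
    ∑-averaging (x ∷ xs@(_ ∷ ys)) f _
      with ∑-averaging xs f (+-mono (≤-refl {1#}) (0≤len ys))
    ... | y , y∈ , h with ≤-total (f x) (f y)
    ...   | inj₁ le = y , there y∈ , subst (f x + ∑ xs f ≤_) (eq (len xs) (f y)) (+-mono le h)
      where
      eq : ∀ l a → a + l * a ≡ (1# + l) * a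
      eq = solve-∀ ring
    ...   | inj₂ ge = x , here refl ,
        subst (f x + ∑ xs f ≤_) (eq (len xs) (f x))
          (+-mono (≤-refl {f x}) (≤-trans h (*-monoˡ (0≤len xs) ge)))
      where
      eq : ∀ l a → a + l * a ≡ (1# + l) * a
      eq = solve-∀ ring

    ∑-filter-≤ : ∀ {P : I → Set} (P? : Decidable P) xs {f : I → R} {c} →
      (∀ x → P x → f x ≤ c) → (∀ x → ¬ P x → f x ≤ 0#) →
      ∑ xs f ≤ len (filter P? xs) * c
    ∑-filter-≤ P? [] {c = c} h h′ = ≤-reflexive (eq c)
      where
      eq : ∀ c → 0# ≡ 0# * c
      eq = solve-∀ ring
    ∑-filter-≤ P? (x ∷ xs) {f} {c} h h′ with P? x
    ... | yes p = subst (f x + ∑ xs f ≤_) (eq (len (filter P? xs)) c) (+-mono (h x p) (∑-filter-≤ P? xs h h′))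
      where
      eq : ∀ l a → a + l * a ≡ (1# + l) * a
      eq = solve-∀ ring
    ... | no ¬p = subst (f x + ∑ xs f ≤_) (eq _) (+-mono (h′ x ¬p) (∑-filter-≤ P? xs h h′))
      where
      eq : ∀ a → 0# + a ≡ a
      eq = solve-∀ ring

  ∑-map : ∀ {I J : Set} (h : I → J) xs (f : J → R) → ∑ (map h xs) f ≡ ∑ xs (f ∘ h)
  ∑-map h [] f = refl
  ∑-map h (x ∷ xs) f = cong₂ _+_ refl (∑-map h xs f)

  ∑-cartesianWith : ∀ {I J K : Set} (h : I → J → K) (L : List I) (M : List J) (f : K → R) →
    ∑ (cartesianProductWith h L M) f ≡ ∑ L (λ x → ∑ M (λ y → f (h x y)))
  ∑-cartesianWith h [] M f = refl
  ∑-cartesianWith h (x ∷ L) M f =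
    trans (∑-++ (map (h x) M) _ f) (cong₂ _+_ (∑-map (h x) M f) (∑-cartesianWith h L M f))

  ∑-swap : ∀ {I J : Set} (xs : List I) (ys : List J) (f : I → J → R) →
    ∑ xs (λ x → ∑ ys (f x)) ≡ ∑ ys (λ y → ∑ xs (λ x → f x y))
  ∑-swap [] ys f = sym (∑-0 ys)
  ∑-swap (x ∷ xs) ys f =
    trans (cong₂ _+_ refl (∑-swap xs ys f)) (sym (∑-+ ys (f x) (λ y → ∑ xs (λ x → f x y))))

  ∑-*∑ : ∀ {I J : Set} (xs : List I) (ys : List J) (f : I → R) (g : J → R) →
    ∑ xs f * ∑ ys g ≡ ∑ xs (λ x → ∑ ys (λ y → f x * g y))
  ∑-*∑ xs ys f g = trans (sym (∑-*ʳ xs (∑ ys g) f)) (∑-cong xs (λ x → sym (∑-* ys (f x) g)))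

  -- Lagrange's identity: twice the difference of the two sides is a sum of squares.
  cauchy-schwarz : ∀ {I : Set} (xs : List I) (f g : I → R) →
    ∑ xs (λ x → f x * g x) * ∑ xs (λ x → f x * g x)
      ≤ ∑ xs (λ x → f x * f x) * ∑ xs (λ x → g x * g x)
  cauchy-schwarz {I} xs f g = cancel {nat 2} (nat-mono (ℕ.s≤s ℕ.z≤n))
    (≤by (∑ xs (λ x → ∑ xs (λ y → sq x y))) (sym expand) (0≤∑ xs (λ x → 0≤∑ xs (λ y → 0≤sq _))))
    where
    C A B : R
    C = ∑ xs (λ x → f x * g x)
    A = ∑ xs (λ x → f x * f x)
    B = ∑ xs (λ x → g x * g x)
    sq : I → I → R
    sq x y = (f x * g y - f y * g x) * (f x * g y - f y * g x)
    eq : ∀ a b c d → (a * b - c * d) * (a * b - c * d) ≡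
      a * a * (b * b) + d * d * (c * c) - nat 2 * (a * d * (c * b))
    eq = solve-∀ ring
    eq₂ : ∀ A B C → A * B + B * A - nat 2 * (C * C) ≡ nat 2 * (A * B) - nat 2 * (C * C)
    eq₂ = solve-∀ ring
    expand : ∑ xs (λ x → ∑ xs (λ y → sq x y)) ≡ nat 2 * (A * B) - nat 2 * (C * C)
    expand = begin
      ∑ xs (λ x → ∑ xs (λ y → sq x y))
        ≡⟨ ∑-cong xs (λ x → ∑-cong xs (λ y → eq (f x) (g y) (f y) (g x))) ⟩
      ∑ xs (λ x → ∑ xs (λ y → p x y + q x y - r x y))
        ≡⟨ ∑-cong xs (λ x → trans (∑-- xs _ _) (cong (_- ∑ xs (r x)) (∑-+ xs _ _))) ⟩
      ∑ xs (λ x → ∑ xs (p x) + ∑ xs (q x) - ∑ xs (r x))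
        ≡⟨ trans (∑-- xs _ _) (cong (_- ∑ xs (λ x → ∑ xs (r x))) (∑-+ xs _ _)) ⟩
      ∑ xs (λ x → ∑ xs (p x)) + ∑ xs (λ x → ∑ xs (q x)) - ∑ xs (λ x → ∑ xs (r x))
        ≡⟨ cong₂ _-_ (cong₂ _+_ (sym (∑-*∑ xs xs _ _)) (sym (∑-*∑ xs xs _ _)))
             (trans (∑-cong xs (λ x → ∑-* xs (nat 2) _))
               (trans (∑-* xs (nat 2) _) (cong (nat 2 *_) (sym (∑-*∑ xs xs _ _))))) ⟩
      A * B + B * A - nat 2 * (C * C)
        ≡⟨ eq₂ A B C ⟩
      nat 2 * (A * B) - nat 2 * (C * C) ∎
      where
      open ≡-Reasoning
      p q r : I → I → R
      p x y = f x * f x * (g y * g y)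
      q x y = g x * g x * (f y * f y)
      r x y = nat 2 * (f x * g x * (f y * g y))

  indicator : ∀ {P : Set} → Dec P → R
  indicator (yes _) = 1#
  indicator (no _) = 0#

  infixr 6 _⊕_

  _⊕_ : List ℤ → List ℤ → List ℤ
  _⊕_ = cartesianProductWith ℤ._+_

  neg : List ℤ → List ℤ
  neg = map (λ x → ℤ.- x)

  ∑-⊕ : ∀ L M f → ∑ (L ⊕ M) f ≡ ∑ L (λ x → ∑ M (λ y → f (x ℤ.+ y)))
  ∑-⊕ = ∑-cartesianWith ℤ._+_

  len-⊕ : ∀ L M → len (L ⊕ M) ≡ len L * len M
  len-⊕ L M = trans (∑-⊕ L M _) (∑-const L (len M))

  ∈-⊕ : ∀ L M {l} → l ∈ L ⊕ M → ∃[ x ] ∃[ y ] (x ∈ L × y ∈ M × l ≡ x ℤ.+ y)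
  ∈-⊕ = ∈-cartesianProductWith⁻ ℤ._+_

  range : ℕ → List ℤ
  range zero = []
  range (suc n) = + n ∷ range n

  len-range : ∀ n → len (range n) ≡ nat n
  len-range zero = refl
  len-range (suc n) = cong₂ _+_ (refl {x = 1#}) (len-range n)

  -- Functions on ℤ modulo N and Sidon sets

  module Cyclic (N : ℕ) .{{_ : ℕ.NonZero N}} where

    Z : List ℤ
    Z = range N

    1≤N : 1# ≤ nat N
    1≤N = nat-mono (ℕ.>-nonZero⁻¹ N)

    δ : ℤ → R
    δ y = indicator (+ N ∣? y)

    -- A function on ℤ/N is encoded as a periodic function on ℤ, and sums over ℤ/N run over the
    -- representatives in `Z`.
    Per : (ℤ → R) → Set
    Per φ = ∀ y z → + N ∣ y ℤ.- z → φ y ≡ φ z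

    0≤δ : ∀ y → 0# ≤ δ y
    0≤δ y with + N ∣? y
    ... | yes _ = 0≤nat
    ... | no _ = ≤-refl

    δ-≤ : ∀ y {c} → (+ N ∣ y → 1# ≤ c) → 0# ≤ c → δ y ≤ c
    δ-≤ y h h′ with + N ∣? y
    ... | yes p = h p
    ... | no _ = h′

    1≤δ : ∀ y → + N ∣ y → 1# ≤ δ y
    1≤δ y p with + N ∣? y
    ... | yes _ = ≤-refl
    ... | no ¬p = ⊥-elim (¬p p)

    δ-mono : ∀ y z → (+ N ∣ y → + N ∣ z) → δ y ≤ δ z
    δ-mono y z h = δ-≤ y (λ p → 1≤δ z (h p)) (0≤δ z)

    δ-cong : ∀ y z → (+ N ∣ y → + N ∣ z) → (+ N ∣ z → + N ∣ y) → δ y ≡ δ z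
    δ-cong y z h h′ = ≤-antisym (δ-mono y z h) (δ-mono z y h′)

    -- The equation argument lets the ring solver supply the combination.
    ∣-+ : ∀ {x y z} → + N ∣ x → + N ∣ y → x ℤ.+ y ≡ z → + N ∣ z
    ∣-+ p q refl = ∣m∣n⇒∣m+n p q

    ∣-neg : ∀ {x z} → + N ∣ x → ℤ.- x ≡ z → + N ∣ z
    ∣-neg p refl = ∣m⇒∣-m p

    δ-even : ∀ {y z} → ℤ.- y ≡ z → δ y ≡ δ z
    δ-even {y} refl = δ-cong y (ℤ.- y) ∣m⇒∣-m (λ p → ∣-neg p (ℤ.neg-involutive y))

    δ-per : Per δ
    δ-per y z p = δ-cong y z (λ q → ∣-+ q (∣m⇒∣-m p) (eq₁ y z)) (λ q → ∣-+ p q (eq₂ y z))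
      where
      eq₁ : ∀ y z → y ℤ.+ ℤ.- (y ℤ.- z) ≡ z
      eq₁ = solve-ℤ
      eq₂ : ∀ y z → (y ℤ.- z) ℤ.+ z ≡ y
      eq₂ = solve-ℤ

    per-shift : ∀ {φ} c → Per φ → Per (λ y → φ (y ℤ.+ c))
    per-shift c h y z p = h _ _ (subst (+ N ∣_) (eq y z c) p)
      where
      eq : ∀ y z c → y ℤ.- z ≡ (y ℤ.+ c) ℤ.- (z ℤ.+ c)
      eq = solve-ℤ

    per-reflect : ∀ {φ} c → Per φ → Per (λ y → φ (c ℤ.- y))
    per-reflect c h y z p = h _ _ (∣-neg p (eq y z c))
      where
      eq : ∀ y z c → ℤ.- (y ℤ.- z) ≡ (c ℤ.- y) ℤ.- (c ℤ.- z)
      eq = solve-ℤ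

    per-∑ : ∀ {I : Set} (xs : List I) {φ : I → ℤ → R} → (∀ i → Per (φ i)) → Per (λ y → ∑ xs (λ i → φ i y))
    per-∑ xs h y z p = ∑-cong xs (λ i → h i y z p)

    per₂ : ∀ (_∙_ : R → R → R) {φ ψ} → Per φ → Per ψ → Per (λ y → φ y ∙ ψ y)
    per₂ _∙_ h k y z p = cong₂ _∙_ (h y z p) (k y z p)

    δ-subst : ∀ {φ} → Per φ → ∀ y z → δ (y ℤ.- z) * φ y ≡ δ (y ℤ.- z) * φ z
    δ-subst {φ} h y z with + N ∣? (y ℤ.- z)
    ... | yes p = cong (1# *_) (h y z p)
    ... | no _ = eq (φ y) (φ z)
      where
      eq : ∀ a b → 0# * a ≡ 0# * b
      eq = solve-∀ ring

    -- A shift by 1 telescopes, and its two boundary values ψ(0) and ψ(N) agree by periodicity;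
    -- larger shifts are iterated.
    ∑-shift-ℕ : ∀ {φ} → Per φ → ∀ k → ∑ Z (λ z → φ (z ℤ.+ + k)) ≡ ∑ Z φ
    ∑-shift-ℕ {φ} h zero = ∑-cong Z (λ z → cong φ (ℤ.+-identityʳ z))
    ∑-shift-ℕ {φ} h (suc k) = begin
      ∑ Z (λ z → φ (z ℤ.+ + suc k)) ≡⟨ ∑-cong Z (λ z → cong φ (assoc z)) ⟩
      ∑ Z (λ z → ψ (z ℤ.+ + 1))     ≡⟨ step (per-shift (+ k) h) ⟩
      ∑ Z ψ                         ≡⟨ ∑-shift-ℕ h k ⟩
      ∑ Z φ                         ∎
      where
      open ≡-Reasoning
      ψ : ℤ → R
      ψ z = φ (z ℤ.+ + k)
      assoc : ∀ z → z ℤ.+ + suc k ≡ z ℤ.+ + 1 ℤ.+ + k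
      assoc z = sym (ℤ.+-assoc z (+ 1) (+ k))
      telescope : ∀ (ψ : ℤ → R) n → ∑ (range n) (λ z → ψ (z ℤ.+ + 1)) + ψ (+ 0) ≡ ∑ (range n) ψ + ψ (+ n)
      telescope ψ zero = refl
      telescope ψ (suc n) = begin
        ψ (+ n ℤ.+ + 1) + ∑ (range n) (λ z → ψ (z ℤ.+ + 1)) + ψ (+ 0)
          ≡⟨ eq₁ _ _ _ ⟩
        ψ (+ n ℤ.+ + 1) + (∑ (range n) (λ z → ψ (z ℤ.+ + 1)) + ψ (+ 0))
          ≡⟨ cong₂ _+_ (cong (λ i → ψ (+ i)) (ℕ.+-comm n 1)) (telescope ψ n) ⟩
        ψ (+ suc n) + (∑ (range n) ψ + ψ (+ n))
          ≡⟨ eq₂ _ _ _ ⟩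
        ψ (+ n) + ∑ (range n) ψ + ψ (+ suc n) ∎
        where
        eq₁ : ∀ a b c → a + b + c ≡ a + (b + c)
        eq₁ = solve-∀ ring
        eq₂ : ∀ a b c → a + (b + c) ≡ c + b + a
        eq₂ = solve-∀ ring
      step : ∀ {ψ} → Per ψ → ∑ Z (λ z → ψ (z ℤ.+ + 1)) ≡ ∑ Z ψ
      step {ψ} h = begin
        ∑ Z (λ z → ψ (z ℤ.+ + 1))                     ≡⟨ eq₁ _ (ψ (+ 0)) ⟩
        ∑ Z (λ z → ψ (z ℤ.+ + 1)) + ψ (+ 0) - ψ (+ 0) ≡⟨ cong (_- ψ (+ 0)) (telescope ψ N) ⟩
        ∑ Z ψ + ψ (+ N) - ψ (+ 0)                     ≡⟨ cong (λ a → ∑ Z ψ + a - ψ (+ 0))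
            (h _ _ (subst (+ N ∣_) (sym (ℤ.+-identityʳ (+ N))) ∣-refl)) ⟩
        ∑ Z ψ + ψ (+ 0) - ψ (+ 0)                     ≡⟨ sym (eq₁ _ (ψ (+ 0))) ⟩
        ∑ Z ψ                                         ∎
        where
        eq₁ : ∀ a b → a ≡ a + b - b
        eq₁ = solve-∀ ring

    ∑-shift : ∀ {φ} → Per φ → ∀ c → ∑ Z (λ z → φ (z ℤ.+ c)) ≡ ∑ Z φ
    ∑-shift {φ} h (+ k) = ∑-shift-ℕ h k
    ∑-shift {φ} h c@(ℤ.-[1+ k ]) =
      trans (sym (∑-shift-ℕ (per-shift c h) (suc k))) (∑-cong Z (λ z → cong φ (eq z)))
      where
      assoc : ∀ z k → z ℤ.+ k ℤ.+ ℤ.- k ≡ z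
      assoc = solve-ℤ
      eq : ∀ z → z ℤ.+ + suc k ℤ.+ c ≡ z
      eq z = assoc z (+ suc k)

    ∑-δ : ∑ Z δ ≡ 1#
    ∑-δ = subst (λ n → ∑ (range n) δ ≡ 1#) (ℕ.suc-pred N)
      (partial (ℕ.pred N) (ℕ.≤-reflexive (ℕ.suc-pred N)))
      where
      partial : ∀ n → n ℕ.< N → ∑ (range (suc n)) δ ≡ 1#
      partial zero _ with + N ∣? (+ 0)
      ... | yes _ = refl
      ... | no ¬p = ⊥-elim (¬p (divides (+ 0) refl))
      partial (suc n) h = cong₂ _+_ δ-0 (partial n (ℕ.<⇒≤ h))
        where
        δ-0 : δ (+ suc n) ≡ 0#
        δ-0 with + N ∣? (+ suc n)
        ... | yes p = ⊥-elim (ℕ.<⇒≱ h (ℕ.∣⇒≤ (∣⇒∣ᵤ p)))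
        ... | no _ = refl

    ∑-reproducing : ∀ {φ} → Per φ → ∀ c → ∑ Z (λ z → δ (z ℤ.- c) * φ z) ≡ φ c
    ∑-reproducing {φ} h c = begin
      ∑ Z (λ z → δ (z ℤ.- c) * φ z) ≡⟨ ∑-cong Z (λ z → δ-subst h z c) ⟩
      ∑ Z (λ z → δ (z ℤ.- c) * φ c) ≡⟨ ∑-*ʳ Z (φ c) (λ z → δ (z ℤ.- c)) ⟩
      ∑ Z (λ z → δ (z ℤ.- c)) * φ c ≡⟨ cong (_* φ c) (trans (∑-shift δ-per (ℤ.- c)) ∑-δ) ⟩
      1# * φ c                      ≡⟨ eq (φ c) ⟩
      φ c                           ∎
      where
      open ≡-Reasoning
      eq : ∀ a → 1# * a ≡ a
      eq = solve-∀ ring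

    -- Convolution with the counting function of `L`, where repeated entries count separately. With
    -- `δ` it gives the representation function `r`.
    _⋆_ : List ℤ → (ℤ → R) → ℤ → R
    (L ⋆ f) y = ∑ L (λ l → f (y ℤ.- l))

    r : List ℤ → ℤ → R
    r L = L ⋆ δ

    ⋆-per : ∀ L {f} → Per f → Per (L ⋆ f)
    ⋆-per L h = per-∑ L (λ l → per-shift (ℤ.- l) h)

    r-per : ∀ L → Per (r L)
    r-per L = ⋆-per L δ-per

    0≤r : ∀ L y → 0# ≤ r L y
    0≤r L y = 0≤∑ L (λ l → 0≤δ (y ℤ.- l))

    ∑-⋆ : ∀ L {f} → Per f → ∑ Z (L ⋆ f) ≡ len L * ∑ Z f
    ∑-⋆ L {f} h = trans (∑-swap Z L (λ z l → f (z ℤ.- l)))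
      (trans (∑-cong L (λ l → ∑-shift h (ℤ.- l))) (∑-const L (∑ Z f)))

    ∑-r : ∀ L → ∑ Z (r L) ≡ len L
    ∑-r L = trans (∑-⋆ L δ-per) (trans (cong (len L *_) ∑-δ) (eq (len L)))
      where
      eq : ∀ a → a * 1# ≡ a
      eq = solve-∀ ring

    ⊕-⋆ : ∀ L M f y → ((L ⊕ M) ⋆ f) y ≡ (L ⋆ (M ⋆ f)) y
    ⊕-⋆ L M f y = trans (∑-⊕ L M _) (∑-cong L (λ l → ∑-cong M (λ m → cong f (eq y l m))))
      where
      eq : ∀ y l m → y ℤ.- (l ℤ.+ m) ≡ y ℤ.- l ℤ.- m
      eq = solve-ℤ

    ∑-r* : ∀ L {φ} → Per φ → ∑ Z (λ z → r L z * φ z) ≡ ∑ L φ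
    ∑-r* L {φ} h = begin
      ∑ Z (λ z → r L z * φ z)                  ≡⟨ ∑-cong Z (λ z → sym (∑-*ʳ L (φ z) (λ l → δ (z ℤ.- l)))) ⟩
      ∑ Z (λ z → ∑ L (λ l → δ (z ℤ.- l) * φ z)) ≡⟨ ∑-swap Z L (λ z l → δ (z ℤ.- l) * φ z) ⟩
      ∑ L (λ l → ∑ Z (λ z → δ (z ℤ.- l) * φ z)) ≡⟨ ∑-cong L (λ l → ∑-reproducing h l) ⟩
      ∑ L φ ∎
      where open ≡-Reasoning

    r-inner : ∀ L M → ∑ Z (λ z → r L z * r M z) ≡ ∑ L (λ l → ∑ M (λ m → δ (l ℤ.- m)))
    r-inner L M = ∑-r* L (r-per M)

    -- A point where `r L` is positive is congruent to an entry of `L`, where the bound is assumed.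
    -- No entry has to be chosen: the inequality is multiplied by `r L y`, moved to the entries
    -- along `δ`, and the factor is cancelled.
    r-bounded : ∀ L {f} → Per f → (∀ y → 0# ≤ f y) → (∀ l → l ∈ L → r L l ≤ f l) → ∀ y → r L y ≤ f y
    r-bounded L {f} h 0≤f bound y with 1# ≤? r L y
    ... | no ¬p = ≤-trans (≤by _ (eq (r L y)) (gap (≰⇒1+≤ ¬p))) (0≤f y)
      where
      eq : ∀ a → 0# - a ≡ 1# - (1# + a)
      eq = solve-∀ ring
    ... | yes p = cancel p (begin
      r L y * r L y                     ≡⟨ sym (∑-*ʳ L (r L y) (λ l → δ (y ℤ.- l))) ⟩
      ∑ L (λ l → δ (y ℤ.- l) * r L y)   ≡⟨ ∑-cong L (λ l → δ-subst (r-per L) y l) ⟩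
      ∑ L (λ l → δ (y ℤ.- l) * r L l)   ≤⟨ ∑-mono∈ L (λ l l∈ → *-monoˡ (0≤δ (y ℤ.- l)) (bound l l∈)) ⟩
      ∑ L (λ l → δ (y ℤ.- l) * f l)     ≡⟨ ∑-cong L (λ l → sym (δ-subst h y l)) ⟩
      ∑ L (λ l → δ (y ℤ.- l) * f y)     ≡⟨ ∑-*ʳ L (f y) (λ l → δ (y ℤ.- l)) ⟩
      r L y * f y                       ∎)
      where open ≤-Reasoning

    Distinct : List ℤ → Set
    Distinct X = ∀ c → ∑ X (λ x → δ (x ℤ.- c)) ≤ 1#

    -- In `sums` a single coincidence is enough: the hypothesis then makes the remaining two
    -- elements congruent as well.
    record Sidon (X : List ℤ) : Set where
      field
        sums : ∀ {x₁ x₂ x₃ x₄} → x₁ ∈ X → x₂ ∈ X → x₃ ∈ X → x₄ ∈ X →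
          + N ∣ (x₁ ℤ.+ x₂) ℤ.- (x₃ ℤ.+ x₄) → + N ∣ x₁ ℤ.- x₃ ⊎ + N ∣ x₂ ℤ.- x₃
        distinct : Distinct X

    open Sidon

    -- In x₁ + x₂ ≡ x₃ + x₄ the element x₃ is congruent to x₁ or to x₂, and it then determines x₄.
    -- It suffices to check values that are sums, by `r-bounded`.
    sums≤2 : ∀ {X} → Sidon X → ∀ y → r (X ⊕ X) y ≤ nat 2
    sums≤2 {X} sidon = r-bounded (X ⊕ X) (λ _ _ _ → refl) (λ _ → 0≤nat) bound
      where
      ones : ∀ x → ∑ X (λ x₃ → δ (x₃ ℤ.- x)) ≤ 1#
      ones = distinct sidon
      pointwise : ∀ {x₁ x₂ x₃ x₄} → x₁ ∈ X → x₂ ∈ X → x₃ ∈ X → x₄ ∈ X →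
        δ (x₁ ℤ.+ x₂ ℤ.- (x₃ ℤ.+ x₄)) ≤ (δ (x₃ ℤ.- x₁) + δ (x₃ ℤ.- x₂)) * δ (x₄ ℤ.- (x₁ ℤ.+ x₂ ℤ.- x₃))
      pointwise {x₁} {x₂} {x₃} {x₄} p₁ p₂ p₃ p₄ = δ-≤ _ case
        (0≤* (0≤+ (0≤δ _) (0≤δ _)) (0≤δ _))
        where
        eq₁ : ∀ x₁ x₂ x₃ x₄ → ℤ.- (x₁ ℤ.+ x₂ ℤ.- (x₃ ℤ.+ x₄)) ≡ x₄ ℤ.- (x₁ ℤ.+ x₂ ℤ.- x₃)
        eq₁ = solve-ℤ
        eq₂ : ∀ x y → ℤ.- (x ℤ.- y) ≡ y ℤ.- x
        eq₂ = solve-ℤ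
        case : + N ∣ x₁ ℤ.+ x₂ ℤ.- (x₃ ℤ.+ x₄) →
          1# ≤ (δ (x₃ ℤ.- x₁) + δ (x₃ ℤ.- x₂)) * δ (x₄ ℤ.- (x₁ ℤ.+ x₂ ℤ.- x₃))
        case q = 1≤* lem (1≤δ _ (∣-neg q (eq₁ x₁ x₂ x₃ x₄)))
          where
          lem : 1# ≤ δ (x₃ ℤ.- x₁) + δ (x₃ ℤ.- x₂)
          lem with sums sidon p₁ p₂ p₃ p₄ q
          ... | inj₁ p = +-mono (1≤δ _ (∣-neg p (eq₂ x₁ x₃))) (0≤δ _)
          ... | inj₂ p = +-mono (0≤δ _) (1≤δ _ (∣-neg p (eq₂ x₂ x₃)))
      bound : ∀ l → l ∈ X ⊕ X → r (X ⊕ X) l ≤ nat 2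
      bound l l∈ with ∈-⊕ X X l∈
      ... | x₁ , x₂ , p₁ , p₂ , refl = begin
        r (X ⊕ X) (x₁ ℤ.+ x₂)
          ≡⟨ ∑-⊕ X X _ ⟩
        ∑ X (λ x₃ → ∑ X (λ x₄ → δ (x₁ ℤ.+ x₂ ℤ.- (x₃ ℤ.+ x₄))))
          ≤⟨ ∑-mono∈ X (λ x₃ p₃ → ≤-trans (∑-mono∈ X (λ x₄ p₄ → pointwise p₁ p₂ p₃ p₄))
               (≤-trans (≤-reflexive (∑-* X _ _))
                 (*-monoˡ (0≤+ (0≤δ _) (0≤δ _)) (ones (x₁ ℤ.+ x₂ ℤ.- x₃))))) ⟩
        ∑ X (λ x₃ → (δ (x₃ ℤ.- x₁) + δ (x₃ ℤ.- x₂)) * 1#)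
          ≡⟨ trans (∑-*ʳ X 1# _) (cong (_* 1#) (∑-+ X _ _)) ⟩
        (∑ X (λ x₃ → δ (x₃ ℤ.- x₁)) + ∑ X (λ x₃ → δ (x₃ ℤ.- x₂))) * 1#
          ≤⟨ *-monoʳ 0≤1 (+-mono (ones x₁) (ones x₂)) ⟩
        nat 2 ∎
        where open ≤-Reasoning

    -- The congruence x₁ - x₂ ≡ x₃ - x₄ is read as x₁ + x₄ ≡ x₃ + x₂. Either x₃ ≡ x₁, which fixes x₄
    -- too, or x₄ ≡ x₃ and the difference is 0; the second case has at most `len X` representations.
    differences≤ : ∀ {X} → Sidon X → ∀ y → r (X ⊕ neg X) y ≤ 1# + len X * δ y
    differences≤ {X} sidon = r-bounded (X ⊕ neg X)
      (per₂ (λ _ a → 1# + len X * a) δ-per δ-per)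
      (λ y → 0≤+ 0≤1 (0≤* (0≤len X) (0≤δ y))) bound
      where
      ones : ∀ x → ∑ X (λ x₃ → δ (x₃ ℤ.- x)) ≤ 1#
      ones = distinct sidon
      bound : ∀ l → l ∈ X ⊕ neg X → r (X ⊕ neg X) l ≤ 1# + len X * δ l
      bound l l∈ with ∈-⊕ X (neg X) l∈
      ... | x₁ , _ , p₁ , q₂ , refl with ∈-map⁻ (λ x → ℤ.- x) q₂
      ... | x₂ , p₂ , refl = begin
        r (X ⊕ neg X) (x₁ ℤ.- x₂)
          ≡⟨ trans (∑-⊕ X (neg X) _) (∑-cong X (λ x₃ → ∑-map (λ x → ℤ.- x) X _)) ⟩
        ∑ X (λ x₃ → ∑ X (λ x₄ → δ (x₁ ℤ.- x₂ ℤ.- (x₃ ℤ.- x₄))))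
          ≤⟨ ∑-mono∈ X (λ x₃ p₃ → ∑-mono∈ X (λ x₄ p₄ → pointwise p₃ p₄)) ⟩
        ∑ X (λ x₃ → ∑ X (λ x₄ → δ (x₃ ℤ.- x₁) * δ (x₄ ℤ.- (x₂ ℤ.+ x₃ ℤ.- x₁)) + d * δ (x₄ ℤ.- x₃)))
          ≡⟨ ∑-cong X (λ x₃ → trans (∑-+ X _ _) (cong₂ _+_ (∑-* X _ _) (∑-* X _ _))) ⟩
        ∑ X (λ x₃ → δ (x₃ ℤ.- x₁) * ∑ X (λ x₄ → δ (x₄ ℤ.- (x₂ ℤ.+ x₃ ℤ.- x₁))) + d * ∑ X (λ x₄ → δ (x₄ ℤ.- x₃)))
          ≤⟨ ∑-mono X (λ x₃ → +-mono (*-monoˡ (0≤δ (x₃ ℤ.- x₁)) (ones _)) (*-monoˡ (0≤δ _) (ones x₃))) ⟩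
        ∑ X (λ x₃ → δ (x₃ ℤ.- x₁) * 1# + d * 1#)
          ≡⟨ trans (∑-+ X _ _) (cong₂ _+_ (∑-*ʳ X 1# _) (∑-const X _)) ⟩
        ∑ X (λ x₃ → δ (x₃ ℤ.- x₁)) * 1# + len X * (d * 1#)
          ≤⟨ +-mono (*-monoʳ 0≤1 (ones x₁)) ≤-refl ⟩
        1# * 1# + len X * (d * 1#)
          ≡⟨ eq (len X) d ⟩
        1# + len X * d ∎
        where
        open ≤-Reasoning
        d : R
        d = δ (x₁ ℤ.- x₂)
        eq : ∀ a d → 1# * 1# + a * (d * 1#) ≡ 1# + a * d
        eq = solve-∀ ring
        pointwise : ∀ {x₃ x₄} → x₃ ∈ X → x₄ ∈ X → δ (x₁ ℤ.- x₂ ℤ.- (x₃ ℤ.- x₄)) ≤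
          δ (x₃ ℤ.- x₁) * δ (x₄ ℤ.- (x₂ ℤ.+ x₃ ℤ.- x₁)) + d * δ (x₄ ℤ.- x₃)
        pointwise {x₃} {x₄} p₃ p₄ = δ-≤ _ case (0≤+ (0≤* (0≤δ _) (0≤δ _)) (0≤* (0≤δ _) (0≤δ _)))
          where
          eq₁ : ∀ x₁ x₂ x₃ x₄ → x₁ ℤ.- x₂ ℤ.- (x₃ ℤ.- x₄) ≡ x₁ ℤ.+ x₄ ℤ.- (x₃ ℤ.+ x₂)
          eq₁ = solve-ℤ
          eq₂ : ∀ x y → ℤ.- (x ℤ.- y) ≡ y ℤ.- x
          eq₂ = solve-ℤ
          eq₃ : ∀ x₁ x₂ x₃ x₄ → x₁ ℤ.- x₂ ℤ.- (x₃ ℤ.- x₄) ≡ x₄ ℤ.- (x₂ ℤ.+ x₃ ℤ.- x₁)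
          eq₃ = solve-ℤ
          eq₄ : ∀ x₁ x₂ x₃ x₄ → x₁ ℤ.- x₂ ℤ.- (x₃ ℤ.- x₄) ℤ.+ ℤ.- (x₄ ℤ.- x₃) ≡ x₁ ℤ.- x₂
          eq₄ = solve-ℤ
          case : + N ∣ x₁ ℤ.- x₂ ℤ.- (x₃ ℤ.- x₄) →
            1# ≤ δ (x₃ ℤ.- x₁) * δ (x₄ ℤ.- (x₂ ℤ.+ x₃ ℤ.- x₁)) + d * δ (x₄ ℤ.- x₃)
          case q with sums sidon p₁ p₄ p₃ p₂ (subst (+ N ∣_) (eq₁ x₁ x₂ x₃ x₄) q)
          ... | inj₁ p = +-mono (1≤* (1≤δ _ (∣-neg p (eq₂ x₁ x₃)))
                  (1≤δ _ (subst (+ N ∣_) (eq₃ x₁ x₂ x₃ x₄) q))) (0≤* (0≤δ _) (0≤δ _))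
          ... | inj₂ p = +-mono (0≤* (0≤δ _) (0≤δ _))
                  (1≤* (1≤δ _ (∣-+ q (∣m⇒∣-m p) (eq₄ x₁ x₂ x₃ x₄))) (1≤δ _ p))

    -- The left side counts x + y ≡ x′ + y′. Regrouped as x - x′ ≡ y′ - y, each pair (y, y′)
    -- contributes one solution by `differences≤`, plus `len X` when y ≡ y′.
    mixed-energy : ∀ {X} → Sidon X → ∀ Y →
      ∑ Z (λ z → r (X ⊕ Y) z * r (X ⊕ Y) z) ≤ len Y * len Y + len X * ∑ Y (λ y → ∑ Y (λ y′ → δ (y ℤ.- y′)))
    mixed-energy {X} sidon Y = begin
      ∑ Z (λ z → r (X ⊕ Y) z * r (X ⊕ Y) z)
        ≡⟨ r-inner (X ⊕ Y) (X ⊕ Y) ⟩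
      ∑ (X ⊕ Y) (λ l → ∑ (X ⊕ Y) (λ l′ → δ (l ℤ.- l′)))
        ≡⟨ trans (∑-⊕ X Y _) (∑-cong X (λ x → ∑-cong Y (λ y → ∑-⊕ X Y _))) ⟩
      ∑ X (λ x → ∑ Y (λ y → ∑ X (λ x′ → ∑ Y (λ y′ → δ (x ℤ.+ y ℤ.- (x′ ℤ.+ y′))))))
        ≡⟨ trans (∑-swap X Y _) (∑-cong Y (λ y → trans (∑-cong X (λ x → ∑-swap X Y _)) (∑-swap X Y _))) ⟩
      ∑ Y (λ y → ∑ Y (λ y′ → ∑ X (λ x → ∑ X (λ x′ → δ (x ℤ.+ y ℤ.- (x′ ℤ.+ y′))))))
        ≡⟨ ∑-cong Y (λ y → ∑-cong Y (λ y′ → sym (trans (∑-⊕ X (neg X) _)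
             (∑-cong X (λ x → trans (∑-map (λ x → ℤ.- x) X _) (∑-cong X (λ x′ → δ-even (eq x y x′ y′)))))))) ⟩
      ∑ Y (λ y → ∑ Y (λ y′ → r (X ⊕ neg X) (y′ ℤ.- y)))
        ≤⟨ ∑-mono Y (λ y → ∑-mono Y (λ y′ → differences≤ sidon (y′ ℤ.- y))) ⟩
      ∑ Y (λ y → ∑ Y (λ y′ → 1# + len X * δ (y′ ℤ.- y)))
        ≡⟨ ∑-cong Y (λ y → trans (∑-+ Y _ _) (cong₂ _+_ refl (∑-* Y _ _))) ⟩
      ∑ Y (λ y → len Y + len X * ∑ Y (λ y′ → δ (y′ ℤ.- y)))
        ≡⟨ trans (∑-+ Y _ _) (cong₂ _+_ (∑-const Y _) (∑-* Y _ _)) ⟩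
      len Y * len Y + len X * ∑ Y (λ y → ∑ Y (λ y′ → δ (y′ ℤ.- y)))
        ≡⟨ cong (λ a → len Y * len Y + len X * a) (∑-swap Y Y _) ⟩
      len Y * len Y + len X * ∑ Y (λ y → ∑ Y (λ y′ → δ (y ℤ.- y′))) ∎
      where
      open ≤-Reasoning
      eq : ∀ x y x′ y′ → ℤ.- (y′ ℤ.- y ℤ.- (x ℤ.- x′)) ≡ x ℤ.+ y ℤ.- (x′ ℤ.+ y′)
      eq = solve-ℤ

    mixed-energy-distinct : ∀ {X} → Sidon X → ∀ Y → Distinct Y →
      ∑ Z (λ z → r (X ⊕ Y) z * r (X ⊕ Y) z) ≤ len Y * len Y + len X * len Y
    mixed-energy-distinct {X} sidon Y distinct = ≤-trans (mixed-energy sidon Y)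
      (+-mono ≤-refl (*-monoˡ (0≤len X) (≤-trans (≤-reflexive (∑-swap Y Y _)) (∑-mono Y distinct))))

  -- Powers, lists confined to a short interval, and a variance inequality

  infixr 8 _^_

  _^_ : R → ℕ → R
  x ^ zero = 1#
  x ^ suc k = x * x ^ k

  1≤^ : ∀ {x} → 1# ≤ x → ∀ k → 1# ≤ x ^ k
  1≤^ h zero = ≤-refl
  1≤^ h (suc k) = 1≤* h (1≤^ h k)

  -- Pairwise closeness confines a list to an interval of length `n`. Multiples by `c` then stay
  -- distinct modulo `N` as long as c n ≤ N, which plain distinctness modulo `N` would not give.
  Close : ℕ → ℤ → ℤ → Set
  Close n x y = 0 ℕ.< ℤ.∣ x ℤ.- y ∣ × ℤ.∣ x ℤ.- y ∣ ℕ.< n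

  range-close : ∀ n → AllPairs (Close n) (range n)
  range-close n = pairs n ℕ.≤-refl
    where
    below : ∀ k j → j ℕ.≤ k → k ℕ.< n → All (Close n (+ k)) (range j)
    below k zero _ _ = []
    below k (suc j) j<k k<n = (subst (0 ℕ.<_) (sym eq) (ℕ.m<n⇒0<n∸m j<k) ,
        subst (ℕ._< n) (sym eq) (ℕ.≤-<-trans (ℕ.m∸n≤m k j) k<n)) ∷
            below k j (ℕ.<⇒≤ j<k) k<n
      where
      eq : ℤ.∣ + k ℤ.- + j ∣ ≡ k ℕ.∸ j
      eq = trans (cong ℤ.∣_∣ (trans (ℤ.m-n≡m⊖n k j) (ℤ.⊖-≥ (ℕ.<⇒≤ j<k)))) refl
    pairs : ∀ k → k ℕ.≤ n → AllPairs (Close n) (range k)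
    pairs zero _ = []
    pairs (suc k) h = below k k ℕ.≤-refl h ∷ pairs k (ℕ.<⇒≤ h)

  translate-close : ∀ {n} c {L} → AllPairs (Close n) L → AllPairs (Close n) (map (λ x → x ℤ.- c) L)
  translate-close c pairs = AllPairs.map⁺ (AllPairs.map (λ {x} {y} → subst (λ d → 0 ℕ.< ℤ.∣ d ∣ × ℤ.∣ d ∣ ℕ.< _) (eq x y c)) pairs)
    where
    eq : ∀ x y c → x ℤ.- y ≡ x ℤ.- c ℤ.- (y ℤ.- c)
    eq = solve-ℤ

  -- The numbers `len L * d l - ∑ L d` add up to 0, so the cross term with `e` vanishes. What is
  -- given away is `len L` times the square of `∑ L d`, the mean part of the variance.
  ∑-variance : ∀ {I : Set} (L : List I) (d : I → R) e →
    ∑ L (λ l → (e + len L * d l - ∑ L d) * (e + len L * d l - ∑ L d))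
      ≤ len L * (e * e) + len L * len L * ∑ L (λ l → d l * d l)
  ∑-variance L d e = ≤by (q * (h * h)) final (0≤* (0≤len L) (0≤sq h))
    where
    q h s : R
    q = len L
    h = ∑ L d
    s = ∑ L (λ l → d l * d l)
    eq₁ : ∀ e q d h → (e + q * d - h) * (e + q * d - h) ≡
      (e - h) * (e - h) + nat 2 * q * (e - h) * d + q * q * (d * d)
    eq₁ = solve-∀ ring
    expand : ∑ L (λ l → (e + q * d l - h) * (e + q * d l - h)) ≡
      q * ((e - h) * (e - h)) + nat 2 * q * (e - h) * h + q * q * s
    expand = trans (∑-cong L (λ l → eq₁ e q (d l) h))
      (trans (∑-+ L _ _) (cong₂ _+_ (trans (∑-+ L _ _) (cong₂ _+_ (∑-const L _) (∑-* L _ d))) (∑-* L _ _)))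
    eq₂ : ∀ e q h s → q * (e * e) + q * q * s - (q * ((e - h) * (e - h)) + nat 2 * q * (e - h) * h + q * q * s)
      ≡ q * (h * h)
    eq₂ = solve-∀ ring
    final : q * (e * e) + q * q * s - ∑ L (λ l → (e + q * d l - h) * (e + q * d l - h)) ≡ q * (h * h)
    final = trans (cong (λ a → q * (e * e) + q * q * s - a) expand) (eq₂ e q h s)

  near-rescale : ∀ k q e c → k ≡ nat 16 * q → 1# ≤ k → k * k * e ≤ nat 8 * (k * (nat 2 * c)) → q * e ≤ c
  near-rescale k q e c refl 1≤k h = cancel {nat 16} (nat-mono (ℕ.s≤s ℕ.z≤n))
    (cancel 1≤k (≤-trans (≤-reflexive (eq₁ q e)) (≤-trans h (≤-reflexive (eq₂ q c)))))
    where
    eq₁ : ∀ q e → nat 16 * q * (nat 16 * (q * e)) ≡ nat 16 * q * (nat 16 * q) * e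
    eq₁ = solve-∀ ring
    eq₂ : ∀ q c → nat 8 * (nat 16 * q * (nat 2 * c)) ≡ nat 16 * q * (nat 16 * c)
    eq₂ = solve-∀ ring

  -- The sampling below takes 16q samples. Each of them multiplies a weight by at most 2 and costs
  -- the potential a factor `D₀`; the leading 2 compares the final slack, at most 2B, with the
  -- initial slack B.
  period-loss : R → ℕ → R
  period-loss D₀ q = nat 2 * (nat 2 ^ (16 ℕ.* q) * D₀ ^ (16 ℕ.* q))

  -- Almost periods

  module Periods (N : ℕ) .{{_ : ℕ.NonZero N}} where
    open Cyclic N
    open Sidon

    infix 9 ‖_‖²

    ‖_‖² : (ℤ → R) → R
    ‖ f ‖² = ∑ Z (λ z → f z * f z)

    0≤‖‖ : ∀ f → 0# ≤ ‖ f ‖²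
    0≤‖‖ f = 0≤∑ Z (λ z → 0≤sq (f z))

    ‖‖-cong : ∀ {f g} → (∀ z → f z ≡ g z) → ‖ f ‖² ≡ ‖ g ‖²
    ‖‖-cong h = ∑-cong Z (λ z → cong₂ _*_ (h z) (h z))

    ‖‖-shift : ∀ {f} c → Per f → ‖ (λ z → f (z ℤ.+ c)) ‖² ≡ ‖ f ‖²
    ‖‖-shift c h = ∑-shift (per₂ _*_ h h) c

    ‖‖-+ : ∀ f g → ‖ (λ z → f z + g z) ‖² ≤ nat 2 * (‖ f ‖² + ‖ g ‖²)
    ‖‖-+ f g = ≤-trans (∑-mono Z (λ z → sq+ (f z) (g z)))
      (≤-reflexive (trans (∑-* Z (nat 2) _) (cong (nat 2 *_) (∑-+ Z _ _))))

    ‖‖-* : ∀ c f → ‖ (λ z → c * f z) ‖² ≡ c * c * ‖ f ‖²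
    ‖‖-* c f = trans (∑-cong Z (λ z → eq c (f z))) (∑-* Z (c * c) _)
      where
      eq : ∀ c x → c * x * (c * x) ≡ c * c * (x * x)
      eq = solve-∀ ring

    ‖‖-neg : ∀ f → ‖ (λ z → - f z) ‖² ≡ ‖ f ‖²
    ‖‖-neg f = ∑-cong Z (λ z → eq (f z))
      where
      eq : ∀ x → - x * - x ≡ x * x
      eq = solve-∀ ring

    close-errors : ∀ {f} u₀ k B (e₀ e : ℤ → R) → Per f → (∀ z → k * f (z ℤ.- u₀) ≡ e₀ z + - e z) →
      ‖ e₀ ‖² ≤ B + B → ‖ e ‖² ≤ B + B → k * k * ‖ f ‖² ≤ nat 8 * B
    close-errors {f} u₀ k B e₀ e f-per difference bound₀ bound = begin
      k * k * ‖ f ‖²                              ≡⟨ cong (k * k *_) (sym (‖‖-shift (ℤ.- u₀) f-per)) ⟩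
      k * k * ‖ (λ z → f (z ℤ.- u₀)) ‖²           ≡⟨ sym (‖‖-* k (λ z → f (z ℤ.- u₀))) ⟩
      ‖ (λ z → k * f (z ℤ.- u₀)) ‖²               ≡⟨ ‖‖-cong difference ⟩
      ‖ (λ z → e₀ z + - e z) ‖²                   ≤⟨ ‖‖-+ e₀ (λ z → - e z) ⟩
      nat 2 * (‖ e₀ ‖² + ‖ (λ z → - e z) ‖²)      ≡⟨ cong (λ a → nat 2 * (‖ e₀ ‖² + a)) (‖‖-neg e) ⟩
      nat 2 * (‖ e₀ ‖² + ‖ e ‖²)                  ≤⟨ *-monoˡ 0≤nat (+-mono bound₀ bound) ⟩
      nat 2 * (B + B + (B + B))                   ≡⟨ eq B ⟩
      nat 8 * B                                   ∎
      where
      open ≤-Reasoning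
      eq : ∀ b → nat 2 * (b + b + (b + b)) ≡ nat 8 * b
      eq = solve-∀ ring

    -- If c u and c v were both congruent to y, then `N` would divide c (u - v), whose absolute
    -- value is positive and less than c n.
    distinct-multiples : ∀ {n L} c → 0 ℕ.< c → c ℕ.* n ℕ.≤ N → AllPairs (Close n) L →
      Distinct (map (λ x → + c ℤ.* x) L)
    distinct-multiples {n} {L} c 0<c cn≤N pairs y = subst (_≤ 1#) (sym (∑-map (λ x → + c ℤ.* x) L (λ x → δ (x ℤ.- y)))) (go pairs)
      where
      indivisible : ∀ {u v} → Close n u v → + N ∣ + c ℤ.* u ℤ.- y → ¬ + N ∣ + c ℤ.* v ℤ.- y
      indivisible {u} {v} (0<d , d<n) p q =
        ℕ.<⇒≱ (ℕ.<-≤-trans (ℕ.*-monoʳ-< c {{ℕ.>-nonZero 0<c}} d<n) cn≤N)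
          (ℕ.∣⇒≤ {{ℕ.>-nonZero (ℕ.*-mono-< 0<c 0<d)}}
            (subst (N ℕ.∣_) (ℤ.abs-* (+ c) (u ℤ.- v)) (∣⇒∣ᵤ (∣-+ p (∣m⇒∣-m q) (eq (+ c) u v y)))))
        where
        eq : ∀ c u v y → c ℤ.* u ℤ.- y ℤ.+ ℤ.- (c ℤ.* v ℤ.- y) ≡ c ℤ.* (u ℤ.- v)
        eq = solve-ℤ
      vanish : ∀ {u L} → All (Close n u) L → + N ∣ + c ℤ.* u ℤ.- y → ∑ L (λ v → δ (+ c ℤ.* v ℤ.- y)) ≤ 0#
      vanish [] _ = ≤-refl
      vanish (close ∷ rest) p = +-mono (δ-≤ _ (λ q → ⊥-elim (indivisible close p q)) ≤-refl) (vanish rest p)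
      go : ∀ {L} → AllPairs (Close n) L → ∑ L (λ v → δ (+ c ℤ.* v ℤ.- y)) ≤ 1#
      go [] = 0≤nat
      go {u ∷ L} (close ∷ rest) with + N ∣? (+ c ℤ.* u ℤ.- y)
      ... | yes p = +-mono (≤-refl {1#}) (vanish close p)
      ... | no _ = +-mono (≤-refl {0#}) (go rest)

    distinct-neg : ∀ X → Distinct X → Distinct (neg X)
    distinct-neg X h c = subst (_≤ 1#)
      (sym (trans (∑-map (λ x → ℤ.- x) X (λ x → δ (x ℤ.- c))) (∑-cong X (λ x → δ-even (eq x c))))) (h (ℤ.- c))
      where
      eq : ∀ x c → ℤ.- (ℤ.- x ℤ.- c) ≡ x ℤ.- ℤ.- c
      eq = solve-ℤ

    module _ {X} (sidon : Sidon X) (1≤m : 1# ≤ len X) where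

      private
        m : R
        m = len X
        1≤m² : 1# ≤ m * m
        1≤m² = 1≤* 1≤m 1≤m

      D H : ℤ → R
      D = r (X ⊕ neg X)
      H = (X ⊕ X) ⋆ D

      D-per : Per D
      D-per = r-per (X ⊕ neg X)

      H-per : Per H
      H-per = ⋆-per (X ⊕ X) D-per

      ‖D‖² : ‖ D ‖² ≤ nat 2 * (m * m)
      ‖D‖² = ≤-trans (mixed-energy-distinct sidon (neg X) (distinct-neg X (distinct sidon)))
        (≤-reflexive (trans (cong (λ a → a * a + m * a) (∑-map _ X _)) (eq m)))
        where
        eq : ∀ m → m * m + m * m ≡ nat 2 * (m * m)
        eq = solve-∀ ring

      m⁶ : R
      m⁶ = m * m * (m * m) * (m * m)

      1≤m⁶ : 1# ≤ m⁶
      1≤m⁶ = 1≤* (1≤* 1≤m² 1≤m²) 1≤m²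

      -- The scale m⁶ is the a priori size of ‖H‖², since 1_X * 1_X has mass m² and ‖D‖² is at most
      -- 2m². Thus `q` measures the gain over the trivial bound.
      Near : ℕ → ℤ → Set
      Near q s = nat q * ‖ (λ z → H (z ℤ.- s) - H z) ‖² ≤ m⁶

      -- The Croot–Sisask sampling argument, derandomised: the potential below loses a factor of at most
      -- D₀ when a further sample x is added, while only shifts u with x − u ∈ X + X keep their weight.
      module Sampling (D₀ : R) (1≤D₀ : 1# ≤ D₀) (N≤ : nat N ≤ D₀ * (m * m)) (n : ℕ) (B : R) (0≤B : 0# ≤ B) where

        C : R
        C = nat 2 * m⁶

        -- If x - u is a random sum of two elements of `X`, then D(z - x) has mean H(z - u) / m². So
        -- `err` is m² times the distance of the sum `G` of `j` samples from its expected value for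
        -- the shift `u`.
        err : (ℤ → R) → ℕ → ℤ → ℤ → R
        err G j u z = m * m * G z - nat j * H (z ℤ.- u)

        slack : (ℤ → R) → ℕ → ℤ → R
        slack G j u = B + nat j * C - ‖ err G j u ‖²

        add : (ℤ → R) → ℤ → ℤ → R
        add G x z = G z + D (z ℤ.- x)

        -- By `∑-variance`, averaging over the next sample raises the squared error by at most m⁴
        -- ‖D‖², which is at most `C`. As `slack` grants a further `C` for each sample, its average
        -- does not decrease.
        slack-sample : ∀ G j u → Per G →
          m * m * slack G j u ≤ ∑ Z (λ x → r (X ⊕ X) (x ℤ.- u) * slack (add G x) (suc j) u)
        slack-sample G j u perG = begin
          m * m * slack G j u
            ≤⟨ ≤by _ (eq₁ (m * m) B (nat j) C E₁ E) (gap errors) ⟩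
          m * m * (B + nat (suc j) * C) - ∑ XX (λ l → ‖ err (add G (l ℤ.+ u)) (suc j) u ‖²)
            ≡⟨ cong (λ a → a * (B + nat (suc j) * C) - E₁) (sym (len-⊕ X X)) ⟩
          len XX * (B + nat (suc j) * C) - ∑ XX (λ l → ‖ err (add G (l ℤ.+ u)) (suc j) u ‖²)
            ≡⟨ sym (trans (∑-- XX _ _) (cong₂ _-_ (∑-const XX _) refl)) ⟩
          ∑ XX (λ l → slack (add G (l ℤ.+ u)) (suc j) u)
            ≡⟨ sym (∑-r* XX (per-shift u slack-per)) ⟩
          ∑ Z (λ x → r XX x * slack (add G (x ℤ.+ u)) (suc j) u)
            ≡⟨ ∑-cong Z (λ x → cong (λ y → r XX y * slack (add G (x ℤ.+ u)) (suc j) u) (eq₂ x u)) ⟩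
          ∑ Z (λ x → r XX (x ℤ.+ u ℤ.- u) * slack (add G (x ℤ.+ u)) (suc j) u)
            ≡⟨ ∑-shift (per₂ _*_ (per-shift (ℤ.- u) (r-per XX)) slack-per) u ⟩
          ∑ Z (λ x → r XX (x ℤ.- u) * slack (add G x) (suc j) u) ∎
          where
          open ≤-Reasoning
          XX : List ℤ
          XX = X ⊕ X
          eq₂ : ∀ x u → x ≡ x ℤ.+ u ℤ.- u
          eq₂ = solve-ℤ
          slack-per : Per (λ x → slack (add G x) (suc j) u)
          slack-per y z p = cong (λ a → B + nat (suc j) * C - a) (‖‖-cong (λ w →
            cong (λ a → m * m * (G w + a) - nat (suc j) * H (w ℤ.- u)) (per-reflect w D-per y z p)))
          E₁ E : R
          E₁ = ∑ XX (λ l → ‖ err (add G (l ℤ.+ u)) (suc j) u ‖²)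
          E = ‖ err G j u ‖²
          eq₁ : ∀ q b k c e₁ e → q * (b + (1# + k) * c) - e₁ - q * (b + k * c - e) ≡ q * (e + c) - e₁
          eq₁ = solve-∀ ring
          d : ℤ → ℤ → R
          d z l = D (z ℤ.- u ℤ.- l)
          e : ℤ → R
          e = err G j u
          eq₃ : ∀ q g d k h → q * (g + d) - (1# + k) * h ≡ q * g - k * h + q * d - h
          eq₃ = solve-∀ ring
          eq₄ : ∀ z l u → z ℤ.- (l ℤ.+ u) ≡ z ℤ.- u ℤ.- l
          eq₄ = solve-ℤ
          err-add : ∀ l z → err (add G (l ℤ.+ u)) (suc j) u z ≡ e z + len XX * d z l - H (z ℤ.- u)
          err-add l z = trans
            (cong (λ a → m * m * (G z + a) - nat (suc j) * H (z ℤ.- u)) (cong D (eq₄ z l u)))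
            (trans (eq₃ (m * m) (G z) (d z l) (nat j) (H (z ℤ.- u)))
              (cong (λ a → e z + a * d z l - H (z ℤ.- u)) (sym (len-⊕ X X))))
          d-energy : ∑ Z (λ z → ∑ XX (λ l → d z l * d z l)) ≡ len XX * ‖ D ‖²
          d-energy = trans (∑-swap Z XX _) (trans (∑-cong XX (λ l →
            trans (‖‖-shift (ℤ.- u) (per-shift (ℤ.- l) D-per)) (‖‖-shift (ℤ.- l) D-per)))
            (∑-const XX ‖ D ‖²))
          eq₅ : ∀ q e → q * e + q * q * (q * (nat 2 * q)) ≡ q * (e + nat 2 * (q * q * q))
          eq₅ = solve-∀ ring
          errors : E₁ ≤ m * m * (E + C)
          errors = begin
            E₁
              ≡⟨ ∑-cong XX (λ l → ‖‖-cong (err-add l)) ⟩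
            ∑ XX (λ l → ‖ (λ z → e z + len XX * d z l - H (z ℤ.- u)) ‖²)
              ≡⟨ ∑-swap XX Z _ ⟩
            ∑ Z (λ z → ∑ XX (λ l → (e z + len XX * d z l - H (z ℤ.- u)) * (e z + len XX * d z l - H (z ℤ.- u))))
              ≤⟨ ∑-mono Z (λ z → ∑-variance XX (d z) (e z)) ⟩
            ∑ Z (λ z → len XX * (e z * e z) + len XX * len XX * ∑ XX (λ l → d z l * d z l))
              ≡⟨ trans (∑-+ Z _ _) (cong₂ _+_ (∑-* Z _ _) (trans (∑-* Z _ _) (cong (λ a → len XX * len XX * a) d-energy))) ⟩
            len XX * E + len XX * len XX * (len XX * ‖ D ‖²)
              ≡⟨ cong (λ q → q * E + q * q * (q * ‖ D ‖²)) (len-⊕ X X) ⟩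
            m * m * E + m * m * (m * m) * (m * m * ‖ D ‖²)
              ≤⟨ +-mono ≤-refl (*-monoˡ (0≤sq (m * m)) (*-monoˡ (0≤sq m) ‖D‖²)) ⟩
            m * m * E + m * m * (m * m) * (m * m * (nat 2 * (m * m)))
              ≡⟨ eq₅ (m * m) E ⟩
            m * m * (E + C) ∎

        Φ : (ℤ → R) → (ℤ → R) → ℕ → R
        Φ ω G j = ∑ (range n) (λ u → ω u * slack G j u)

        -- The weight `ω u` is the product of `r (X ⊕ X) (x - u)` over the samples x chosen so far:
        -- the number of ways in which these samples arise from the shift `u`.
        record State (j : ℕ) : Set where
          field
            ω G : ℤ → R
            0≤ω : ∀ u → 0# ≤ ω u
            ω≤ : ∀ u → ω u ≤ nat 2 ^ j
            G-per : Per G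
            0≤Φ : 0# ≤ Φ ω G j
            Φ≥ : nat n * B ≤ D₀ ^ j * Φ ω G j

        advance : ∀ {j} → State j → State (suc j)
        advance {j} state = record
          { ω = ω′ x
          ; G = add G x
          ; 0≤ω = λ u → 0≤* (0≤ω u) (0≤r (X ⊕ X) (x ℤ.- u))
          ; ω≤ = λ u → ≤-trans (*-mono (0≤ω u) (0≤r (X ⊕ X) (x ℤ.- u)) (ω≤ u) (sums≤2 sidon (x ℤ.- u)))
                   (≤-reflexive (*-comm (nat 2 ^ j) (nat 2)))
          ; G-per = per₂ _+_ G-per (per-shift (ℤ.- x) D-per)
          ; 0≤Φ = 0≤Φ′
          ; Φ≥ = ≤-trans Φ≥ (≤-trans (*-monoˡ (1≤⇒0≤ (1≤^ 1≤D₀ j)) step) (≤-reflexive (eq₁ (D₀ ^ j) D₀ Φ′)))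
          }
          where
          open State state
          open ≤-Reasoning
          ω′ : ℤ → ℤ → R
          ω′ x u = ω u * r (X ⊕ X) (x ℤ.- u)
          eq₁ : ∀ p d a → p * (d * a) ≡ d * p * a
          eq₁ = solve-∀ ring
          eq₂ : ∀ w q s → q * (w * s) ≡ w * (q * s)
          eq₂ = solve-∀ ring
          eq₃ : ∀ a b c → a * (b * c) ≡ a * b * c
          eq₃ = solve-∀ ring
          total : m * m * Φ ω G j ≤ ∑ Z (λ x → Φ (ω′ x) (add G x) (suc j))
          total = begin
            m * m * Φ ω G j
              ≡⟨ trans (sym (∑-* (range n) (m * m) _)) (∑-cong (range n) (λ u → eq₂ (ω u) (m * m) (slack G j u))) ⟩
            ∑ (range n) (λ u → ω u * (m * m * slack G j u))
              ≤⟨ ∑-mono (range n) (λ u → *-monoˡ (0≤ω u) (slack-sample G j u G-per)) ⟩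
            ∑ (range n) (λ u → ω u * ∑ Z (λ x → r (X ⊕ X) (x ℤ.- u) * slack (add G x) (suc j) u))
              ≡⟨ ∑-cong (range n) (λ u → trans (sym (∑-* Z (ω u) _)) (∑-cong Z (λ x → eq₃ _ _ _))) ⟩
            ∑ (range n) (λ u → ∑ Z (λ x → ω′ x u * slack (add G x) (suc j) u))
              ≡⟨ ∑-swap (range n) Z _ ⟩
            ∑ Z (λ x → Φ (ω′ x) (add G x) (suc j)) ∎
          -- Some x does at least as well as the average over the `N` residues. Since N ≤ D₀ m², the
          -- factor m² gained from the sums in X + X makes up for `N` except for `D₀`.
          pick : ∃[ x ] (x ∈ Z × ∑ Z (λ x → Φ (ω′ x) (add G x) (suc j)) ≤ len Z * Φ (ω′ x) (add G x) (suc j))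
          pick = ∑-averaging Z (λ x → Φ (ω′ x) (add G x) (suc j)) (subst (1# ≤_) (sym (len-range N)) 1≤N)
          x : ℤ
          x = proj₁ pick
          Φ′ : R
          Φ′ = Φ (ω′ x) (add G x) (suc j)
          gain : m * m * Φ ω G j ≤ nat N * Φ′
          gain = ≤-trans total (subst (λ a → ∑ Z (λ x → Φ (ω′ x) (add G x) (suc j)) ≤ a * Φ′) (len-range N) (proj₂ (proj₂ pick)))
          0≤Φ′ : 0# ≤ Φ′
          0≤Φ′ = cancel 1≤N (≤-trans (≤-reflexive (zeroʳ (nat N))) (≤-trans (0≤* (0≤sq m) 0≤Φ) gain))
          step : Φ ω G j ≤ D₀ * Φ′
          step = cancel 1≤m² (≤-trans gain (≤-trans (*-monoʳ 0≤Φ′ N≤) (≤-reflexive (eq D₀ (m * m) Φ′))))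
            where
            eq : ∀ d q a → d * q * a ≡ q * (d * a)
            eq = solve-∀ ring

        initial : State 0
        initial = record
          { ω = λ _ → 1#
          ; G = λ _ → 0#
          ; 0≤ω = λ _ → 0≤1
          ; ω≤ = λ _ → ≤-refl
          ; G-per = λ _ _ _ → refl
          ; 0≤Φ = subst (0# ≤_) (sym Φ₀) (0≤* 0≤nat 0≤B)
          ; Φ≥ = ≤-reflexive (sym (trans (cong (1# *_) Φ₀) (*-identityˡ _)))
          }
          where
          eq₁ : ∀ q h → (q * 0# - 0# * h) * (q * 0# - 0# * h) ≡ 0#
          eq₁ = solve-∀ ring
          eq₂ : ∀ b c → 1# * (b + 0# * c - 0#) ≡ b
          eq₂ = solve-∀ ring
          Φ₀ : Φ (λ _ → 1#) (λ _ → 0#) 0 ≡ nat n * B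
          Φ₀ = trans (∑-cong (range n) (λ u → trans
            (cong (λ a → 1# * (B + nat 0 * C - a)) (trans (∑-cong Z (λ z → eq₁ (m * m) (H (z ℤ.- u)))) (∑-0 Z)))
            (eq₂ B C))) (trans (∑-const (range n) B) (cong (_* B) (len-range n)))

        state : ∀ j → State j
        state zero = initial
        state (suc j) = advance (state j)

      -- All good shifts u share the same `G`, and k H(· - u) is close to m² G for each of them.
      -- Hence translates of `H` by two good shifts are close to each other, and subtracting one
      -- fixed good shift `u₀` gives almost periods.
      almost-periods : ∀ {D₀} → 1# ≤ D₀ → nat N ≤ D₀ * (m * m) → ∀ {n} → 0 ℕ.< n → ∀ {q} → 0 ℕ.< q →
        ∃[ V ] (AllPairs (Close n) V × nat n ≤ period-loss D₀ q * len V × (∀ {v} → v ∈ V → Near q v))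
      almost-periods {D₀} 1≤D₀ N≤ {n} 0<n {q} 0<q = V ,
        translate-close u₀ (AllPairs.filter⁺ good? (range-close n)) ,
        subst (λ a → nat n ≤ period-loss D₀ q * a) (sym (∑-map (λ u → u ℤ.- u₀) U (λ _ → 1#))) large ,
        near
        where
        k : ℕ
        k = 16 ℕ.* q
        -- With B = k C the final slack is 2B minus the squared error, so a shift of positive slack
        -- has error at most 2B.
        B : R
        B = nat k * (nat 2 * m⁶)
        0≤B : 0# ≤ B
        0≤B = 0≤* 0≤nat (0≤* 0≤nat (1≤⇒0≤ 1≤m⁶))
        1≤k : 1# ≤ nat k
        1≤k = nat-mono (ℕ.≤-trans 0<q (ℕ.m≤n*m q 16))
        1≤B : 1# ≤ B
        1≤B = 1≤* 1≤k (1≤* (nat-mono (ℕ.s≤s ℕ.z≤n)) 1≤m⁶)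
        open Sampling D₀ 1≤D₀ N≤ n B 0≤B
        open State (state k)
        good? : ∀ u → Dec (‖ err G k u ‖² ≤ B + B)
        good? u = ‖ err G k u ‖² ≤? B + B
        U : List ℤ
        U = filter good? (range n)

        -- Shifts outside `U` have nonpositive slack and only lower the potential; the others have
        -- slack at most 2B and weight at most 2 to the power k.
        Φ≤ : Φ ω G k ≤ len U * (nat 2 ^ k * (B + B))
        Φ≤ = ∑-filter-≤ good? (range n) heavy light
          where
          eq₁ : ∀ b e → b + b - (b + b - e) ≡ e
          eq₁ = solve-∀ ring
          eq₂ : ∀ b e → 0# - (b + b - e) ≡ e - (1# + (b + b)) + 1#
          eq₂ = solve-∀ ring
          heavy : ∀ u → ‖ err G k u ‖² ≤ B + B → ω u * slack G k u ≤ nat 2 ^ k * (B + B)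
          heavy u p = *-mono (0≤ω u) (gap p) (ω≤ u) (≤by _ (eq₁ B _) (0≤‖‖ (err G k u)))
          light : ∀ u → ¬ ‖ err G k u ‖² ≤ B + B → ω u * slack G k u ≤ 0#
          light u ¬p = ≤-trans (*-monoˡ (0≤ω u) (≤by _ (eq₂ B _) (0≤+ (gap (≰⇒1+≤ ¬p)) 0≤1)))
            (≤-reflexive (zeroʳ (ω u)))

        large : nat n ≤ period-loss D₀ q * len U
        large = cancel 1≤B (begin
          B * nat n                                       ≡⟨ *-comm B (nat n) ⟩
          nat n * B                                       ≤⟨ Φ≥ ⟩
          D₀ ^ k * Φ ω G k                                ≤⟨ *-monoˡ (1≤⇒0≤ (1≤^ 1≤D₀ k)) Φ≤ ⟩
          D₀ ^ k * (len U * (nat 2 ^ k * (B + B)))        ≡⟨ eq (D₀ ^ k) (len U) (nat 2 ^ k) B ⟩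
          B * (nat 2 * (nat 2 ^ k * D₀ ^ k) * len U)      ∎)
          where
          open ≤-Reasoning
          eq : ∀ d l p b → d * (l * (p * (b + b))) ≡ b * (nat 2 * (p * d) * l)
          eq = solve-∀ ring

        nonempty : ∀ L → nat n ≤ period-loss D₀ q * len L → ∃[ u ] u ∈ L
        nonempty [] h = ⊥-elim (1≰0 (≤-trans (nat-mono 0<n) (≤-trans h (≤-reflexive (zeroʳ _)))))
        nonempty (u ∷ _) _ = u , here refl

        u₀ : ℤ
        u₀ = proj₁ (nonempty U large)
        V : List ℤ
        V = map (λ u → u ℤ.- u₀) U

        good : ∀ {u} → u ∈ U → ‖ err G k u ‖² ≤ B + B
        good u∈ = proj₂ (∈-filter⁻ good? {xs = range n} u∈)

        near : ∀ {v} → v ∈ V → Near q v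
        near v∈ = let u , u∈ , eq = ∈-map⁻ (λ u → u ℤ.- u₀) v∈ in subst (Near q) (sym eq) (near-point u u∈)
          where
          near-point : ∀ u → u ∈ U → Near q (u ℤ.- u₀)
          near-point u u∈ = near-rescale (nat k) (nat q) ‖ f ‖² m⁶ (nat-* 16 q) 1≤k
           (close-errors u₀ (nat k) B (err G k u₀) (err G k u) f-per difference
            (good (proj₂ (nonempty U large))) (good u∈))
            where
            f : ℤ → R
            f z = H (z ℤ.- (u ℤ.- u₀)) - H z
            f-per : Per f
            f-per = per₂ _-_ (per-shift (ℤ.- (u ℤ.- u₀)) H-per) H-per
            eq₃ : ∀ z u u₀ → z ℤ.- u₀ ℤ.- (u ℤ.- u₀) ≡ z ℤ.- u
            eq₃ = solve-ℤ
            eq₄ : ∀ k h h₀ q g → k * (h - h₀) ≡ q * g - k * h₀ + - (q * g - k * h)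
            eq₄ = solve-∀ ring
            difference : ∀ z → nat k * f (z ℤ.- u₀) ≡ err G k u₀ z + - err G k u z
            difference z = trans (cong (λ w → nat k * (H w - H (z ℤ.- u₀))) (eq₃ z u u₀))
              (eq₄ (nat k) (H (z ℤ.- u)) (H (z ℤ.- u₀)) (m * m) (G z))

  -- Continuity of the number of solutions along almost periods

  module Continuity (N : ℕ) .{{_ : ℕ.NonZero N}} where
    open Cyclic N
    open Sidon
    open Periods N

    Δ : ℤ → (ℤ → R) → ℤ → R
    Δ s f z = f (z ℤ.- s) - f z

    Δ-per : ∀ s {f} → Per f → Per (Δ s f)
    Δ-per s h = per₂ _-_ (per-shift (ℤ.- s) h) h

    Δ-⋆ : ∀ s L f z → Δ s (L ⋆ f) z ≡ (L ⋆ Δ s f) z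
    Δ-⋆ s L f z = trans (cong (_- (L ⋆ f) z) (∑-cong L (λ l → cong f (eq z s l))))
      (sym (∑-- L (λ l → f (z ℤ.- l ℤ.- s)) (λ l → f (z ℤ.- l))))
      where
      eq : ∀ z s l → z ℤ.- s ℤ.- l ≡ z ℤ.- l ℤ.- s
      eq = solve-ℤ

    ‖Δ‖ : ∀ s {f} → Per f → ‖ Δ s f ‖² ≤ nat 4 * ‖ f ‖²
    ‖Δ‖ s {f} h = begin
      ‖ Δ s f ‖²                                                   ≤⟨ ‖‖-+ (λ z → f (z ℤ.- s)) (λ z → - f z) ⟩
      nat 2 * (‖ (λ z → f (z ℤ.- s)) ‖² + ‖ (λ z → - f z) ‖²)      ≡⟨ cong₂ (λ a b → nat 2 * (a + b)) (‖‖-shift (ℤ.- s) h) (‖‖-neg f) ⟩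
      nat 2 * (‖ f ‖² + ‖ f ‖²)                                    ≡⟨ eq ‖ f ‖² ⟩
      nat 4 * ‖ f ‖²                                               ∎
      where
      open ≤-Reasoning
      eq : ∀ a → nat 2 * (a + a) ≡ nat 4 * a
      eq = solve-∀ ring

    ⋆-adjoint : ∀ X {f g} → Per f → Per g → ∑ Z (λ z → g z * (neg X ⋆ f) z) ≡ ∑ Z (λ z → (X ⋆ g) z * f z)
    ⋆-adjoint X {f} {g} f-per g-per = begin
      ∑ Z (λ z → g z * (neg X ⋆ f) z)
        ≡⟨ ∑-cong Z (λ z → trans (cong (g z *_) (∑-map (λ x → ℤ.- x) X (λ l → f (z ℤ.- l)))) (sym (∑-* X (g z) _))) ⟩
      ∑ Z (λ z → ∑ X (λ x → g z * f (z ℤ.- ℤ.- x)))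
        ≡⟨ ∑-swap Z X _ ⟩
      ∑ X (λ x → ∑ Z (λ z → g z * f (z ℤ.- ℤ.- x)))
        ≡⟨ ∑-cong X (λ x → trans (sym (∑-shift (per₂ _*_ g-per (per-shift (ℤ.- ℤ.- x) f-per)) (ℤ.- x)))
             (∑-cong Z (λ z → cong (λ w → g (z ℤ.- x) * f w) (eq z x)))) ⟩
      ∑ X (λ x → ∑ Z (λ z → g (z ℤ.- x) * f z))
        ≡⟨ ∑-swap X Z _ ⟩
      ∑ Z (λ z → ∑ X (λ x → g (z ℤ.- x) * f z))
        ≡⟨ ∑-cong Z (λ z → ∑-*ʳ X (f z) _) ⟩
      ∑ Z (λ z → (X ⋆ g) z * f z) ∎
      where
      open ≡-Reasoning
      eq : ∀ z x → z ℤ.- x ℤ.- ℤ.- x ≡ z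
      eq = solve-ℤ

    r-⊕ : ∀ L M y → r (L ⊕ M) y ≡ (L ⋆ r M) y
    r-⊕ L M = ⊕-⋆ L M δ

    -- The number of solutions of x₁ + x₂ − x₄ − x₅ + x₃ ≡ −s with x₁, x₂, x₄ ∈ X, x₃ ∈ B and x₅ ∈ C.
    solutions : (X B C : List ℤ) → ℤ → R
    solutions X B C s = ∑ Z (λ z → r (neg X ⊕ (X ⊕ X)) (z ℤ.- s) * r (C ⊕ neg B) z)

    module _ {X} (sidon : Sidon X) (1≤m : 1# ≤ len X) where

      private
        S F : ℤ → R
        S = r (X ⊕ X)
        F = r (neg X ⊕ (X ⊕ X))
        m² : R
        m² = len X * len X

      S-per : Per S
      S-per = r-per (X ⊕ X)

      ‖S‖² : ‖ S ‖² ≤ nat 2 * m²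
      ‖S‖² = ≤-trans (mixed-energy-distinct sidon X (distinct sidon)) (≤-reflexive (eq (len X)))
        where
        eq : ∀ m → m * m + m * m ≡ nat 2 * (m * m)
        eq = solve-∀ ring

      X⋆F : ∀ z → (X ⋆ F) z ≡ H sidon 1≤m z
      X⋆F z = begin
        (X ⋆ F) z                       ≡⟨ ∑-cong X (λ x → r-⊕ (neg X) (X ⊕ X) (z ℤ.- x)) ⟩
        (X ⋆ (neg X ⋆ S)) z             ≡⟨ sym (⊕-⋆ X (neg X) S z) ⟩
        ((X ⊕ neg X) ⋆ S) z             ≡⟨ ∑-swap (X ⊕ neg X) (X ⊕ X) (λ l k → δ (z ℤ.- l ℤ.- k)) ⟩
        ∑ (X ⊕ X) (λ k → ∑ (X ⊕ neg X) (λ l → δ (z ℤ.- l ℤ.- k)))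
          ≡⟨ ∑-cong (X ⊕ X) (λ k → ∑-cong (X ⊕ neg X) (λ l → cong δ (eq z l k))) ⟩
        H sidon 1≤m z                   ∎
        where
        open ≡-Reasoning
        eq : ∀ z l k → z ℤ.- l ℤ.- k ≡ z ℤ.- k ℤ.- l
        eq = solve-ℤ

      -- Moving one factor -X across the inner product rewrites ‖ΔF‖² as the inner product of ΔH and
      -- ΔS. Cauchy-Schwarz then applies, with ‖ΔS‖² at most 4 · 2m².
      ‖ΔF‖⁴ : ∀ s → ‖ Δ s F ‖² * ‖ Δ s F ‖² ≤ nat 8 * m² * ‖ Δ s (H sidon 1≤m) ‖²
      ‖ΔF‖⁴ s = begin
        ‖ Δ s F ‖² * ‖ Δ s F ‖²
          ≡⟨ cong (λ a → a * a) inner ⟩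
        ∑ Z (λ z → Δ s (H sidon 1≤m) z * Δ s S z) * ∑ Z (λ z → Δ s (H sidon 1≤m) z * Δ s S z)
          ≤⟨ cauchy-schwarz Z (Δ s (H sidon 1≤m)) (Δ s S) ⟩
        ‖ Δ s (H sidon 1≤m) ‖² * ‖ Δ s S ‖²
          ≤⟨ *-monoˡ (0≤‖‖ (Δ s (H sidon 1≤m))) (≤-trans (‖Δ‖ s S-per) (*-monoˡ 0≤nat ‖S‖²)) ⟩
        ‖ Δ s (H sidon 1≤m) ‖² * (nat 4 * (nat 2 * m²))
          ≡⟨ eq ‖ Δ s (H sidon 1≤m) ‖² m² ⟩
        nat 8 * m² * ‖ Δ s (H sidon 1≤m) ‖² ∎
        where
        open ≤-Reasoning
        eq : ∀ a q → a * (nat 4 * (nat 2 * q)) ≡ nat 8 * q * a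
        eq = solve-∀ ring
        F-per : Per F
        F-per = r-per (neg X ⊕ (X ⊕ X))
        ΔF : ∀ z → Δ s F z ≡ (neg X ⋆ Δ s S) z
        ΔF z = trans (cong₂ _-_ (r-⊕ (neg X) (X ⊕ X) (z ℤ.- s)) (r-⊕ (neg X) (X ⊕ X) z)) (Δ-⋆ s (neg X) S z)
        inner : ‖ Δ s F ‖² ≡ ∑ Z (λ z → Δ s (H sidon 1≤m) z * Δ s S z)
        inner = trans (∑-cong Z (λ z → cong (Δ s F z *_) (ΔF z)))
          (trans (⋆-adjoint X (Δ-per s S-per) (Δ-per s F-per))
            (∑-cong Z (λ z → cong (_* Δ s S z) (trans (sym (Δ-⋆ s X F z)) (cong₂ _-_ (X⋆F (z ℤ.- s)) (X⋆F z))))))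

      -- The difference of the two counts is the inner product of ΔF with the representation
      -- function of C - B, whose energy is at most 2m². The fourth power appears because `‖ΔF‖⁴`
      -- already spent one Cauchy-Schwarz; 32 is 4 · 8.
      solutions-continuous : ∀ {B C} → Sidon C → Distinct B → len B ≡ len X → len C ≡ len X → ∀ {q s} → Near sidon 1≤m q s →
        let d = solutions X B C s - solutions X B C (+ 0) in
        nat q * (d * d * (d * d)) ≤ nat 32 * (m⁶ sidon 1≤m * m⁶ sidon 1≤m)
      solutions-continuous {B} {C} sidonC distinctB lenB lenC {q} {s} near =
        conclude (nat q) d ‖ w ‖² ‖ Δ s F ‖² ‖ Δ s (H sidon 1≤m) ‖² m² 0≤nat (0≤‖‖ w) (0≤‖‖ (Δ s F))
          (0≤sq (len X)) squared ‖w‖² (‖ΔF‖⁴ s) near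
        where
        d : R
        d = solutions X B C s - solutions X B C (+ 0)
        w : ℤ → R
        w = r (C ⊕ neg B)
        ‖w‖² : ‖ w ‖² ≤ nat 2 * m²
        ‖w‖² = ≤-trans (mixed-energy-distinct sidonC (neg B) (distinct-neg B distinctB))
          (≤-reflexive (trans (cong₂ (λ b c → b * b + c * b) (trans (∑-map (λ x → ℤ.- x) B (λ _ → 1#)) lenB) lenC) (eq (len X))))
          where
          eq : ∀ m → m * m + m * m ≡ nat 2 * (m * m)
          eq = solve-∀ ring
        eq₁ : ∀ a b c → a * c - b * c ≡ (a - b) * c
        eq₁ = solve-∀ ring
        difference : d ≡ ∑ Z (λ z → Δ s F z * w z)
        difference = trans (sym (∑-- Z _ _)) (∑-cong Z (λ z →
          trans (cong (λ y → F (z ℤ.- s) * w z - F y * w z) (ℤ.+-identityʳ z)) (eq₁ (F (z ℤ.- s)) (F z) (w z))))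
        squared : d * d ≤ ‖ Δ s F ‖² * ‖ w ‖²
        squared = subst (λ a → a * a ≤ ‖ Δ s F ‖² * ‖ w ‖²) (sym difference) (cauchy-schwarz Z (Δ s F) w)
        conclude : ∀ q d w f h m → 0# ≤ q → 0# ≤ w → 0# ≤ f → 0# ≤ m → d * d ≤ f * w → w ≤ nat 2 * m →
          f * f ≤ nat 8 * m * h → q * h ≤ m * m * m → q * (d * d * (d * d)) ≤ nat 32 * (m * m * m * (m * m * m))
        conclude q d w f h m 0≤q 0≤w 0≤f 0≤m d² w≤ f² near = begin
          q * (d * d * (d * d))                          ≤⟨ *-monoˡ 0≤q (sq-mono (0≤sq d) d²) ⟩
          q * (f * w * (f * w))                          ≤⟨ *-monoˡ 0≤q (sq-mono (0≤* 0≤f 0≤w) (*-monoˡ 0≤f w≤)) ⟩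
          q * (f * (nat 2 * m) * (f * (nat 2 * m)))      ≡⟨ eq₂ q f m ⟩
          q * (nat 4 * (m * m)) * (f * f)                ≤⟨ *-monoˡ (0≤* 0≤q (0≤* 0≤nat (0≤sq m))) f² ⟩
          q * (nat 4 * (m * m)) * (nat 8 * m * h)        ≡⟨ eq₃ q m h ⟩
          nat 32 * (m * m * m) * (q * h)                 ≤⟨ *-monoˡ (0≤* 0≤nat (0≤* (0≤sq m) 0≤m)) near ⟩
          nat 32 * (m * m * m) * (m * m * m)             ≡⟨ eq₄ (m * m * m) ⟩
          nat 32 * (m * m * m * (m * m * m))             ∎
          where
          open ≤-Reasoning
          eq₂ : ∀ q f m → q * (f * (nat 2 * m) * (f * (nat 2 * m))) ≡ q * (nat 4 * (m * m)) * (f * f)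
          eq₂ = solve-∀ ring
          eq₃ : ∀ q m h → q * (nat 4 * (m * m)) * (nat 8 * m * h) ≡ nat 32 * (m * m * m) * (q * h)
          eq₃ = solve-∀ ring
          eq₄ : ∀ a → nat 32 * a * a ≡ nat 32 * (a * a)
          eq₄ = solve-∀ ring

      private
        Nr : ℕ → ℤ → Set
        Nr = Near sidon 1≤m
        H′ : ℤ → R
        H′ = H sidon 1≤m

      near-0 : ∀ q → Nr q (+ 0)
      near-0 q = ≤-trans (≤-reflexive (trans (cong (nat q *_) (trans (∑-cong Z (λ z →
        trans (cong (λ y → (H′ y - H′ z) * (H′ y - H′ z)) (ℤ.+-identityʳ z)) (eq (H′ z)))) (∑-0 Z))) (zeroʳ (nat q))))
        (1≤⇒0≤ (1≤m⁶ sidon 1≤m))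
        where
        eq : ∀ a → (a - a) * (a - a) ≡ 0#
        eq = solve-∀ ring

      near-neg : ∀ q {s} → Nr q s → Nr q (ℤ.- s)
      near-neg q {s} = subst (λ a → nat q * a ≤ m⁶ sidon 1≤m)
        (trans (sym (‖‖-shift s (Δ-per s (H-per sidon 1≤m)))) (∑-cong Z (λ z → trans
          (cong₂ (λ y w → (H′ y - H′ w) * (H′ y - H′ w)) (eq₁ z s) (eq₂ z s)) (eq₃ (H′ z) (H′ (z ℤ.- ℤ.- s))))))
        where
        eq₁ : ∀ z s → z ℤ.+ s ℤ.- s ≡ z
        eq₁ = solve-ℤ
        eq₂ : ∀ z s → z ℤ.+ s ≡ z ℤ.- ℤ.- s
        eq₂ = solve-ℤ
        eq₃ : ∀ a b → (a - b) * (a - b) ≡ (b - a) * (b - a)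
        eq₃ = solve-∀ ring

      near-mono : ∀ {q q′ s} → q ℕ.≤ q′ → Nr q′ s → Nr q s
      near-mono {s = s} q≤ = ≤-trans (*-monoʳ (0≤‖‖ (Δ s H′)) (nat-mono q≤))

      -- This is the triangle inequality for translates of `H`; squaring a sum of two terms costs 2,
      -- and there are two terms, hence the 4.
      near-+ : ∀ q {s t} → Nr (4 ℕ.* q) s → Nr (4 ℕ.* q) t → Nr q (s ℤ.+ t)
      near-+ q {s} {t} near-s near-t = conclude (nat q) ‖ Δ (s ℤ.+ t) H′ ‖² ‖ Δ s H′ ‖² ‖ Δ t H′ ‖² (m⁶ sidon 1≤m) 0≤nat triangle
        (subst (λ a → a * ‖ Δ s H′ ‖² ≤ m⁶ sidon 1≤m) (nat-* 4 q) near-s)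
        (subst (λ a → a * ‖ Δ t H′ ‖² ≤ m⁶ sidon 1≤m) (nat-* 4 q) near-t)
        where
        eq₁ : ∀ a b c → a - c ≡ a - b + (b - c)
        eq₁ = solve-∀ ring
        eq₂ : ∀ z s t → z ℤ.- (s ℤ.+ t) ≡ z ℤ.- t ℤ.- s
        eq₂ = solve-ℤ
        triangle : ‖ Δ (s ℤ.+ t) H′ ‖² ≤ nat 2 * (‖ Δ s H′ ‖² + ‖ Δ t H′ ‖²)
        triangle = begin
          ‖ Δ (s ℤ.+ t) H′ ‖²
            ≡⟨ ‖‖-cong (λ z → trans (cong (λ y → H′ y - H′ z) (eq₂ z s t)) (eq₁ (H′ (z ℤ.- t ℤ.- s)) (H′ (z ℤ.- t)) (H′ z))) ⟩
          ‖ (λ z → Δ s H′ (z ℤ.- t) + Δ t H′ z) ‖²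
            ≤⟨ ‖‖-+ (λ z → Δ s H′ (z ℤ.- t)) (Δ t H′) ⟩
          nat 2 * (‖ (λ z → Δ s H′ (z ℤ.- t)) ‖² + ‖ Δ t H′ ‖²)
            ≡⟨ cong (λ a → nat 2 * (a + ‖ Δ t H′ ‖²)) (‖‖-shift (ℤ.- t) (Δ-per s (H-per sidon 1≤m))) ⟩
          nat 2 * (‖ Δ s H′ ‖² + ‖ Δ t H′ ‖²) ∎
          where open ≤-Reasoning
        conclude : ∀ q e e₁ e₂ c → 0# ≤ q → e ≤ nat 2 * (e₁ + e₂) → nat 4 * q * e₁ ≤ c → nat 4 * q * e₂ ≤ c → q * e ≤ c
        conclude q e e₁ e₂ c 0≤q h h₁ h₂ = cancel {nat 2} (nat-mono (ℕ.s≤s ℕ.z≤n))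
          (≤by _ (eq q e e₁ e₂ c) (0≤+ (0≤* 0≤nat (0≤* 0≤q (gap h))) (0≤+ (gap h₁) (gap h₂))))
          where
          eq : ∀ q e e₁ e₂ c → nat 2 * c - nat 2 * (q * e) ≡
            nat 2 * (q * (nat 2 * (e₁ + e₂) - e)) + (c - nat 4 * q * e₁ + (c - nat 4 * q * e₂))
          eq = solve-∀ ring

      near-multiple : ∀ c q {s} → Nr (4 ℕ.^ c ℕ.* q) s → Nr q (+ c ℤ.* s)
      near-multiple zero q h = near-0 q
      near-multiple (suc c) q {s} h = subst (Nr q) (eq (+ c) s)
        (near-+ q (near-mono {s = s} (ℕ.*-monoˡ-≤ q (ℕ.m≤m*n 4 (4 ℕ.^ c) {{ℕ.m^n≢0 4 c}})) h)
          (near-multiple c (4 ℕ.* q) (subst (λ k → Nr k s) (eq₂ (4 ℕ.^ c) q) h)))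
        where
        eq : ∀ c s → s ℤ.+ c ℤ.* s ≡ (+ 1 ℤ.+ c) ℤ.* s
        eq = solve-ℤ
        eq₂ : ∀ a q → 4 ℕ.* a ℕ.* q ≡ a ℕ.* (4 ℕ.* q)
        eq₂ a q = trans (cong (ℕ._* q) (ℕ.*-comm 4 a)) (ℕ.*-assoc a 4 q)

  -- Many configurations in a function that averaging hardly changes

  ≰⇒≥ : ∀ {x y} → ¬ x ≤ y → y ≤ x
  ≰⇒≥ {x} {y} h = ≤by _ (eq x y) (0≤+ (gap (≰⇒1+≤ h)) 0≤1)
    where
    eq : ∀ x y → x - y ≡ x - (1# + y) + 1#
    eq = solve-∀ ring

  Π₅ : (y₁ y₂ y₃ y₄ y₅ : R) → R
  Π₅ y₁ y₂ y₃ y₄ y₅ = y₅ * (y₃ * (y₄ * (y₁ * y₂)))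

  0≤Π₅ : ∀ {y₁ y₂ y₃ y₄ y₅} → 0# ≤ y₁ → 0# ≤ y₂ → 0# ≤ y₃ → 0# ≤ y₄ → 0# ≤ y₅ → 0# ≤ Π₅ y₁ y₂ y₃ y₄ y₅
  0≤Π₅ h₁ h₂ h₃ h₄ h₅ = 0≤* h₅ (0≤* h₃ (0≤* h₄ (0≤* h₁ h₂)))

  Π₅-mono : ∀ {c y₁ y₂ y₃ y₄ y₅} → 0# ≤ c → c ≤ y₁ → c ≤ y₂ → c ≤ y₃ → c ≤ y₄ → c ≤ y₅ →
    Π₅ c c c c c ≤ Π₅ y₁ y₂ y₃ y₄ y₅
  Π₅-mono 0≤c h₁ h₂ h₃ h₄ h₅ =
    *-mono 0≤c (0≤* 0≤c (0≤* 0≤c (0≤sq _))) h₅ (*-mono 0≤c (0≤* 0≤c (0≤sq _)) h₃ (*-mono 0≤c (0≤sq _) h₄ (*-mono 0≤c 0≤c h₁ h₂)))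

  -- If the average g / Y is at least M / 2N, then either all the values y are at least M / 4N, or one of
  -- them deviates from the average by at least M / 4N.
  module Dichotomy (N M Y g : R) (0≤N : 0# ≤ N) (0≤M : 0# ≤ M) (0≤Y : 0# ≤ Y) where

    deviation : R → R
    deviation y = (Y * y - g) * (Y * y - g)

    heavy : R
    heavy = indicator (M * Y ≤? nat 2 * N * g)

    0≤deviation : ∀ y → 0# ≤ deviation y
    0≤deviation y = 0≤sq (Y * y - g)

    deviates : ∀ {y} → M * Y ≤ nat 2 * N * g → ¬ M ≤ nat 4 * N * y → M * Y * (M * Y) ≤ nat 16 * (N * N) * deviation y
    deviates {y} p ¬q = ≤-trans (sq-mono (0≤* 0≤M 0≤Y)
        (≤by _ (eq₁ M Y N g y) (0≤+ (0≤* 0≤nat (gap p)) (0≤* 0≤Y (gap (≰⇒≥ ¬q))))))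
      (≤-reflexive (eq₂ N Y y g))
      where
      eq₁ : ∀ M Y N g y → nat 4 * N * (g - Y * y) - M * Y ≡ nat 2 * (nat 2 * N * g - M * Y) + Y * (M - nat 4 * N * y)
      eq₁ = solve-∀ ring
      eq₂ : ∀ N Y y g → nat 4 * N * (g - Y * y) * (nat 4 * N * (g - Y * y)) ≡ nat 16 * (N * N) * ((Y * y - g) * (Y * y - g))
      eq₂ = solve-∀ ring

    -- For a heavy average, either all five values are at least M / 4N and the product pays, 1024
    -- being 4⁵, or one of them deviates and its square alone pays by `deviates`. Denominators are
    -- cleared throughout.
    pointwise : ∀ y₁ y₂ y₃ y₄ y₅ → 0# ≤ y₁ → 0# ≤ y₂ → 0# ≤ y₃ → 0# ≤ y₄ → 0# ≤ y₅ →
      M * M * M * (M * Y * (M * Y)) * heavy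
        ≤ Y * Y * (nat 1024 * (N * N * N * N * N)) * Π₅ y₁ y₂ y₃ y₄ y₅
          + M * M * M * (nat 16 * (N * N)) * (deviation y₁ + deviation y₂ + deviation y₃ + deviation y₄ + deviation y₅)
    pointwise y₁ y₂ y₃ y₄ y₅ h₁ h₂ h₃ h₄ h₅ with M * Y ≤? nat 2 * N * g
    ... | no _ = ≤-trans (≤-reflexive (zeroʳ (M * M * M * (M * Y * (M * Y))))) (0≤+ 0≤left (0≤* 0≤c 0≤right))
      where
      0≤left : 0# ≤ Y * Y * (nat 1024 * (N * N * N * N * N)) * Π₅ y₁ y₂ y₃ y₄ y₅
      0≤left = 0≤* (0≤* (0≤sq Y) (0≤* 0≤nat (0≤* (0≤* (0≤* (0≤sq N) 0≤N) 0≤N) 0≤N))) (0≤Π₅ h₁ h₂ h₃ h₄ h₅)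
      0≤c : 0# ≤ M * M * M * (nat 16 * (N * N))
      0≤c = 0≤* (0≤* (0≤sq M) 0≤M) (0≤* 0≤nat (0≤sq N))
      0≤right : 0# ≤ deviation y₁ + deviation y₂ + deviation y₃ + deviation y₄ + deviation y₅
      0≤right = 0≤+ (0≤+ (0≤+ (0≤+ (0≤deviation y₁) (0≤deviation y₂)) (0≤deviation y₃)) (0≤deviation y₄)) (0≤deviation y₅)
    ... | yes p = cases (M ≤? nat 4 * N * y₁) (M ≤? nat 4 * N * y₂) (M ≤? nat 4 * N * y₃) (M ≤? nat 4 * N * y₄) (M ≤? nat 4 * N * y₅)
      where
      d₁ d₂ d₃ d₄ d₅ L c : R
      d₁ = deviation y₁
      d₂ = deviation y₂
      d₃ = deviation y₃
      d₄ = deviation y₄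
      d₅ = deviation y₅
      L = Y * Y * (nat 1024 * (N * N * N * N * N)) * Π₅ y₁ y₂ y₃ y₄ y₅
      c = nat 16 * (N * N)
      0≤L : 0# ≤ L
      0≤L = 0≤* (0≤* (0≤sq Y) (0≤* 0≤nat (0≤* (0≤* (0≤* (0≤sq N) 0≤N) 0≤N) 0≤N))) (0≤Π₅ h₁ h₂ h₃ h₄ h₅)
      0≤M³ : 0# ≤ M * M * M
      0≤M³ = 0≤* (0≤sq M) 0≤M
      Goal : Set
      Goal = M * M * M * (M * Y * (M * Y)) * 1# ≤ L + M * M * M * c * (d₁ + d₂ + d₃ + d₄ + d₅)
      deviating : ∀ d e → M * Y * (M * Y) ≤ c * d → 0# ≤ e → d₁ + d₂ + d₃ + d₄ + d₅ ≡ d + e → Goal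
      deviating d e h 0≤e eq = ≤by _ (trans (cong (λ s → L + M * M * M * c * s - M * M * M * (M * Y * (M * Y)) * 1#) eq)
        (eq₁ L (M * M * M) c d e (M * Y * (M * Y)))) (0≤+ 0≤L (0≤* 0≤M³ (0≤+ (gap h) (0≤* (0≤* 0≤nat (0≤sq N)) 0≤e))))
        where
        eq₁ : ∀ l m c d e s → l + m * c * (d + e) - m * s * 1# ≡ l + m * (c * d - s + c * e)
        eq₁ = solve-∀ ring
      0≤sum₄ : ∀ a b c d → 0# ≤ deviation a + deviation b + deviation c + deviation d
      0≤sum₄ a b c d = 0≤+ (0≤+ (0≤+ (0≤deviation a) (0≤deviation b)) (0≤deviation c)) (0≤deviation d)
      cases : Dec (M ≤ nat 4 * N * y₁) → Dec (M ≤ nat 4 * N * y₂) → Dec (M ≤ nat 4 * N * y₃) →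
        Dec (M ≤ nat 4 * N * y₄) → Dec (M ≤ nat 4 * N * y₅) → Goal
      cases (no ¬q) _ _ _ _ = deviating d₁ (d₂ + d₃ + d₄ + d₅) (deviates p ¬q) (0≤sum₄ y₂ y₃ y₄ y₅) (eq d₁ d₂ d₃ d₄ d₅)
        where
        eq : ∀ a b c d e → a + b + c + d + e ≡ a + (b + c + d + e)
        eq = solve-∀ ring
      cases _ (no ¬q) _ _ _ = deviating d₂ (d₁ + d₃ + d₄ + d₅) (deviates p ¬q) (0≤sum₄ y₁ y₃ y₄ y₅) (eq d₁ d₂ d₃ d₄ d₅)
        where
        eq : ∀ a b c d e → a + b + c + d + e ≡ b + (a + c + d + e)
        eq = solve-∀ ring
      cases _ _ (no ¬q) _ _ = deviating d₃ (d₁ + d₂ + d₄ + d₅) (deviates p ¬q) (0≤sum₄ y₁ y₂ y₄ y₅) (eq d₁ d₂ d₃ d₄ d₅)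
        where
        eq : ∀ a b c d e → a + b + c + d + e ≡ c + (a + b + d + e)
        eq = solve-∀ ring
      cases _ _ _ (no ¬q) _ = deviating d₄ (d₁ + d₂ + d₃ + d₅) (deviates p ¬q) (0≤sum₄ y₁ y₂ y₃ y₅) (eq d₁ d₂ d₃ d₄ d₅)
        where
        eq : ∀ a b c d e → a + b + c + d + e ≡ d + (a + b + c + e)
        eq = solve-∀ ring
      cases _ _ _ _ (no ¬q) = deviating d₅ (d₁ + d₂ + d₃ + d₄) (deviates p ¬q) (0≤sum₄ y₁ y₂ y₃ y₄) (eq d₁ d₂ d₃ d₄ d₅)
        where
        eq : ∀ a b c d e → a + b + c + d + e ≡ e + (a + b + c + d)
        eq = solve-∀ ring
      cases (yes q₁) (yes q₂) (yes q₃) (yes q₄) (yes q₅) = ≤by _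
        (eq (M * M * M * c) (d₁ + d₂ + d₃ + d₄ + d₅) M Y N y₁ y₂ y₃ y₄ y₅)
        (0≤+ (0≤* (0≤sq Y) (gap (Π₅-mono 0≤M q₁ q₂ q₃ q₄ q₅)))
          (0≤* (0≤* 0≤M³ (0≤* 0≤nat (0≤sq N))) (0≤+ (0≤sum₄ y₁ y₂ y₃ y₄) (0≤deviation y₅))))
        where
        eq : ∀ c d M Y N y₁ y₂ y₃ y₄ y₅ →
          Y * Y * (nat 1024 * (N * N * N * N * N)) * (y₅ * (y₃ * (y₄ * (y₁ * y₂)))) + c * d
            - M * M * M * (M * Y * (M * Y)) * 1#
          ≡ Y * Y * (nat 4 * N * y₅ * (nat 4 * N * y₃ * (nat 4 * N * y₄ * (nat 4 * N * y₁ * (nat 4 * N * y₂))))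
              - M * (M * (M * (M * M)))) + c * d
        eq = solve-∀ ring

    -- A pointwise form of the Paley-Zygmund inequality: a quadratic polynomial in `g` bounded above
    -- by a multiple of the indicator `heavy`. Summed over all positions it needs only the first and
    -- second moments of `g`; `L` is a free parameter.
    heavy-bound : ∀ L → 0# ≤ L →
      nat 4 * L * (N * (M * Y)) * g - nat 2 * L * (M * Y * (M * Y)) - N * N * (g * g)
        ≤ nat 4 * (L * L) * (M * Y * (M * Y)) * heavy
    heavy-bound L 0≤L with M * Y ≤? nat 2 * N * g
    ... | yes _ = ≤by _ (eq L N (M * Y) g) (0≤+ (0≤sq (nat 2 * L * (M * Y) - N * g)) (0≤* (0≤* 0≤nat 0≤L) (0≤sq (M * Y))))
      where
      eq : ∀ L N c g → nat 4 * (L * L) * (c * c) * 1# - (nat 4 * L * (N * c) * g - nat 2 * L * (c * c) - N * N * (g * g))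
        ≡ (nat 2 * L * c - N * g) * (nat 2 * L * c - N * g) + nat 2 * L * (c * c)
      eq = solve-∀ ring
    ... | no ¬p = ≤by _ (eq L N (M * Y) g)
        (0≤+ (0≤* (0≤* 0≤nat (0≤* 0≤L (0≤* 0≤M 0≤Y))) (gap (≰⇒≥ ¬p))) (0≤sq (N * g)))
      where
      eq : ∀ L N c g → nat 4 * (L * L) * (c * c) * 0# - (nat 4 * L * (N * c) * g - nat 2 * L * (c * c) - N * N * (g * g))
        ≡ nat 2 * (L * c) * (c - nat 2 * N * g) + N * g * (N * g)
      eq = solve-∀ ring

  module Density (N : ℕ) .{{_ : ℕ.NonZero N}} where
    open Cyclic N
    open Periods N

    module _ {f : ℤ → R} (f-per : Per f) (ν : List ℤ) where

      average : ℤ → R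
      average t = ∑ ν (λ q → f (t ℤ.+ q))

      ∑-average : ∑ Z average ≡ len ν * ∑ Z f
      ∑-average = trans (∑-swap Z ν (λ t q → f (t ℤ.+ q)))
        (trans (∑-cong ν (λ q → ∑-shift f-per q)) (∑-const ν (∑ Z f)))

      variance : ℤ → R
      variance t = ∑ ν (λ q → (len ν * f (t ℤ.+ q) - average t) * (len ν * f (t ℤ.+ q) - average t))

      -- Every shift of `f` has the same energy by periodicity, so the energy lost in averaging is
      -- exactly the total variance of `f` along the translates of `ν`.
      ∑-variance≡ : ∑ Z variance ≡ len ν * (len ν * len ν * ‖ f ‖² - ‖ average ‖²)
      ∑-variance≡ = begin
        ∑ Z variance
          ≡⟨ ∑-cong Z pointwise ⟩
        ∑ Z (λ t → Y * Y * ∑ ν (λ q → f (t ℤ.+ q) * f (t ℤ.+ q)) - Y * (average t * average t))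
          ≡⟨ trans (∑-- Z _ _) (cong₂ _-_ (∑-* Z (Y * Y) _) (∑-* Z Y _)) ⟩
        Y * Y * ∑ Z (λ t → ∑ ν (λ q → f (t ℤ.+ q) * f (t ℤ.+ q))) - Y * ‖ average ‖²
          ≡⟨ cong (λ a → Y * Y * a - Y * ‖ average ‖²) (trans (∑-swap Z ν _)
               (trans (∑-cong ν (λ q → ‖‖-shift q f-per)) (∑-const ν ‖ f ‖²))) ⟩
        Y * Y * (Y * ‖ f ‖²) - Y * ‖ average ‖²
          ≡⟨ eq₁ Y ‖ f ‖² ‖ average ‖² ⟩
        Y * (Y * Y * ‖ f ‖² - ‖ average ‖²) ∎
        where
        open ≡-Reasoning
        Y : R
        Y = len ν
        eq₁ : ∀ y a b → y * y * (y * a) - y * b ≡ y * (y * y * a - b)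
        eq₁ = solve-∀ ring
        eq₂ : ∀ y f g → (y * f - g) * (y * f - g) ≡ y * y * (f * f) - nat 2 * y * g * f + g * g
        eq₂ = solve-∀ ring
        eq₃ : ∀ y s g → y * y * s - nat 2 * y * g * g + y * (g * g) ≡ y * y * s - y * (g * g)
        eq₃ = solve-∀ ring
        pointwise : ∀ t → variance t ≡ Y * Y * ∑ ν (λ q → f (t ℤ.+ q) * f (t ℤ.+ q)) - Y * (average t * average t)
        pointwise t = trans (∑-cong ν (λ q → eq₂ Y (f (t ℤ.+ q)) (average t)))
          (trans (∑-+ ν _ _) (trans (cong₂ _+_ (trans (∑-- ν _ _)
            (cong₂ _-_ (∑-* ν (Y * Y) _) (∑-* ν (nat 2 * Y * average t) _))) (∑-const ν _))
            (eq₃ Y _ (average t))))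

      average-energy≤ : 1# ≤ len ν → ‖ average ‖² ≤ len ν * len ν * ‖ f ‖²
      average-energy≤ 1≤Y = ≤by _ refl (cancel 1≤Y (≤-trans (≤-reflexive (eq (len ν)))
        (≤-trans (0≤∑ Z (λ t → 0≤∑ ν (λ q → 0≤sq (len ν * f (t ℤ.+ q) - average t)))) (≤-reflexive ∑-variance≡))))
        where
        eq : ∀ a → a * 0# ≡ 0#
        eq = solve-∀ ring

    module _ {f : ℤ → R} (f-per : Per f) (0≤f : ∀ z → 0# ≤ f z)
      {I : Set} (T : List I) (q₁ q₂ q₃ q₄ q₅ : I → ℤ) (ν : List ℤ)
      (∑-ν : ∀ φ → ∑ ν φ ≡ ∑ T (λ τ → φ (q₁ τ) + φ (q₂ τ) + φ (q₃ τ) + φ (q₄ τ) + φ (q₅ τ)))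
      {D₀ M W : R} (1≤D₀ : 1# ≤ D₀) (1≤M : 1# ≤ M) (1≤T : 1# ≤ len T) (mass : ∑ Z f ≡ M)
      (NW²≤ : nat N * (W * W) ≤ D₀ * (M * M)) (‖f‖²≤ : ‖ f ‖² ≤ nat 2 * (W * W))
      where

      private
        n̂ Y g² : R
        n̂ = nat N
        Y = len ν
        g² = ‖ average f-per ν ‖²
        g : ℤ → R
        g = average f-per ν
        heavy : ℤ → R
        heavy t = Dichotomy.heavy n̂ M Y (g t) 0≤nat (1≤⇒0≤ 1≤M) (0≤len ν)
        deviation : ℤ → R → R
        deviation t = Dichotomy.deviation n̂ M Y (g t) 0≤nat (1≤⇒0≤ 1≤M) (0≤len ν)

      configurations : R
      configurations = ∑ Z (λ t → ∑ T (λ τ →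
        Π₅ (f (t ℤ.+ q₁ τ)) (f (t ℤ.+ q₂ τ)) (f (t ℤ.+ q₃ τ)) (f (t ℤ.+ q₄ τ)) (f (t ℤ.+ q₅ τ))))

      Y≡ : Y ≡ nat 5 * len T
      Y≡ = trans (∑-ν (λ _ → 1#)) (trans (∑-const T (nat 5)) (*-comm (len T) (nat 5)))

      1≤Y : 1# ≤ Y
      1≤Y = subst (1# ≤_) (sym Y≡) (1≤* (nat-mono (ℕ.s≤s ℕ.z≤n)) 1≤T)

      heavy-often : n̂ ≤ nat 8 * D₀ * ∑ Z heavy
      heavy-often = conclude n̂ D₀ (M * Y) M W Y (∑ Z heavy) g² ‖ f ‖² refl 1≤D₀ (1≤* 1≤M 1≤Y) 0≤nat
        (average-energy≤ f-per ν 1≤Y) ‖f‖²≤ NW²≤ summed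
        where
        L : R
        -- The first moment leaves 2 L N (M Y)², and the second moment takes at most 2 D₀ N (M Y)².
        -- With L = 2D₀ half of the former survives, against 16 D₀² (M Y)² times the number of heavy
        -- positions.
        L = nat 2 * D₀
        summed : nat 4 * L * (n̂ * (M * Y)) * (Y * M) - n̂ * (nat 2 * L * (M * Y * (M * Y))) - n̂ * n̂ * g²
          ≤ nat 4 * (L * L) * (M * Y * (M * Y)) * ∑ Z heavy
        summed = subst₂ _≤_
          (trans (∑-- Z _ _) (cong₂ _-_ (trans (∑-- Z _ _) (cong₂ _-_
            (trans (∑-* Z _ _) (cong (λ a → nat 4 * L * (n̂ * (M * Y)) * a) (trans (∑-average f-per ν) (cong (Y *_) mass))))
            (trans (∑-const Z _) (cong (_* (nat 2 * L * (M * Y * (M * Y)))) (len-range N)))))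
            (∑-* Z (n̂ * n̂) _)))
          (∑-* Z _ _)
          (∑-mono Z (λ t → Dichotomy.heavy-bound n̂ M Y (g t) 0≤nat (1≤⇒0≤ 1≤M) (0≤len ν) L (0≤* 0≤nat (1≤⇒0≤ 1≤D₀))))
        conclude : ∀ n d c M W Y h g f → c ≡ M * Y → 1# ≤ d → 1# ≤ c → 0# ≤ n → g ≤ Y * Y * f → f ≤ nat 2 * (W * W) →
            n * (W * W) ≤ d * (M * M) →
          nat 4 * (nat 2 * d) * (n * c) * (Y * M) - n * (nat 2 * (nat 2 * d) * (c * c)) - n * n * g
            ≤ nat 4 * (nat 2 * d * (nat 2 * d)) * (c * c) * h →
          n ≤ nat 8 * d * h
        conclude n d _ M W Y h g f refl 1≤d 1≤c 0≤n g≤ f≤ nW² s =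
          cancel (1≤* (nat-mono {1} {2} (ℕ.s≤s ℕ.z≤n)) (1≤* 1≤d (1≤* 1≤c 1≤c)))
            (≤by _ (eq n d M W Y h g f)
              (0≤+ (gap s) (0≤+ (0≤* (0≤sq n) (gap g≤)) (0≤+ (0≤* (0≤* (0≤sq n) (0≤sq Y)) (gap f≤))
                (0≤* (0≤* (0≤* 0≤nat 0≤n) (0≤sq Y)) (gap nW²))))))
          where
          eq : ∀ n d M W Y h g f → nat 2 * (d * (M * Y * (M * Y))) * (nat 8 * d * h) - nat 2 * (d * (M * Y * (M * Y))) * n ≡
            nat 4 * (nat 2 * d * (nat 2 * d)) * (M * Y * (M * Y)) * h
              - (nat 4 * (nat 2 * d) * (n * (M * Y)) * (Y * M) - n * (nat 2 * (nat 2 * d) * (M * Y * (M * Y))) - n * n * g)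
            + (n * n * (Y * Y * f - g) + (n * n * (Y * Y) * (nat 2 * (W * W) - f)
            + nat 2 * n * (Y * Y) * (d * (M * M) - n * (W * W))))
          eq = solve-∀ ring

      -- When averaging over ν hardly decreases the energy, most values of f at t + q are close to the average.
      configurations-many : nat 1280 * (D₀ * D₀) * (Y * Y * ‖ f ‖² - g²) ≤ Y * Y * (W * W) →
        M * M * M * (M * M) * len T ≤ nat 16384 * D₀ * (n̂ * n̂ * n̂ * n̂) * configurations
      configurations-many stable = conclude M (len T) (∑ Z heavy) n̂ configurations (Y * Y * ‖ f ‖² - g²) Y D₀ W Y≡
        1≤D₀ 1≤Y 1≤N (1≤⇒0≤ 1≤M) (0≤len T) heavy-often stable NW²≤ summed
        where
        c₁ c₂ : R
        c₁ = M * M * M * (M * Y * (M * Y))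
        c₂ = M * M * M * (nat 16 * (n̂ * n̂))
        c₃ : R
        c₃ = Y * Y * (nat 1024 * (n̂ * n̂ * n̂ * n̂ * n̂))
        value : I → ℤ → R
        value τ t = Π₅ (f (t ℤ.+ q₁ τ)) (f (t ℤ.+ q₂ τ)) (f (t ℤ.+ q₃ τ)) (f (t ℤ.+ q₄ τ)) (f (t ℤ.+ q₅ τ))
        at : ∀ t → len T * (c₁ * heavy t) ≤ c₃ * ∑ T (λ τ → value τ t) + c₂ * variance f-per ν t
        at t = subst₂ _≤_ (∑-const T _)
          (trans (∑-+ T _ _) (cong₂ _+_ (∑-* T c₃ _) (trans (∑-* T c₂ _) (cong (c₂ *_) (sym (∑-ν (λ q → deviation t (f (t ℤ.+ q)))))))))
          (∑-mono T (λ τ → Dichotomy.pointwise n̂ M Y (g t) 0≤nat (1≤⇒0≤ 1≤M) (0≤len ν)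
            (f (t ℤ.+ q₁ τ)) (f (t ℤ.+ q₂ τ)) (f (t ℤ.+ q₃ τ)) (f (t ℤ.+ q₄ τ)) (f (t ℤ.+ q₅ τ))
            (0≤f _) (0≤f _) (0≤f _) (0≤f _) (0≤f _)))
        summed : len T * (c₁ * ∑ Z heavy) ≤ c₃ * configurations + c₂ * (Y * (Y * Y * ‖ f ‖² - g²))
        summed = subst₂ _≤_ (trans (∑-* Z (len T) _) (cong (len T *_) (∑-* Z c₁ _)))
          (trans (∑-+ Z _ _) (cong₂ _+_ (∑-* Z c₃ _) (trans (∑-* Z c₂ _) (cong (c₂ *_) (∑-variance≡ f-per ν)))))
          (∑-mono Z at)
        conclude : ∀ M R S N Θ V Y D W → Y ≡ nat 5 * R → 1# ≤ D → 1# ≤ Y → 1# ≤ N → 0# ≤ M → 0# ≤ R → N ≤ nat 8 * D * S →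
          nat 1280 * (D * D) * V ≤ Y * Y * (W * W) → N * (W * W) ≤ D * (M * M) →
          R * (M * M * M * (M * Y * (M * Y)) * S) ≤
            Y * Y * (nat 1024 * (N * N * N * N * N)) * Θ + M * M * M * (nat 16 * (N * N)) * (Y * V) →
          M * M * M * (M * M) * R ≤ nat 16384 * D * (N * N * N * N) * Θ
        conclude M R S N Θ V Y D W Y≡ 1≤D 1≤Y 1≤N 0≤M 0≤R b c d a =
          cancel (1≤* (1≤* 1≤Y 1≤Y) 1≤N) (≤by _ (eq₂ M R S N Θ V Y D)
            (0≤+ (0≤* (0≤* 0≤nat (1≤⇒0≤ 1≤D)) (gap a)) (0≤+ (0≤* 0≤M³ (gap e))
              (0≤* (0≤* 0≤nat (0≤* 0≤R (0≤* 0≤M³ (0≤sq (M * Y))))) (gap b)))))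
          where
          0≤M³ : 0# ≤ M * M * M
          0≤M³ = 0≤* (0≤sq M) 0≤M
          eq₁ : ∀ M R N V D W → nat 5 * D * (N * R * (M * (nat 5 * R) * (M * (nat 5 * R))))
              - nat 5 * D * (nat 256 * D * (N * N) * (nat 5 * R * V)) ≡
            N * N * (nat 5 * R) * (nat 5 * R * (nat 5 * R) * (W * W) - nat 1280 * (D * D) * V)
            + N * (nat 5 * R) * (nat 5 * R * (nat 5 * R)) * (D * (M * M) - N * (W * W))
          eq₁ = solve-∀ ring
          0≤Y : 0# ≤ Y
          0≤Y = 1≤⇒0≤ 1≤Y
          -- The deviations use up at most half of what the heavy positions supply. This fixes both
          -- constants: 1280 is 5 · 16 · 16, with 5 from |ν| = 5|T| and one 16 from `deviates`, and
          -- 16384 is 2 · 8 · 1024.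
          e : nat 256 * D * (N * N) * (Y * V) ≤ N * R * (M * Y * (M * Y))
          e = cancel (1≤* (nat-mono {1} {5} (ℕ.s≤s ℕ.z≤n)) 1≤D) (≤by _
            (subst (λ Y → nat 5 * D * (N * R * (M * Y * (M * Y))) - nat 5 * D * (nat 256 * D * (N * N) * (Y * V)) ≡
              N * N * Y * (Y * Y * (W * W) - nat 1280 * (D * D) * V) + N * Y * (Y * Y) * (D * (M * M) - N * (W * W)))
              (sym Y≡) (eq₁ M R N V D W))
            (0≤+ (0≤* (0≤* (0≤sq N) 0≤Y) (gap c)) (0≤* (0≤* (0≤* (1≤⇒0≤ 1≤N) 0≤Y) (0≤sq Y)) (gap d))))
          eq₂ : ∀ M R S N Θ V Y D →
            Y * Y * N * (nat 16384 * D * (N * N * N * N) * Θ) - Y * Y * N * (M * M * M * (M * M) * R) ≡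
            nat 16 * D * (Y * Y * (nat 1024 * (N * N * N * N * N)) * Θ + M * M * M * (nat 16 * (N * N)) * (Y * V)
              - R * (M * M * M * (M * Y * (M * Y)) * S))
            + (M * M * M * (N * R * (M * Y * (M * Y)) - nat 256 * D * (N * N) * (Y * V))
            + nat 2 * (R * (M * M * M * (M * Y * (M * Y)))) * (nat 8 * D * S - N))
          eq₂ = solve-∀ ring

  -- Quintuples and the linear form of the equation

  ∑-cartesian : ∀ {I J : Set} (L : List I) (M : List J) f → ∑ (cartesianProduct L M) f ≡ ∑ L (λ x → ∑ M (λ y → f (x , y)))
  ∑-cartesian = ∑-cartesianWith _,_

  len-cartesian : ∀ {I J : Set} (L : List I) (M : List J) → len (cartesianProduct L M) ≡ len L * len M
  len-cartesian L M = trans (∑-cartesian L M _) (∑-const L (len M))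

  ∑-cartesian-* : ∀ {I J : Set} (L : List I) (M : List J) (f : I → R) (g : J → R) →
    ∑ L f * ∑ M g ≡ ∑ (cartesianProduct L M) (λ (x , y) → f x * g y)
  ∑-cartesian-* L M f g = trans (∑-*∑ L M f g) (sym (∑-cartesian L M _))

  -- The components are ordered (x₅ , x₃ , x₄ , x₁ , x₂), the order in which the sums in solutions unfold.
  Quintuple : Set
  Quintuple = ℤ × ℤ × ℤ × ℤ × ℤ

  quintuples : List ℤ → List Quintuple
  quintuples L = cartesianProduct L (cartesianProduct L (cartesianProduct L (cartesianProduct L L)))

  Π₅-∑ : ∀ L (h₁ h₂ h₃ h₄ h₅ : ℤ → R) → Π₅ (∑ L h₁) (∑ L h₂) (∑ L h₃) (∑ L h₄) (∑ L h₅) ≡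
    ∑ (quintuples L) (λ (x₅ , x₃ , x₄ , x₁ , x₂) → Π₅ (h₁ x₁) (h₂ x₂) (h₃ x₃) (h₄ x₄) (h₅ x₅))
  Π₅-∑ L h₁ h₂ h₃ h₄ h₅ =
    trans (cong (λ a → ∑ L h₅ * (∑ L h₃ * (∑ L h₄ * a))) (∑-cartesian-* L L h₁ h₂))
    (trans (cong (λ a → ∑ L h₅ * (∑ L h₃ * a)) (∑-cartesian-* L _ h₄ _))
    (trans (cong (λ a → ∑ L h₅ * a) (∑-cartesian-* L _ h₃ _)) (∑-cartesian-* L _ h₅ _)))

  ∑-quintuples : ∀ L f → ∑ (quintuples L) f ≡
    ∑ L (λ x₅ → ∑ L (λ x₃ → ∑ L (λ x₄ → ∑ L (λ x₁ → ∑ L (λ x₂ → f (x₅ , x₃ , x₄ , x₁ , x₂))))))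
  ∑-quintuples L f = trans (∑-cartesian L _ f) (∑-cong L (λ x₅ → trans (∑-cartesian L _ _) (∑-cong L (λ x₃ →
    trans (∑-cartesian L _ _) (∑-cong L (λ x₄ → ∑-cartesian L L _))))))

  len-quintuples : ∀ L → len (quintuples L) ≡ Π₅ (len L) (len L) (len L) (len L) (len L)
  len-quintuples L = sym (Π₅-∑ L _ _ _ _ _)

  mul : ℕ → List ℤ → List ℤ
  mul c = map (λ x → + c ℤ.* x)

  form : ℕ → ℕ → Quintuple → ℤ
  form a b (x₅ , x₃ , x₄ , x₁ , x₂) =
    + a ℤ.* x₁ ℤ.+ + a ℤ.* x₂ ℤ.+ + b ℤ.* x₃ ℤ.- (+ a ℤ.* x₄ ℤ.+ (+ a ℤ.+ + b) ℤ.* x₅)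

  -- Counting solutions in smoothings of A

  module Counting (N : ℕ) .{{_ : ℕ.NonZero N}} (a b : ℕ) (A : List ℤ) where
    open Cyclic N
    open Periods N
    open Continuity N
    open Density N

    δ*-≤ : ∀ {x y c} → 0# ≤ c → (+ N ∣ x → y ≤ c) → δ x * y ≤ c
    δ*-≤ {x} {y} {c} 0≤c h with + N ∣? x
    ... | yes p = ≤-trans (≤-reflexive (eq y)) (h p)
      where
      eq : ∀ y → 1# * y ≡ y
      eq = solve-∀ ring
    ... | no _ = ≤-trans (≤-reflexive (eq y)) 0≤c
      where
      eq : ∀ y → 0# * y ≡ 0#
      eq = solve-∀ ring

    T₀ : ℤ → R
    T₀ = solutions (mul a A) (mul b A) (mul (a ℕ.+ b) A)

    T₀≡ : ∀ s → T₀ s ≡ ∑ (quintuples A) (λ x → δ (form a b x ℤ.+ s))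
    T₀≡ s = begin
      T₀ s
        ≡⟨ ∑-cong Z (λ z → *-comm (r L (z ℤ.- s)) (r (C ⊕ neg B) z)) ⟩
      ∑ Z (λ z → r (C ⊕ neg B) z * r L (z ℤ.- s))
        ≡⟨ ∑-r* (C ⊕ neg B) (per-shift (ℤ.- s) (r-per L)) ⟩
      ∑ (C ⊕ neg B) (λ l → r L (l ℤ.- s))
        ≡⟨ ∑-⊕ C (neg B) _ ⟩
      ∑ C (λ c → ∑ (neg B) (λ b′ → r L (c ℤ.+ b′ ℤ.- s)))
        ≡⟨ trans (∑-map _ A (λ c → ∑ (neg B) (λ b′ → r L (c ℤ.+ b′ ℤ.- s))))
            (∑-cong A (λ x₅ → ∑-neg-mul b (λ b′ → r L (+ (a ℕ.+ b) ℤ.* x₅ ℤ.+ b′ ℤ.- s)))) ⟩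
      ∑ A (λ x₅ → ∑ A (λ x₃ → r L (+ (a ℕ.+ b) ℤ.* x₅ ℤ.+ ℤ.- (+ b ℤ.* x₃) ℤ.- s)))
        ≡⟨ ∑-cong A (λ x₅ → ∑-cong A (λ x₃ → r-L (+ (a ℕ.+ b) ℤ.* x₅ ℤ.+ ℤ.- (+ b ℤ.* x₃) ℤ.- s))) ⟩
      ∑ A (λ x₅ → ∑ A (λ x₃ → ∑ A (λ x₄ → ∑ A (λ x₁ → ∑ A (λ x₂ →
        δ (+ (a ℕ.+ b) ℤ.* x₅ ℤ.+ ℤ.- (+ b ℤ.* x₃) ℤ.- s ℤ.- (ℤ.- (+ a ℤ.* x₄) ℤ.+ (+ a ℤ.* x₁ ℤ.+ + a ℤ.* x₂))))))))
        ≡⟨ ∑-cong A (λ x₅ → ∑-cong A (λ x₃ → ∑-cong A (λ x₄ → ∑-cong A (λ x₁ → ∑-cong A (λ x₂ →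
             δ-even (eq (+ a) (+ b) x₁ x₂ x₃ x₄ x₅ s)))))) ⟩
      ∑ A (λ x₅ → ∑ A (λ x₃ → ∑ A (λ x₄ → ∑ A (λ x₁ → ∑ A (λ x₂ → δ (form a b (x₅ , x₃ , x₄ , x₁ , x₂) ℤ.+ s))))))
        ≡⟨ sym (∑-quintuples A _) ⟩
      ∑ (quintuples A) (λ x → δ (form a b x ℤ.+ s)) ∎
      where
      open ≡-Reasoning
      X B C L : List ℤ
      X = mul a A
      B = mul b A
      C = mul (a ℕ.+ b) A
      L = neg X ⊕ (X ⊕ X)
      ∑-neg-mul : ∀ c (f : ℤ → R) → ∑ (neg (mul c A)) f ≡ ∑ A (λ x → f (ℤ.- (+ c ℤ.* x)))
      ∑-neg-mul c f = trans (∑-map (λ x → ℤ.- x) (mul c A) f) (∑-map (λ x → + c ℤ.* x) A (λ x → f (ℤ.- x)))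
      ∑-mul : ∀ c (f : ℤ → R) → ∑ (mul c A) f ≡ ∑ A (λ x → f (+ c ℤ.* x))
      ∑-mul c f = ∑-map (λ x → + c ℤ.* x) A f
      r-L : ∀ y → r L y ≡ ∑ A (λ x₄ → ∑ A (λ x₁ → ∑ A (λ x₂ → δ (y ℤ.- (ℤ.- (+ a ℤ.* x₄) ℤ.+ (+ a ℤ.* x₁ ℤ.+ + a ℤ.* x₂))))))
      r-L y = trans (∑-⊕ (neg X) (X ⊕ X) (λ l → δ (y ℤ.- l))) (trans (∑-neg-mul a (λ k → ∑ (X ⊕ X) (λ l → δ (y ℤ.- (k ℤ.+ l)))))
        (∑-cong A (λ x₄ → trans (∑-⊕ X X _) (trans (∑-mul a _) (∑-cong A (λ x₁ → ∑-mul a _))))))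
      eq : ∀ a b x₁ x₂ x₃ x₄ x₅ s →
        ℤ.- ((a ℤ.+ b) ℤ.* x₅ ℤ.+ ℤ.- (b ℤ.* x₃) ℤ.- s ℤ.- (ℤ.- (a ℤ.* x₄) ℤ.+ (a ℤ.* x₁ ℤ.+ a ℤ.* x₂))) ≡
        a ℤ.* x₁ ℤ.+ a ℤ.* x₂ ℤ.+ b ℤ.* x₃ ℤ.- (a ℤ.* x₄ ℤ.+ (a ℤ.+ b) ℤ.* x₅) ℤ.+ s
      eq = solve-ℤ

    smoothed : List ℤ → ℤ → R
    smoothed P z = ∑ P (λ p → r A (z ℤ.+ p))

    smoothed-per : ∀ P → Per (smoothed P)
    smoothed-per P = per-∑ P (λ p → per-shift p (r-per A))

    0≤smoothed : ∀ P z → 0# ≤ smoothed P z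
    0≤smoothed P z = 0≤∑ P (λ p → 0≤r A (z ℤ.+ p))

    ∑-smoothed : ∀ P → ∑ Z (smoothed P) ≡ len A * len P
    ∑-smoothed P = trans (∑-swap Z P (λ z p → r A (z ℤ.+ p)))
      (trans (∑-cong P (λ p → trans (∑-shift (r-per A) p) (∑-r A))) (trans (∑-const P (len A)) (*-comm (len P) (len A))))

    smoothed-⊕ : ∀ ν P t → smoothed (ν ⊕ P) t ≡ average (smoothed-per P) ν t
    smoothed-⊕ ν P t = trans (∑-⊕ ν P _) (∑-cong ν (λ q → ∑-cong P (λ p → cong (r A) (eq t q p))))
      where
      eq : ∀ t q p → t ℤ.+ (q ℤ.+ p) ≡ t ℤ.+ q ℤ.+ p
      eq = solve-ℤ

    Triple : Set
    Triple = ℤ × ℤ × ℤ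

    -- With q₃ = −a m and q₅ = 0, the form a (q₁ + q₂ − q₄ − q₅) + b (q₃ − q₅) vanishes.
    q₁ q₂ q₃ q₄ q₅ : Triple → ℤ
    q₁ (m , z , x) = x
    q₂ (m , z , x) = z ℤ.+ ℤ.- x ℤ.+ + b ℤ.* m
    q₃ (m , z , x) = ℤ.- (+ a ℤ.* m)
    q₄ (m , z , x) = z
    q₅ (m , z , x) = + 0

    module Window (V : List ℤ) (distinct : Distinct V) (distinct-a : Distinct (mul a V)) (P : List ℤ) where

      T : List Triple
      T = cartesianProduct V (cartesianProduct V V)

      -- Every shift that occurs in any of the five positions is listed, with multiplicity, so that
      -- the variance along `ν` controls the deviations in all positions together.
      ν : List ℤ
      ν = map q₁ T ++ map q₂ T ++ map q₃ T ++ map q₄ T ++ map q₅ T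

      ∑-ν : ∀ φ → ∑ ν φ ≡ ∑ T (λ τ → φ (q₁ τ) + φ (q₂ τ) + φ (q₃ τ) + φ (q₄ τ) + φ (q₅ τ))
      ∑-ν φ = trans split (trans (eq (∑ T (φ ∘ q₁)) (∑ T (φ ∘ q₂)) (∑ T (φ ∘ q₃)) (∑ T (φ ∘ q₄)) (∑ T (φ ∘ q₅))) (sym joined))
        where
        eq : ∀ a b c d e → a + (b + (c + (d + e))) ≡ a + b + c + d + e
        eq = solve-∀ ring
        split : ∑ ν φ ≡ ∑ T (φ ∘ q₁) + (∑ T (φ ∘ q₂) + (∑ T (φ ∘ q₃) + (∑ T (φ ∘ q₄) + ∑ T (φ ∘ q₅))))
        split = trans (∑-++ (map q₁ T) _ φ) (cong₂ _+_ (∑-map q₁ T φ)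
          (trans (∑-++ (map q₂ T) _ φ) (cong₂ _+_ (∑-map q₂ T φ)
          (trans (∑-++ (map q₃ T) _ φ) (cong₂ _+_ (∑-map q₃ T φ)
          (trans (∑-++ (map q₄ T) _ φ) (cong₂ _+_ (∑-map q₄ T φ) (∑-map q₅ T φ))))))))
        joined : ∑ T (λ τ → φ (q₁ τ) + φ (q₂ τ) + φ (q₃ τ) + φ (q₄ τ) + φ (q₅ τ)) ≡
          ∑ T (φ ∘ q₁) + ∑ T (φ ∘ q₂) + ∑ T (φ ∘ q₃) + ∑ T (φ ∘ q₄) + ∑ T (φ ∘ q₅)
        joined = trans (∑-+ T _ _) (cong₂ _+_ (trans (∑-+ T _ _) (cong₂ _+_ (trans (∑-+ T _ _)
            (cong₂ _+_ (∑-+ T _ _) refl)) refl)) refl)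

      residue : ℤ → (Triple → ℤ) → ℤ → ℤ → Triple → ℤ
      residue t q p x τ = t ℤ.+ q τ ℤ.+ p ℤ.- x

      matches : Quintuple → Quintuple → ℤ → Triple → R
      matches (p₅ , p₃ , p₄ , p₁ , p₂) (x₅ , x₃ , x₄ , x₁ , x₂) t τ =
        Π₅ (δ (residue t q₁ p₁ x₁ τ)) (δ (residue t q₂ p₂ x₂ τ)) (δ (residue t q₃ p₃ x₃ τ))
           (δ (residue t q₄ p₄ x₄ τ)) (δ (residue t q₅ p₅ x₅ τ))

      -- The fifth congruence determines t, the third then a m and hence m, the fourth z, and the
      -- first the last component of the triple. What remains of the second congruence is that x and
      -- p have congruent forms, because the form vanishes on t + qᵢ.
      matches≤ : ∀ p x → ∑ Z (λ t → ∑ T (matches p x t)) ≤ δ (form a b x ℤ.- form a b p)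
      matches≤ p@(p₅ , p₃ , p₄ , p₁ , p₂) x@(x₅ , x₃ , x₄ , x₁ , x₂) = begin
        ∑ Z (λ t → ∑ T (matches p x t))
          ≡⟨ ∑-cong Z (λ t → trans (∑-cartesian V (cartesianProduct V V) (matches p x t))
               (∑-cong V (λ m → ∑-cartesian V V (λ zy → matches p x t (m , zy))))) ⟩
        ∑ Z (λ t → ∑ V (λ m → ∑ V (λ z → ∑ V (λ y → matches p x t (m , z , y)))))
          ≤⟨ ∑-mono Z (λ t → ∑-mono V (λ m → ∑-mono V (λ z → ∑-mono V (λ y → pointwise t m z y)))) ⟩
        ∑ Z (λ t → ∑ V (λ m → ∑ V (λ z → ∑ V (λ y → δ₅ t * (δ₃ m * (δ₄ z * (δ₁ y * k)))))))
          ≡⟨ ∑-cong Z (λ t → trans (∑-cong V (λ m → trans (∑-cong V (λ z → trans (∑-* V (δ₅ t) _)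
               (cong (δ₅ t *_) (trans (∑-* V (δ₃ m) _) (cong (δ₃ m *_) (trans (∑-* V (δ₄ z) _) (cong (δ₄ z *_) (∑-*ʳ V k δ₁))))))))
               (trans (∑-* V (δ₅ t) _) (cong (δ₅ t *_) (trans (∑-* V (δ₃ m) _) (cong (δ₃ m *_) (∑-*ʳ V (∑ V δ₁ * k) δ₄)))))))
               (trans (∑-* V (δ₅ t) _) (cong (δ₅ t *_) (∑-*ʳ V (∑ V δ₄ * (∑ V δ₁ * k)) δ₃)))) ⟩
        ∑ Z (λ t → δ₅ t * (∑ V δ₃ * (∑ V δ₄ * (∑ V δ₁ * k))))
          ≡⟨ ∑-*ʳ Z (∑ V δ₃ * (∑ V δ₄ * (∑ V δ₁ * k))) δ₅ ⟩
        ∑ Z δ₅ * (∑ V δ₃ * (∑ V δ₄ * (∑ V δ₁ * k)))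
          ≤⟨ at-most (≤-reflexive (trans (∑-shift δ-per (ℤ.- (x₅ ℤ.- p₅))) ∑-δ))
               (0≤* (0≤∑ V (λ v → 0≤δ _)) (0≤* (0≤∑ V (λ v → 0≤δ _)) (0≤* (0≤∑ V (λ v → 0≤δ _)) (0≤δ _)))) ⟩
        ∑ V δ₃ * (∑ V δ₄ * (∑ V δ₁ * k))
          ≤⟨ at-most (subst (_≤ 1#) (∑-map _ V (λ v → δ (v ℤ.- (x₅ ℤ.- p₅ ℤ.- (x₃ ℤ.- p₃))))) (distinct-a _))
              (0≤* (0≤∑ V (λ v → 0≤δ _)) (0≤* (0≤∑ V (λ v → 0≤δ _)) (0≤δ _))) ⟩
        ∑ V δ₄ * (∑ V δ₁ * k)
          ≤⟨ at-most (distinct _) (0≤* (0≤∑ V (λ v → 0≤δ _)) (0≤δ _)) ⟩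
        ∑ V δ₁ * k
          ≤⟨ at-most (distinct _) (0≤δ _) ⟩
        k ∎
        where
        open ≤-Reasoning
        k : R
        k = δ (form a b x ℤ.- form a b p)
        δ₅ δ₃ δ₄ δ₁ : ℤ → R
        δ₅ t = δ (t ℤ.- (x₅ ℤ.- p₅))
        δ₃ m = δ (+ a ℤ.* m ℤ.- (x₅ ℤ.- p₅ ℤ.- (x₃ ℤ.- p₃)))
        δ₄ z = δ (z ℤ.- (x₄ ℤ.- p₄ ℤ.- (x₅ ℤ.- p₅)))
        δ₁ y = δ (y ℤ.- (x₁ ℤ.- p₁ ℤ.- (x₅ ℤ.- p₅)))
        at-most : ∀ {c y} → c ≤ 1# → 0# ≤ y → c * y ≤ y
        at-most {c} {y} c≤1 0≤y = ≤-trans (*-monoʳ 0≤y c≤1) (≤-reflexive (*-identityˡ y))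
        pointwise : ∀ t m z y → matches p x t (m , z , y) ≤ δ₅ t * (δ₃ m * (δ₄ z * (δ₁ y * k)))
        pointwise t m z y =
          δ*-≤ 0≤c (λ d₅ → δ*-≤ 0≤c (λ d₃ → δ*-≤ 0≤c (λ d₄ → δ*-≤ 0≤c (λ d₁ → δ-≤ _ (λ d₂ →
            1≤* (1≤δ _ (subst (+ N ∣_) (eq₅ t p₅ x₅) d₅))
            (1≤* (1≤δ _ (∣-+ d₅ (∣m⇒∣-m d₃) (eq₃ (+ a) t m p₅ x₅ p₃ x₃)))
            (1≤* (1≤δ _ (∣-+ d₄ (∣m⇒∣-m d₅) (eq₄ t z p₅ x₅ p₄ x₄)))
            (1≤* (1≤δ _ (∣-+ d₁ (∣m⇒∣-m d₅) (eq₄ t y p₅ x₅ p₁ x₁)))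
            (1≤δ _ (∣-neg (∣-+ (∣n⇒∣m*n (+ a) (∣-+ (∣-+ d₁ d₂ refl) (∣m⇒∣-m (∣-+ d₄ d₅ refl)) refl))
               (∣n⇒∣m*n (+ b) (∣-+ d₃ (∣m⇒∣-m d₅) refl)) refl)
               (eq (+ a) (+ b) t m z y p₁ p₂ p₃ p₄ p₅ x₁ x₂ x₃ x₄ x₅))))))) 0≤c))))
          where
          0≤c : 0# ≤ δ₅ t * (δ₃ m * (δ₄ z * (δ₁ y * k)))
          0≤c = 0≤* (0≤δ _) (0≤* (0≤δ _) (0≤* (0≤δ _) (0≤* (0≤δ _) (0≤δ _))))
          eq₅ : ∀ t p₅ x₅ → t ℤ.+ + 0 ℤ.+ p₅ ℤ.- x₅ ≡ t ℤ.- (x₅ ℤ.- p₅)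
          eq₅ = solve-ℤ
          eq₃ : ∀ a t m p₅ x₅ p₃ x₃ → (t ℤ.+ + 0 ℤ.+ p₅ ℤ.- x₅) ℤ.+ ℤ.- (t ℤ.+ ℤ.- (a ℤ.* m) ℤ.+ p₃ ℤ.- x₃)
            ≡ a ℤ.* m ℤ.- (x₅ ℤ.- p₅ ℤ.- (x₃ ℤ.- p₃))
          eq₃ = solve-ℤ
          eq₄ : ∀ t z p₅ x₅ p₄ x₄ → (t ℤ.+ z ℤ.+ p₄ ℤ.- x₄) ℤ.+ ℤ.- (t ℤ.+ + 0 ℤ.+ p₅ ℤ.- x₅)
            ≡ z ℤ.- (x₄ ℤ.- p₄ ℤ.- (x₅ ℤ.- p₅))
          eq₄ = solve-ℤ
          eq : ∀ a b t m z y p₁ p₂ p₃ p₄ p₅ x₁ x₂ x₃ x₄ x₅ →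
            ℤ.- (a ℤ.* ((t ℤ.+ y ℤ.+ p₁ ℤ.- x₁) ℤ.+ (t ℤ.+ (z ℤ.+ ℤ.- y ℤ.+ b ℤ.* m) ℤ.+ p₂ ℤ.- x₂)
                ℤ.+ ℤ.- ((t ℤ.+ z ℤ.+ p₄ ℤ.- x₄) ℤ.+ (t ℤ.+ + 0 ℤ.+ p₅ ℤ.- x₅)))
              ℤ.+ b ℤ.* ((t ℤ.+ ℤ.- (a ℤ.* m) ℤ.+ p₃ ℤ.- x₃) ℤ.+ ℤ.- (t ℤ.+ + 0 ℤ.+ p₅ ℤ.- x₅)))
            ≡ a ℤ.* x₁ ℤ.+ a ℤ.* x₂ ℤ.+ b ℤ.* x₃ ℤ.- (a ℤ.* x₄ ℤ.+ (a ℤ.+ b) ℤ.* x₅)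
              ℤ.- (a ℤ.* p₁ ℤ.+ a ℤ.* p₂ ℤ.+ b ℤ.* p₃ ℤ.- (a ℤ.* p₄ ℤ.+ (a ℤ.+ b) ℤ.* p₅))
          eq = solve-ℤ

      count : R
      count = ∑ Z (λ t → ∑ T (λ τ → Π₅ (smoothed P (t ℤ.+ q₁ τ)) (smoothed P (t ℤ.+ q₂ τ)) (smoothed P (t ℤ.+ q₃ τ))
        (smoothed P (t ℤ.+ q₄ τ)) (smoothed P (t ℤ.+ q₅ τ))))

      count≤ : count ≤ ∑ (quintuples P) (λ p → T₀ (ℤ.- form a b p))
      count≤ = begin
        count
          ≡⟨ ∑-cong Z (λ t → ∑-cong T (λ τ → trans (Π₅-∑ P _ _ _ _ _) (∑-cong P⁵ (λ p → Π₅-∑ A _ _ _ _ _)))) ⟩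
        ∑ Z (λ t → ∑ T (λ τ → ∑ P⁵ (λ p → ∑ A⁵ (λ x → matches p x t τ))))
          ≡⟨ trans (∑-cong Z (λ t → trans (∑-swap T P⁵ _) (∑-cong P⁵ (λ p → ∑-swap T A⁵ (λ τ x → matches p x t τ)))))
               (trans (∑-swap Z P⁵ _) (∑-cong P⁵ (λ p → ∑-swap Z A⁵ (λ t x → ∑ T (matches p x t))))) ⟩
        ∑ P⁵ (λ p → ∑ A⁵ (λ x → ∑ Z (λ t → ∑ T (matches p x t))))
          ≤⟨ ∑-mono P⁵ (λ p → ∑-mono A⁵ (λ x → matches≤ p x)) ⟩
        ∑ P⁵ (λ p → ∑ A⁵ (λ x → δ (form a b x ℤ.- form a b p)))
          ≡⟨ ∑-cong P⁵ (λ p → sym (T₀≡ (ℤ.- form a b p))) ⟩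
        ∑ P⁵ (λ p → T₀ (ℤ.- form a b p)) ∎
        where
        open ≤-Reasoning
        P⁵ A⁵ : List Quintuple
        P⁵ = quintuples P
        A⁵ = quintuples A

  ceil : R → ℕ
  ceil (int i) = ℤ.∣ i ∣

  ≤ceil : ∀ x → x ≤ nat (ceil x)
  ≤ceil (int (+ n)) = ≤-refl
  ≤ceil (int ℤ.-[1+ n ]) = int≤ ℤ.-≤+

  ∈-quintuples : ∀ L {x} → x ∈ quintuples L →
    let (x₅ , x₃ , x₄ , x₁ , x₂) = x in x₁ ∈ L × x₂ ∈ L × x₃ ∈ L × x₄ ∈ L × x₅ ∈ L
  ∈-quintuples L p =
    let p₅ , q = ∈-cartesianProduct⁻ L _ p
        p₃ , q = ∈-cartesianProduct⁻ L _ q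
        p₄ , q = ∈-cartesianProduct⁻ L _ q
        p₁ , p₂ = ∈-cartesianProduct⁻ L L q
    in p₁ , p₂ , p₃ , p₄ , p₅

  ∀∈-map : ∀ {I : Set} {Q : ℤ → Set} (f : I → ℤ) {L} → (∀ {x} → x ∈ L → Q (f x)) → ∀ {v} → v ∈ map f L → Q v
  ∀∈-map {Q = Q} f h v∈ = let x , x∈ , eq = ∈-map⁻ f v∈ in subst Q (sym eq) (h x∈)

  ∀∈-++ : ∀ {Q : ℤ → Set} L {M} → (∀ {v} → v ∈ L → Q v) → (∀ {v} → v ∈ M → Q v) → ∀ {v} → v ∈ L ++ M → Q v
  ∀∈-++ L h h′ v∈ with ∈-++⁻ L v∈
  ... | inj₁ p = h p
  ... | inj₂ p = h′ p

  -- Suppose c t ≥ m³. Since c t₀ ≤ 3 c m² ≤ m³ / 2, it follows that m³ ≤ 2 c (t - t₀). Fourth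
  -- powers then give q ≤ 16 · 32 c⁴ = 512 c⁴, which the choice of `q` excludes.
  cube-bound : ∀ c m q t t₀ → 1# ≤ c → 1# ≤ m → t₀ ≤ nat 3 * (m * m) → nat 6 * c ≤ m → nat 512 * (c * c * (c * c)) + 1# ≤ q →
    q * ((t - t₀) * (t - t₀) * ((t - t₀) * (t - t₀))) ≤ nat 32 * (m * m * (m * m) * (m * m) * (m * m * (m * m) * (m * m))) →
    1# + c * t ≤ m * m * m
  cube-bound c m q t t₀ 1≤c 1≤m t₀≤ 6c≤m q≥ h with 1# + c * t ≤? m * m * m
  ... | yes p = p
  ... | no ¬p = ⊥-elim (1≰0 (cancel 1≤m¹² (≤by _ (eq₃ c m¹² q u⁴)
          (0≤+ (0≤* 0≤m¹² (gap q≥)) (0≤+ (0≤* 0≤q (gap quartic)) (0≤* (0≤* 0≤nat 0≤c⁴) (gap h)))))))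
    where
    0≤c : 0# ≤ c
    0≤c = 1≤⇒0≤ 1≤c
    m³ m¹² u c⁴ u⁴ : R
    m³ = m * m * m
    m¹² = m * m * (m * m) * (m * m) * (m * m * (m * m) * (m * m))
    u = t - t₀
    c⁴ = c * c * (c * c)
    u⁴ = u * u * (u * u)
    1≤m² : 1# ≤ m * m
    1≤m² = 1≤* 1≤m 1≤m
    1≤m¹² : 1# ≤ m¹²
    1≤m¹² = 1≤* (1≤* (1≤* 1≤m² 1≤m²) 1≤m²) (1≤* (1≤* 1≤m² 1≤m²) 1≤m²)
    0≤m¹² : 0# ≤ m¹²
    0≤m¹² = 1≤⇒0≤ 1≤m¹²
    0≤c⁴ : 0# ≤ c⁴
    0≤c⁴ = 0≤sq (c * c)
    0≤q : 0# ≤ q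
    0≤q = ≤-trans (0≤+ (0≤* 0≤nat 0≤c⁴) 0≤1) q≥
    0≤m³ : 0# ≤ m³
    0≤m³ = 1≤⇒0≤ (1≤* 1≤m² 1≤m)
    eq₁ : ∀ c m t t₀ → nat 2 * c * (t - t₀) - m * m * m ≡
      nat 2 * (1# + c * t - (1# + m * m * m)) + (nat 2 * c * (nat 3 * (m * m) - t₀) + m * m * (m - nat 6 * c))
    eq₁ = solve-∀ ring
    linear : m³ ≤ nat 2 * c * u
    linear = ≤by _ (eq₁ c m t t₀) (0≤+ (0≤* 0≤nat (gap (≰⇒1+≤ ¬p)))
      (0≤+ (0≤* (0≤* 0≤nat 0≤c) (gap t₀≤)) (0≤* (1≤⇒0≤ 1≤m²) (gap 6c≤m))))
    eq₂ : ∀ m → m * m * m * (m * m * m) * (m * m * m * (m * m * m)) ≡ m * m * (m * m) * (m * m) * (m * m * (m * m) * (m * m))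
    eq₂ = solve-∀ ring
    eq₄ : ∀ c d → nat 2 * c * d * (nat 2 * c * d) * (nat 2 * c * d * (nat 2 * c * d)) ≡ nat 16 * (c * c * (c * c)) * (d * d * (d * d))
    eq₄ = solve-∀ ring
    quartic : m¹² ≤ nat 16 * c⁴ * u⁴
    quartic = subst₂ _≤_ (eq₂ m) (eq₄ c u) (sq-mono (0≤sq m³) (sq-mono 0≤m³ linear))
    eq₃ : ∀ c m q d → m * 0# - m * 1# ≡
      m * (q - (nat 512 * (c * c * (c * c)) + 1#)) + (q * (nat 16 * (c * c * (c * c)) * d - m)
      + nat 16 * (c * c * (c * c)) * (nat 32 * m - q * d))
    eq₃ = solve-∀ ring

  -- Energy decrement

  module Levels (a b : ℕ) {D₀ d̂ : R} (1≤D₀ : 1# ≤ D₀) (1≤d̂ : 1# ≤ d̂) where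

    -- The number of factors 4 that suffices for the combinations formed below: at most three for
    -- sums and differences, and at most a + b for the multiples by a and b.
    e : ℕ
    e = 3 ℕ.+ (a ℕ.+ b)

    -- The shifts in `ν` cost at most `e` factors 4; the remaining 4 pays for adding such a shift to
    -- an element of the finer smoothing.
    quality : ℕ → ℕ
    quality ℓ = 4 ℕ.^ e ℕ.* (4 ℕ.* ℓ)

    -- The reciprocal density of solutions that a stable smoothing would have. The factor 16384 and
    -- one `D₀` come from `configurations-many`, the other `D₀` from N ≤ D₀ m², and the cube from
    -- the |V|³ triples with N ≤ K |V|.
    c₁ : ℕ → R
    c₁ ℓ = nat 16384 * (D₀ * D₀) * (K * K * K)
      where
      K : R
      K = d̂ * period-loss D₀ (quality ℓ)

    E : R
    E = nat 1280 * (D₀ * D₀)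

    tolerance : ℕ → ℕ
    tolerance ℓ = ceil (nat 512 * (c₁ ℓ * c₁ ℓ * (c₁ ℓ * c₁ ℓ)) + 1#)

    -- The next finer level meets two demands: 4 times the coarser one, so that a shift of the
    -- window can be added, and enough accuracy to evaluate `T₀` at the forms. As their sum is
    -- taken, `near-mono` recovers either.
    level : ℕ → ℕ
    level zero = 1
    level (suc j) = 4 ℕ.* level j ℕ.+ 4 ℕ.^ e ℕ.* tolerance (level j)

    threshold : ℕ → R
    threshold zero = 0#
    threshold (suc j) = threshold j + nat 6 * c₁ (level j)

    steps : ℕ
    steps = ceil (nat 2 * E + 1#)

    1≤loss : ∀ q → 1# ≤ period-loss D₀ q
    1≤loss q = 1≤* 1≤2 (1≤* (1≤^ 1≤2 (16 ℕ.* q)) (1≤^ 1≤D₀ (16 ℕ.* q)))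
      where
      1≤2 : 1# ≤ nat 2
      1≤2 = nat-mono (ℕ.s≤s ℕ.z≤n)

    1≤c₁ : ∀ ℓ → 1# ≤ c₁ ℓ
    1≤c₁ ℓ = 1≤* (1≤* (nat-mono (ℕ.s≤s ℕ.z≤n)) (1≤* 1≤D₀ 1≤D₀)) (1≤* (1≤* 1≤K 1≤K) 1≤K)
      where
      1≤K : 1# ≤ d̂ * period-loss D₀ (quality ℓ)
      1≤K = 1≤* 1≤d̂ (1≤loss (quality ℓ))

    1≤E : 1# ≤ E
    1≤E = 1≤* (nat-mono (ℕ.s≤s ℕ.z≤n)) (1≤* 1≤D₀ 1≤D₀)

    0≤threshold : ∀ j → 0# ≤ threshold j
    0≤threshold zero = ≤-refl
    0≤threshold (suc j) = 0≤+ (0≤threshold j) (0≤* 0≤nat (1≤⇒0≤ (1≤c₁ (level j))))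

  module Increment (N : ℕ) .{{_ : ℕ.NonZero N}} (a b n : ℕ) (A : List ℤ) (0<a : 0 ℕ.< a) (0<n : 0 ℕ.< n) (an≤N : a ℕ.* n ℕ.≤ N)
    (sidon : Cyclic.Sidon N (mul a A)) (sidonC : Cyclic.Sidon N (mul (a ℕ.+ b) A)) (distinctB : Cyclic.Distinct N (mul b A))
    (1≤m : 1# ≤ len A) {D₀ d̂ : R} (1≤D₀ : 1# ≤ D₀) (1≤d̂ : 1# ≤ d̂) (N≤D₀m² : nat N ≤ D₀ * (len A * len A))
        (N≤d̂n : nat N ≤ d̂ * nat n)
    (few : Counting.T₀ N a b A (+ 0) ≤ nat 3 * (len A * len A)) where

    open Cyclic N
    open Periods N
    open Continuity N
    open Density N
    open Counting N a b A
    open Levels a b 1≤D₀ 1≤d̂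

    m : R
    m = len A

    len-mul : ∀ c → len (mul c A) ≡ m
    len-mul c = ∑-map (λ x → + c ℤ.* x) A (λ _ → 1#)

    1≤lenX : 1# ≤ len (mul a A)
    1≤lenX = subst (1# ≤_) (sym (len-mul a)) 1≤m

    N≤ : nat N ≤ D₀ * (len (mul a A) * len (mul a A))
    N≤ = subst (λ l → nat N ≤ D₀ * (l * l)) (sym (len-mul a)) N≤D₀m²

    Nr : ℕ → ℤ → Set
    Nr = Near sidon 1≤lenX

    lower : ∀ {i j q s} → i ℕ.≤ j → Nr (4 ℕ.^ j ℕ.* q) s → Nr (4 ℕ.^ i ℕ.* q) s
    lower {i} {j} {q} {s} i≤j = near-mono sidon 1≤lenX {s = s} (ℕ.*-monoˡ-≤ q (ℕ.^-monoʳ-≤ 4 i≤j))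

    plus : ∀ j {q s t} → Nr (4 ℕ.^ suc j ℕ.* q) s → Nr (4 ℕ.^ suc j ℕ.* q) t → Nr (4 ℕ.^ j ℕ.* q) (s ℤ.+ t)
    plus j {q} {s} {t} h₁ h₂ = near-+ sidon 1≤lenX (4 ℕ.^ j ℕ.* q) {s} {t}
      (subst (λ k → Nr k s) (ℕ.*-assoc 4 (4 ℕ.^ j) q) h₁) (subst (λ k → Nr k t) (ℕ.*-assoc 4 (4 ℕ.^ j) q) h₂)

    minus : ∀ j {q s t} → Nr (4 ℕ.^ suc j ℕ.* q) s → Nr (4 ℕ.^ suc j ℕ.* q) t → Nr (4 ℕ.^ j ℕ.* q) (s ℤ.+ ℤ.- t)
    minus j {q} {s} {t} h₁ h₂ = plus j {q} {s} {ℤ.- t} h₁ (near-neg sidon 1≤lenX (4 ℕ.^ suc j ℕ.* q) {t} h₂)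

    times : ∀ c i {q s} → Nr (4 ℕ.^ (c ℕ.+ i) ℕ.* q) s → Nr (4 ℕ.^ i ℕ.* q) (+ c ℤ.* s)
    times c i {q} {s} h = near-multiple sidon 1≤lenX c (4 ℕ.^ i ℕ.* q) {s}
      (subst (λ k → Nr k s) (trans (cong (ℕ._* q) (ℕ.^-distribˡ-+-* 4 c i)) (ℕ.*-assoc (4 ℕ.^ c) (4 ℕ.^ i) q)) h)

    level-0 : ∀ {q s} → Nr (4 ℕ.^ 0 ℕ.* q) s → Nr q s
    level-0 {q} {s} = subst (λ k → Nr k s) (ℕ.*-identityˡ q)

    module _ {q : ℕ} {L : List ℤ} (near : ∀ {v} → v ∈ L → Nr (4 ℕ.^ e ℕ.* q) v) where

      -- The form is grouped as a (p₁ + p₂ - p₄ - p₅) + b (p₃ - p₅). The first part costs a + 3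
      -- factors 4 and the second b + 2, counting the final addition in both; neither exceeds `e`.
      near-form : ∀ {p} → p ∈ quintuples L → Nr q (ℤ.- form a b p)
      near-form {p₅ , p₃ , p₄ , p₁ , p₂} p∈ =
        let h₁ , h₂ , h₃ , h₄ , h₅ = ∈-quintuples L p∈
            s = p₁ ℤ.+ p₂ ℤ.+ ℤ.- (p₄ ℤ.+ p₅)
            t = p₃ ℤ.+ ℤ.- p₅
            near-s = minus (1 ℕ.+ (a ℕ.+ b)) {q} {p₁ ℤ.+ p₂} {p₄ ℤ.+ p₅}
              (plus (2 ℕ.+ (a ℕ.+ b)) {q} {p₁} {p₂} (near h₁) (near h₂)) (plus (2 ℕ.+ (a ℕ.+ b)) {q} {p₄} {p₅} (near h₄) (near h₅))
            near-t = minus (2 ℕ.+ (a ℕ.+ b)) {q} {p₃} {p₅} (near h₃) (near h₅)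
            near-as = times a 1 {q} {s} (lower {q = q} {s = s} a+1≤ near-s)
            near-bt = times b 1 {q} {t} (lower {q = q} {s = t} b+1≤ near-t)
        in subst (Nr q) (cong ℤ.-_ (eq (+ a) (+ b) p₁ p₂ p₃ p₄ p₅))
             (near-neg sidon 1≤lenX q {+ a ℤ.* s ℤ.+ + b ℤ.* t}
               (level-0 {q} {+ a ℤ.* s ℤ.+ + b ℤ.* t} (plus 0 {q} {+ a ℤ.* s} {+ b ℤ.* t} near-as near-bt)))
        where
        a+1≤ : a ℕ.+ 1 ℕ.≤ 1 ℕ.+ (a ℕ.+ b)
        a+1≤ = subst (ℕ._≤ 1 ℕ.+ (a ℕ.+ b)) (ℕ.+-comm 1 a) (ℕ.s≤s (ℕ.m≤m+n a b))
        b+1≤ : b ℕ.+ 1 ℕ.≤ 2 ℕ.+ (a ℕ.+ b)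
        b+1≤ = subst (ℕ._≤ 2 ℕ.+ (a ℕ.+ b)) (ℕ.+-comm 1 b) (ℕ.m≤n⇒m≤1+n (ℕ.s≤s (ℕ.m≤n+m b a)))
        eq : ∀ a b p₁ p₂ p₃ p₄ p₅ → a ℤ.* (p₁ ℤ.+ p₂ ℤ.+ ℤ.- (p₄ ℤ.+ p₅)) ℤ.+ b ℤ.* (p₃ ℤ.+ ℤ.- p₅) ≡
          a ℤ.* p₁ ℤ.+ a ℤ.* p₂ ℤ.+ b ℤ.* p₃ ℤ.- (a ℤ.* p₄ ℤ.+ (a ℤ.+ b) ℤ.* p₅)
        eq = solve-ℤ

      near-window : ∀ distinct distinct-a P {v} → v ∈ Window.ν L distinct distinct-a P → Nr q v
      near-window distinct distinct-a P =
        ∀∈-++ {Nr q} (map q₁ T) (∀∈-map {Q = Nr q} q₁ near₁) (∀∈-++ {Nr q} (map q₂ T) (∀∈-map {Q = Nr q} q₂ near₂)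
        (∀∈-++ {Nr q} (map q₃ T) (∀∈-map {Q = Nr q} q₃ near₃) (∀∈-++ {Nr q} (map q₄ T) (∀∈-map {Q = Nr q} q₄ near₄)
        (∀∈-map {Q = Nr q} q₅ {T} (λ _ → near-0 sidon 1≤lenX q)))))
        where
        open Window L distinct distinct-a P using (T)
        members : ∀ {m z x} → (m , z , x) ∈ T → m ∈ L × z ∈ L × x ∈ L
        members τ∈ = let m∈ , zx∈ = ∈-cartesianProduct⁻ L _ τ∈ in m∈ , ∈-cartesianProduct⁻ L L zx∈
        full : ∀ {v} → v ∈ L → Nr q v
        full {v} v∈ = level-0 {q} {v} (lower {j = e} {q = q} {s = v} ℕ.z≤n (near v∈))
        near₁ : ∀ {τ} → τ ∈ T → Nr q (q₁ τ)
        near₁ τ∈ = full (proj₂ (proj₂ (members τ∈)))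
        near₄ : ∀ {τ} → τ ∈ T → Nr q (q₄ τ)
        near₄ τ∈ = full (proj₁ (proj₂ (members τ∈)))
        near₃ : ∀ {τ} → τ ∈ T → Nr q (q₃ τ)
        near₃ {m , _ , _} τ∈ = near-neg sidon 1≤lenX q {+ a ℤ.* m} (level-0 {q} {+ a ℤ.* m}
          (times a 0 {q} {m} (lower {q = q} {s = m} a+0≤ (near (proj₁ (members τ∈))))))
          where
          a+0≤ : a ℕ.+ 0 ℕ.≤ e
          a+0≤ = subst (ℕ._≤ e) (sym (ℕ.+-identityʳ a)) (ℕ.≤-trans (ℕ.m≤m+n a b) (ℕ.m≤n+m (a ℕ.+ b) 3))
        near₂ : ∀ {τ} → τ ∈ T → Nr q (q₂ τ)
        near₂ {m , z , x} τ∈ = level-0 {q} {z ℤ.+ ℤ.- x ℤ.+ + b ℤ.* m} (plus 0 {q} {z ℤ.+ ℤ.- x} {+ b ℤ.* m}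
          (lower {1} {2 ℕ.+ (a ℕ.+ b)} {q} {z ℤ.+ ℤ.- x} (ℕ.s≤s ℕ.z≤n) (minus (2 ℕ.+ (a ℕ.+ b)) {q} {z} {x}
            (near (proj₁ (proj₂ (members τ∈)))) (near (proj₂ (proj₂ (members τ∈))))))
          (times b 1 {q} {m} (lower {q = q} {s = m} b+1≤ (near (proj₁ (members τ∈))))))
          where
          b+1≤ : b ℕ.+ 1 ℕ.≤ e
          b+1≤ = subst (ℕ._≤ e) (ℕ.+-comm 1 b) (ℕ.s≤s (ℕ.≤-trans (ℕ.m≤n+m b a) (ℕ.m≤n+m (a ℕ.+ b) 2)))

    distinct-close : ∀ {L} → AllPairs (Close n) L → Distinct L
    distinct-close {L} pairs c = subst (_≤ 1#)
      (trans (∑-map (λ x → + 1 ℤ.* x) L _) (∑-cong L (λ x → cong (λ y → δ (y ℤ.- c)) (ℤ.*-identityˡ x))))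
      (distinct-multiples 1 (ℕ.s≤s ℕ.z≤n) (ℕ.≤-trans (ℕ.*-monoˡ-≤ n 0<a) an≤N) pairs c)

    few-solutions : ∀ ℓ → nat 6 * c₁ ℓ ≤ m → ∀ {s} → Nr (tolerance ℓ) s → 1# + c₁ ℓ * T₀ s ≤ m * m * m
    few-solutions ℓ 6c≤m {s} near = cube-bound (c₁ ℓ) m (nat (tolerance ℓ)) (T₀ s) (T₀ (+ 0)) (1≤c₁ ℓ) 1≤m few 6c≤m
      (≤ceil (nat 512 * (c₁ ℓ * c₁ ℓ * (c₁ ℓ * c₁ ℓ)) + 1#))
      (subst (λ l → nat (tolerance ℓ) * (d * d * (d * d)) ≤ nat 32 * (l * l * (l * l) * (l * l) * (l * l * (l * l) * (l * l))))
          (len-mul a)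
        (solutions-continuous sidon 1≤lenX sidonC distinctB
          (trans (len-mul b) (sym (len-mul a))) (trans (len-mul (a ℕ.+ b)) (sym (len-mul a))) {tolerance ℓ} {s} near))
      where
      d : R
      d = T₀ s - T₀ (+ 0)
    -- The energy normalised by |P|² is at most v / E. The unit 1 / E is chosen so that failure of
    -- stability lowers `v` by exactly 1.
    record Smoothing (ℓ : ℕ) (v : R) : Set where
      field
        P : List ℤ
        1≤P : 1# ≤ len P
        near : ∀ {p} → p ∈ P → Nr ℓ p
        energy : E * ‖ smoothed P ‖² ≤ v * (len P * len P)

    module Step (ℓ : ℕ) (6c≤m : nat 6 * c₁ ℓ ≤ m) {v : R} (v≤ : v ≤ nat 2 * E)
      (smoothing : Smoothing (4 ℕ.* ℓ ℕ.+ 4 ℕ.^ e ℕ.* tolerance ℓ) v)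
      (V : List ℤ) (close : AllPairs (Close n) V) (large : nat n ≤ period-loss D₀ (quality ℓ) * len V)
      (nearV : ∀ {v} → v ∈ V → Nr (quality ℓ) v) where

      open Smoothing smoothing

      distinct-V : Distinct V
      distinct-V = distinct-close close

      distinct-aV : Distinct (mul a V)
      distinct-aV = distinct-multiples a 0<a an≤N close

      open Window V distinct-V distinct-aV P

      f : ℤ → R
      f = smoothed P

      W Y κ : R
      W = len P
      Y = len ν
      κ = d̂ * period-loss D₀ (quality ℓ)

      1≤V : 1# ≤ len V
      1≤V with 1# ≤? len V
      ... | yes p = p
      ... | no ¬p = ⊥-elim (1≰0 (≤-trans (nat-mono 0<n) (≤-trans large (≤-trans
            (*-monoˡ (1≤⇒0≤ (1≤loss (quality ℓ))) (≤by _ (eq (len V)) (gap (≰⇒1+≤ ¬p)))) (≤-reflexive (zeroʳ _))))))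
        where
        eq : ∀ a → 0# - a ≡ 1# - (1# + a)
        eq = solve-∀ ring

      len-T : len T ≡ len V * (len V * len V)
      len-T = trans (len-cartesian V _) (cong (len V *_) (len-cartesian V V))

      1≤T : 1# ≤ len T
      1≤T = subst (1# ≤_) (sym len-T) (1≤* 1≤V (1≤* 1≤V 1≤V))

      1≤Y′ : 1# ≤ Y
      1≤Y′ = subst (1# ≤_) (sym (trans (∑-ν (λ _ → 1#)) (trans (∑-const T (nat 5)) (*-comm (len T) (nat 5)))))
        (1≤* (nat-mono (ℕ.s≤s ℕ.z≤n)) 1≤T)

      -- Each form of elements of `P` is an almost period, so `few-solutions` bounds every summand
      -- of `count≤`. The extra 1 per quintuple makes the later contradiction strict.
      count-small : len (quintuples P) + c₁ ℓ * count ≤ len (quintuples P) * (m * m * m)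
      count-small = begin
        len P⁵ + c₁ ℓ * count                                     ≤⟨ +-mono ≤-refl (*-monoˡ (1≤⇒0≤ (1≤c₁ ℓ)) count≤) ⟩
        len P⁵ + c₁ ℓ * ∑ P⁵ (λ p → T₀ (ℤ.- form a b p))          ≡⟨ sym (trans (∑-+ P⁵ _ _) (cong₂ _+_ refl (∑-* P⁵ (c₁ ℓ) _))) ⟩
        ∑ P⁵ (λ p → 1# + c₁ ℓ * T₀ (ℤ.- form a b p))              ≤⟨ ∑-≤const∈ P⁵ (λ p p∈ → few-solutions ℓ 6c≤m {ℤ.- form a b p}
                                                                       (near-form {tolerance ℓ} {P} near-P {p} p∈)) ⟩
        len P⁵ * (m * m * m)                                      ∎
        where
        open ≤-Reasoning
        P⁵ : List Quintuple
        P⁵ = quintuples P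
        near-P : ∀ {p} → p ∈ P → Nr (4 ℕ.^ e ℕ.* tolerance ℓ) p
        near-P {p} p∈ = near-mono sidon 1≤lenX {s = p} (ℕ.m≤n+m _ (4 ℕ.* ℓ)) (near p∈)

      ‖f‖²≤ : ‖ f ‖² ≤ nat 2 * (W * W)
      ‖f‖²≤ = cancel 1≤E (≤-trans energy (≤-trans (*-monoʳ (0≤sq W) v≤) (≤-reflexive (eq E (W * W)))))
        where
        eq : ∀ e w → nat 2 * e * w ≡ e * (nat 2 * w)
        eq = solve-∀ ring

      -- If averaging over `ν` hardly lowered the energy, `configurations-many` would apply with
      -- mass m |P|. Three of its four factors N are absorbed by |V|³ through N ≤ κ |V|, and the
      -- fourth is at most D₀ m². The outcome m³ |P|⁵ ≤ c₁ · `count` contradicts `count-small`.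
      unstable : ¬ E * (Y * Y * ‖ f ‖² - ‖ average (smoothed-per P) ν ‖²) ≤ Y * Y * (W * W)
      unstable stable = conclude m W (len V) (nat N) count D₀ κ (len (quintuples P)) (c₁ ℓ) refl (len-quintuples P)
        (1≤⇒0≤ 1≤m) 1≤P 1≤N 1≤m 1≤D₀ (0≤len V)
        (≤-trans N≤d̂n (≤-trans (*-monoˡ (1≤⇒0≤ 1≤d̂) large) (≤-reflexive (eq d̂ _ (len V)))))
        N≤D₀m² 0≤κ 0≤count count-small
        (subst (λ t → m * W * (m * W) * (m * W) * (m * W * (m * W)) * t ≤ nat 16384 * D₀ * (nat N * nat N * nat N * nat N) * count)
            len-T
          (configurations-many (smoothed-per P) (0≤smoothed P) T q₁ q₂ q₃ q₄ q₅ ν ∑-ν 1≤D₀ (1≤* 1≤m 1≤P) 1≤T (∑-smoothed P)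
            NW²≤ ‖f‖²≤ stable))
        where
        eq : ∀ a b c → a * (b * c) ≡ a * b * c
        eq = solve-∀ ring
        0≤κ : 0# ≤ κ
        0≤κ = 0≤* (1≤⇒0≤ 1≤d̂) (1≤⇒0≤ (1≤loss (quality ℓ)))
        0≤f : ∀ z → 0# ≤ f z
        0≤f = 0≤smoothed P
        0≤count : 0# ≤ count
        0≤count = 0≤∑ Z (λ t → 0≤∑ T (λ τ →
            0≤Π₅ (0≤f (t ℤ.+ q₁ τ)) (0≤f (t ℤ.+ q₂ τ)) (0≤f (t ℤ.+ q₃ τ)) (0≤f (t ℤ.+ q₄ τ)) (0≤f (t ℤ.+ q₅ τ))))
        NW²≤ : nat N * (W * W) ≤ D₀ * (m * W * (m * W))
        NW²≤ = ≤-trans (*-monoʳ (0≤sq W) N≤D₀m²) (≤-reflexive (eq′ D₀ m W))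
          where
          eq′ : ∀ d m w → d * (m * m) * (w * w) ≡ d * (m * w * (m * w))
          eq′ = solve-∀ ring
        conclude : ∀ m W v N Θ D κ W⁵ c → c ≡ nat 16384 * (D * D) * (κ * κ * κ) → W⁵ ≡ Π₅ W W W W W →
          0# ≤ m → 1# ≤ W → 1# ≤ N → 1# ≤ m → 1# ≤ D → 0# ≤ v → N ≤ κ * v → N ≤ D * (m * m) → 0# ≤ κ → 0# ≤ Θ →
          W⁵ + c * Θ ≤ W⁵ * (m * m * m) →
          m * W * (m * W) * (m * W) * (m * W * (m * W)) * (v * (v * v)) ≤ nat 16384 * D * (N * N * N * N) * Θ → ⊥
        conclude m W v N Θ D κ _ _ refl refl 0≤m 1≤W 1≤N 1≤m 1≤D 0≤v N≤κv N≤D 0≤κ 0≤Θ small many =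
          1≰0 (≤-trans (1≤* 1≤W (1≤* 1≤W (1≤* 1≤W (1≤* 1≤W 1≤W))))
            (≤by _ (eq₃ (Π₅ W W W W W) (c * Θ) (m * m * m)) (0≤+ (gap small) (gap dense))))
          where
          c M⁵ : R
          c = nat 16384 * (D * D) * (κ * κ * κ)
          M⁵ = m * W * (m * W) * (m * W) * (m * W * (m * W))
          0≤N : 0# ≤ N
          0≤N = 1≤⇒0≤ 1≤N
          0≤M⁵ : 0# ≤ M⁵
          0≤M⁵ = 0≤* (0≤* (0≤sq (m * W)) (0≤* 0≤m (1≤⇒0≤ 1≤W))) (0≤sq (m * W))
          0≤κ³ : 0# ≤ κ * κ * κ
          0≤κ³ = 0≤* (0≤sq κ) 0≤κ
          eq₁ : ∀ M v κ → M * (κ * v * (κ * v) * (κ * v)) ≡ κ * κ * κ * (M * (v * (v * v)))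
          eq₁ = solve-∀ ring
          eq₂ : ∀ κ D N Θ → κ * κ * κ * (nat 16384 * D * (N * N * N * N) * Θ) ≡ N * N * N * (nat 16384 * D * (κ * κ * κ) * Θ * N)
          eq₂ = solve-∀ ring
          eq₃ : ∀ w c m → 0# - w ≡ w * m - (w + c) + (c - m * w)
          eq₃ = solve-∀ ring
          eq₄ : ∀ m W → m * m * (m * m * m * (W * (W * (W * (W * W))))) ≡ m * W * (m * W) * (m * W) * (m * W * (m * W))
          eq₄ = solve-∀ ring
          eq₅ : ∀ D κ Θ m → nat 16384 * D * (κ * κ * κ) * Θ * (D * (m * m)) ≡ m * m * (nat 16384 * (D * D) * (κ * κ * κ) * Θ)
          eq₅ = solve-∀ ring
          M⁵≤ : M⁵ ≤ nat 16384 * D * (κ * κ * κ) * Θ * N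
          M⁵≤ = cancel (1≤* (1≤* 1≤N 1≤N) 1≤N) (≤-trans (≤-reflexive (*-comm (N * N * N) M⁵))
            (≤-trans (*-monoˡ 0≤M⁵ (*-mono (0≤sq N) 0≤N (sq-mono 0≤N N≤κv) N≤κv))
            (≤-trans (≤-reflexive (eq₁ M⁵ v κ)) (≤-trans (*-monoˡ 0≤κ³ many) (≤-reflexive (eq₂ κ D N Θ))))))
          dense : m * m * m * Π₅ W W W W W ≤ c * Θ
          dense = cancel (1≤* 1≤m 1≤m) (≤-trans (≤-reflexive (eq₄ m W)) (≤-trans M⁵≤
            (≤-trans (*-monoˡ (0≤* (0≤* (0≤* 0≤nat (1≤⇒0≤ 1≤D)) 0≤κ³) 0≤Θ) N≤D) (≤-reflexive (eq₅ D κ Θ m)))))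

      -- Smoothing along ν + P is the average over `ν` of the smoothing along `P`, so its energy is
      -- the one that `unstable` forces down.
      next : Smoothing ℓ (v - 1#)
      next = record
        { P = ν ⊕ P
        ; 1≤P = subst (1# ≤_) (sym (len-⊕ ν P)) (1≤* 1≤Y′ 1≤P)
        ; near = near-sum
        ; energy = subst₂ (λ g l → E * g ≤ (v - 1#) * (l * l)) (sym (‖‖-cong (smoothed-⊕ ν P))) (sym (len-⊕ ν P)) energy′
        }
        where
        near-sum : ∀ {p} → p ∈ ν ⊕ P → Nr ℓ p
        near-sum p∈ =
          let x , y , x∈ , y∈ , eq = ∈-⊕ ν P p∈ in subst (Nr ℓ) (sym eq)
            (near-+ sidon 1≤lenX ℓ {x} {y} (near-window {4 ℕ.* ℓ} {V} nearV distinct-V distinct-aV P x∈)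
              (near-mono sidon 1≤lenX {s = y} (ℕ.m≤m+n (4 ℕ.* ℓ) _) (near y∈)))
        g : R
        g = ‖ average (smoothed-per P) ν ‖²
        energy′ : E * g ≤ (v - 1#) * (Y * W * (Y * W))
        energy′ with E * g ≤? (v - 1#) * (Y * W * (Y * W))
        ... | yes p = p
        ... | no ¬p = ⊥-elim (unstable (≤by _ (eq E Y W v g ‖ f ‖²) (0≤+ (0≤* (0≤sq Y) (gap energy)) (gap (≰⇒≥ ¬p)))))
          where
          eq : ∀ E Y W v g f → Y * Y * (W * W) - E * (Y * Y * f - g) ≡
            Y * Y * (v * (W * W) - E * f) + (E * g - (v - 1#) * (Y * W * (Y * W)))
          eq = solve-∀ ring

    0<level : ∀ j → 0 ℕ.< level j
    0<level zero = ℕ.s≤s ℕ.z≤n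
    0<level (suc j) = ℕ.≤-trans (0<level j) (ℕ.≤-trans (ℕ.m≤n*m (level j) 4) (ℕ.m≤m+n (4 ℕ.* level j) _))

    0<quality : ∀ j → 0 ℕ.< quality (level j)
    0<quality j = ℕ.≤-trans (0<level j) (ℕ.≤-trans (ℕ.m≤n*m (level j) 4)
      (ℕ.m≤n*m (4 ℕ.* level j) (4 ℕ.^ e) {{ℕ.m^n≢0 4 e}}))

    step : ∀ j {v} → v ≤ nat 2 * E → nat 6 * c₁ (level j) ≤ m → Smoothing (level (suc j)) v → Smoothing (level j) (v - 1#)
    step j v≤ 6c≤m smoothing =
      let V , close , large , nearV = almost-periods sidon 1≤lenX 1≤D₀ N≤ {n} 0<n {quality (level j)} (0<quality j)
      in Step.next (level j) 6c≤m v≤ smoothing V close large nearV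

    -- Each step trades one level of accuracy for one unit of energy. No lower bound on `v` is kept,
    -- so the value reached may be negative.
    descend : ∀ j {v} → v ≤ nat 2 * E → threshold j ≤ m → Smoothing (level j) v → Smoothing 1 (v - nat j)
    descend zero {v} _ _ smoothing = subst (Smoothing 1) (eq v) smoothing
      where
      eq : ∀ v → v ≡ v - 0#
      eq = solve-∀ ring
    descend (suc j) {v} v≤ thr smoothing = subst (Smoothing 1) (eq v (nat j))
      (descend j (≤-trans (≤by 1# (eq₁ v) 0≤1) v≤)
        (≤-trans (≤by _ (eq₂ (threshold j) _) (0≤* 0≤nat (1≤⇒0≤ (1≤c₁ (level j))))) thr)
        (step j v≤ (≤-trans (≤by _ (eq₃ (threshold j) _) (0≤threshold j)) thr) smoothing))
      where
      eq : ∀ v j → v - 1# - j ≡ v - (1# + j)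
      eq = solve-∀ ring
      eq₁ : ∀ v → v - (v - 1#) ≡ 1#
      eq₁ = solve-∀ ring
      eq₂ : ∀ a b → a + b - a ≡ b
      eq₂ = solve-∀ ring
      eq₃ : ∀ a b → a + b - b ≡ a
      eq₃ = solve-∀ ring

    -- Smoothing along `V` has energy at most |V|² + m |V|, since `A` is a Sidon set, and this is at
    -- most 2|V|² once |V| ≥ m. The latter holds for large m because |V| is a fixed proportion of
    -- `N`, while N ≥ m² / 2.
    initial : Sidon A → ∀ j → nat 2 * d̂ * period-loss D₀ (level j) ≤ m → Smoothing (level j) (nat 2 * E)
    initial sidonA j loss≤m =
      let V , close , large , nearV = almost-periods sidon 1≤lenX 1≤D₀ N≤ {n} 0<n {level j} (0<level j)
      in from V close large nearV
      where
      K : R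
      K = period-loss D₀ (level j)
      m²≤2N : m * m ≤ nat N * nat 2
      m²≤2N = subst₂ _≤_ (trans (∑-r (A ⊕ A)) (len-⊕ A A)) (trans (∑-const Z (nat 2)) (cong (_* nat 2) (len-range N)))
        (∑-mono Z (sums≤2 sidonA))
      from : ∀ V → AllPairs (Close n) V → nat n ≤ K * len V → (∀ {v} → v ∈ V → Nr (level j) v) → Smoothing (level j) (nat 2 * E)
      from V close large nearV = record { P = V ; 1≤P = ≤-trans 1≤m m≤V ; near = nearV ; energy = energy }
        where
        conclude : ∀ m n N d K v → 1# ≤ d → 1# ≤ K → m * m ≤ N * nat 2 → N ≤ d * n → n ≤ K * v → nat 2 * d * K ≤ m → 0# ≤ m → m ≤ v
        conclude m n N d K v 1≤d 1≤K m² N≤ n≤ K≤ 0≤m =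
          cancel (1≤* (1≤* (nat-mono {1} {2} (ℕ.s≤s ℕ.z≤n)) 1≤d) 1≤K)
            (≤by _ (eq m n N d K v) (0≤+ (0≤* 0≤m (gap K≤)) (0≤+ (gap m²)
                (0≤+ (0≤* 0≤nat (gap N≤)) (0≤* (0≤* 0≤nat (1≤⇒0≤ 1≤d)) (gap n≤))))))
          where
          eq : ∀ m n N d K v → nat 2 * d * K * v - nat 2 * d * K * m ≡
            m * (m - nat 2 * d * K) + (N * nat 2 - m * m + (nat 2 * (d * n - N) + nat 2 * d * (K * v - n)))
          eq = solve-∀ ring
        m≤V : m ≤ len V
        m≤V = conclude m (nat n) (nat N) d̂ K (len V) 1≤d̂ (1≤loss (level j)) m²≤2N N≤d̂n large loss≤m (1≤⇒0≤ 1≤m)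
        as-sum : ∀ z → smoothed V z ≡ r (A ⊕ neg V) z
        as-sum z = trans (∑-swap V A (λ v x → δ (z ℤ.+ v ℤ.- x))) (sym (trans (∑-⊕ A (neg V) (λ l → δ (z ℤ.- l)))
          (∑-cong A (λ x → trans (∑-map (λ v → ℤ.- v) V (λ v → δ (z ℤ.- (x ℤ.+ v)))) (∑-cong V (λ v → cong δ (eq z x v)))))))
          where
          eq : ∀ z x v → z ℤ.- (x ℤ.+ ℤ.- v) ≡ z ℤ.+ v ℤ.- x
          eq = solve-ℤ
        len-neg : len (neg V) ≡ len V
        len-neg = ∑-map (λ v → ℤ.- v) V (λ _ → 1#)
        energy : E * ‖ smoothed V ‖² ≤ nat 2 * E * (len V * len V)
        energy = ≤-trans (*-monoˡ (1≤⇒0≤ 1≤E) (begin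
          ‖ smoothed V ‖²                                   ≡⟨ ‖‖-cong as-sum ⟩
          ‖ r (A ⊕ neg V) ‖²                                ≤⟨ mixed-energy-distinct sidonA (neg V)
              (distinct-neg V (distinct-close close)) ⟩
          len (neg V) * len (neg V) + m * len (neg V)       ≡⟨ cong (λ l → l * l + m * l) len-neg ⟩
          len V * len V + m * len V                         ≤⟨ +-mono ≤-refl (*-monoʳ (0≤len V) m≤V) ⟩
          len V * len V + len V * len V                     ∎)) (≤-reflexive (eq E (len V * len V)))
          where
          open ≤-Reasoning
          eq : ∀ e v → e * (v + v) ≡ nat 2 * e * v
          eq = solve-∀ ring

    -- The energy starts at 2E units and cannot be negative, yet `steps` is at least 2E + 1.
    impossible : Sidon A → threshold steps ≤ m → ¬ nat 2 * d̂ * period-loss D₀ (level steps) ≤ m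
    impossible sidonA threshold≤m loss≤m = conclude E ‖ smoothed P ‖² (len P) (nat steps) (1≤⇒0≤ 1≤E) (0≤‖‖ (smoothed P)) 1≤P
        (≤ceil (nat 2 * E + 1#)) energy
      where
      open Smoothing (descend steps ≤-refl threshold≤m (initial sidonA steps loss≤m))
      conclude : ∀ e f w s → 0# ≤ e → 0# ≤ f → 1# ≤ w → nat 2 * e + 1# ≤ s → e * f ≤ (nat 2 * e - s) * (w * w) → ⊥
      conclude e f w s 0≤e 0≤f 1≤w s≥ h = 1≰0 (≤-trans (1≤* 1≤w 1≤w)
        (≤by _ (eq e f w s) (0≤+ (gap h) (0≤+ (0≤* 0≤e 0≤f) (0≤* (0≤sq w) (gap s≥))))))
        where
        eq : ∀ e f w s → 0# - w * w ≡ (nat 2 * e - s) * (w * w) - e * f + (e * f + w * w * (s - (nat 2 * e + 1#)))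
        eq = solve-∀ ring

  -- Solution-free subsets of [n]

  elements : ∀ {n} → Subset n → List ℤ
  elements [] = []
  elements (true ∷ p) = + 1 ∷ map (λ x → + 1 ℤ.+ x) (elements p)
  elements (false ∷ p) = map (λ x → + 1 ℤ.+ x) (elements p)

  ∈-elements : ∀ {n} (p : Subset n) {x} → x ∈ elements p → ∃[ i ] (i ∈ₛ p × x ≡ + elem i)
  ∈-elements-tail : ∀ {n} s (p : Subset n) {x} → x ∈ map (λ x → + 1 ℤ.+ x) (elements p) →
    ∃[ i ] (i ∈ₛ (s ∷ p) × x ≡ + elem i)

  ∈-elements (true ∷ p) (here refl) = zero , here , refl
  ∈-elements (true ∷ p) (there x∈) = ∈-elements-tail true p x∈
  ∈-elements (false ∷ p) x∈ = ∈-elements-tail false p x∈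

  ∈-elements-tail s p x∈ with ∈-map⁻ (λ x → + 1 ℤ.+ x) x∈
  ... | y , y∈ , refl with ∈-elements p y∈
  ... | i , i∈ , refl = suc i , there i∈ , refl

  len-elements : ∀ {n} (p : Subset n) → len (elements p) ≡ nat (size p)
  len-elements [] = refl
  len-elements (true ∷ p) = cong₂ _+_ (refl {x = 1#})
    (trans (∑-map (λ x → + 1 ℤ.+ x) (elements p) (λ _ → 1#)) (len-elements p))
  len-elements (false ∷ p) = trans (∑-map (λ x → + 1 ℤ.+ x) (elements p) (λ _ → 1#)) (len-elements p)

  elements-close : ∀ {n} (p : Subset n) → AllPairs (Close n) (elements p)
  elements-close [] = []
  elements-close {suc n} (s ∷ p) = cons s
    where
    eq : ∀ x y → x ℤ.- y ≡ (+ 1 ℤ.+ x) ℤ.- (+ 1 ℤ.+ y)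
    eq = solve-ℤ
    eq′ : ∀ y → ℤ.- y ≡ + 1 ℤ.- (+ 1 ℤ.+ y)
    eq′ = solve-ℤ
    tail : AllPairs (Close (suc n)) (map (λ x → + 1 ℤ.+ x) (elements p))
    tail = AllPairs.map⁺ (AllPairs.map (λ {x} {y} (0<d , d<n) →
      subst (λ d → 0 ℕ.< ℤ.∣ d ∣ × ℤ.∣ d ∣ ℕ.< suc n) (eq x y) (0<d , ℕ.m≤n⇒m≤1+n d<n)) (elements-close p))
    apart : ∀ {x} → x ∈ map (λ x → + 1 ℤ.+ x) (elements p) → Close (suc n) (+ 1) x
    apart x∈ with ∈-map⁻ (λ x → + 1 ℤ.+ x) x∈
    ... | y , y∈ , refl with ∈-elements p y∈
    ... | i , _ , refl = subst (λ d → 0 ℕ.< ℤ.∣ d ∣ × ℤ.∣ d ∣ ℕ.< suc n) (eq′ (+ elem i))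
      (ℕ.s≤s ℕ.z≤n , ℕ.s≤s (Fin.toℕ<n i))
    cons : ∀ s → AllPairs (Close (suc n)) (elements (s ∷ p))
    cons true = All.tabulate apart ∷ tail
    cons false = tail

  module Reduction (a b n : ℕ) (1≤a : 1 ℕ.≤ a) (1≤b : 1 ℕ.≤ b) (0<n : 0 ℕ.< n) (p : Subset n) (free : SolutionFree a b p) where

    -- The sums c (x + y) with c ≤ a + b, and both sides of the equation, stay below this modulus,
    -- so congruences between them are equalities.
    N : ℕ
    N = 3 ℕ.* (a ℕ.+ b) ℕ.* n

    0<N : 0 ℕ.< N
    0<N = ℕ.*-mono-≤ {1} {3 ℕ.* (a ℕ.+ b)} (ℕ.≤-trans 1≤a (ℕ.≤-trans (ℕ.m≤m+n a b) (ℕ.m≤n*m (a ℕ.+ b) 3))) 0<n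

    instance
      N-nonZero : ℕ.NonZero N
      N-nonZero = ℕ.>-nonZero 0<N

    open Cyclic N
    open Periods N
    open Counting N a b (elements p)

    A : List ℤ
    A = elements p

    m : R
    m = len A

    value≤n : ∀ (i : Fin n) → elem i ℕ.≤ n
    value≤n = Fin.toℕ<n

    congruent⇒≡ : ∀ {u v} → u ℕ.< N → v ℕ.< N → + N ∣ + u ℤ.- + v → u ≡ v
    congruent⇒≡ {u} {v} u< v< N∣ = ℤ.+-injective (ℤ.i-j≡0⇒i≡j (+ u) (+ v) (ℤ.∣i∣≡0⇒i≡0 (zero-or ℤ.∣ + u ℤ.- + v ∣ (∣⇒∣ᵤ N∣) small)))
      where
      small : ℤ.∣ + u ℤ.- + v ∣ ℕ.< N
      small = ℕ.≤-<-trans (subst (λ i → ℤ.∣ i ∣ ℕ.≤ u ℕ.⊔ v) (sym (ℤ.m-n≡m⊖n u v)) (ℤ.∣m⊝n∣≤m⊔n u v)) (ℕ.⊔-lub u< v<)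
      zero-or : ∀ d → N ℕ.∣ d → d ℕ.< N → d ≡ 0
      zero-or zero _ _ = refl
      zero-or (suc d) N∣d d<N = ⊥-elim (ℕ.<⇒≱ d<N (ℕ.∣⇒≤ N∣d))

    c*n≤N : ∀ {c} → c ℕ.≤ a ℕ.+ b → c ℕ.* n ℕ.≤ N
    c*n≤N c≤ = ℕ.*-monoˡ-≤ n (ℕ.≤-trans c≤ (ℕ.m≤n*m (a ℕ.+ b) 3))

    distinct-mul : ∀ c → 0 ℕ.< c → c ℕ.≤ a ℕ.+ b → Distinct (mul c A)
    distinct-mul c 0<c c≤ = distinct-multiples c 0<c (c*n≤N c≤) (elements-close p)

    sums-trivial : ∀ {i₁ i₂ i₃ i₄} → i₁ ∈ₛ p → i₂ ∈ₛ p → i₃ ∈ₛ p → i₄ ∈ₛ p →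
      elem i₁ ℕ.+ elem i₂ ≡ elem i₃ ℕ.+ elem i₄ → elem i₁ ≡ elem i₃ ⊎ elem i₂ ≡ elem i₃
    sums-trivial {i₁} {i₂} {i₃} {i₄} p₁ p₂ p₃ p₄ eq
      with free i₁ i₂ i₄ i₃ i₄ p₁ p₂ p₄ p₃ p₄ (solution (elem i₁) (elem i₂) (elem i₃) (elem i₄) eq)
      where
      solution : ∀ x₁ x₂ x₃ x₄ → x₁ ℕ.+ x₂ ≡ x₃ ℕ.+ x₄ → Solution a b x₁ x₂ x₄ x₃ x₄
      solution x₁ x₂ x₃ x₄ eq = trans (eq₁ a b x₁ x₂ x₄) (trans (cong (λ s → a ℕ.* s ℕ.+ b ℕ.* x₄) eq) (eq₂ a b x₃ x₄))
        where
        eq₁ : ∀ a b x₁ x₂ x₄ → a ℕ.* x₁ ℕ.+ a ℕ.* x₂ ℕ.+ b ℕ.* x₄ ≡ a ℕ.* (x₁ ℕ.+ x₂) ℕ.+ b ℕ.* x₄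
        eq₁ = solve-ℕ
        eq₂ : ∀ a b x₃ x₄ → a ℕ.* (x₃ ℕ.+ x₄) ℕ.+ b ℕ.* x₄ ≡ a ℕ.* x₃ ℕ.+ (a ℕ.+ b) ℕ.* x₄
        eq₂ = solve-ℕ
    ... | inj₁ (x₁≡x₃ , _) = inj₁ x₁≡x₃
    ... | inj₂ (inj₁ (x₂≡x₃ , _)) = inj₂ x₂≡x₃
    -- The third and fifth variables both carry the fourth summand here, so a trivial solution of
    -- the third kind has all its values equal.
    ... | inj₂ (inj₂ (_ , x₁≡x₂ , x₂≡x₄ , x₄≡x₃)) = inj₁ (trans x₁≡x₂ (trans x₂≡x₄ x₄≡x₃))

    sidon-mul : ∀ c → 0 ℕ.< c → c ℕ.≤ a ℕ.+ b → Sidon (mul c A)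
    sidon-mul c 0<c c≤ = record { sums = sums ; distinct = distinct-mul c 0<c c≤ }
      where
      bound : ∀ (i j : Fin n) → c ℕ.* (elem i ℕ.+ elem j) ℕ.< N
      bound i j = ℕ.≤-<-trans (ℕ.*-mono-≤ c≤ (ℕ.+-mono-≤ (value≤n i) (value≤n j)))
        (subst ((a ℕ.+ b) ℕ.* (n ℕ.+ n) ℕ.<_) (eq (a ℕ.+ b) n)
          (ℕ.m<m+n ((a ℕ.+ b) ℕ.* (n ℕ.+ n)) (ℕ.*-mono-≤ {1} {a ℕ.+ b} (ℕ.≤-trans 1≤a (ℕ.m≤m+n a b)) 0<n)))
        where
        eq : ∀ s n → s ℕ.* (n ℕ.+ n) ℕ.+ s ℕ.* n ≡ 3 ℕ.* s ℕ.* n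
        eq = solve-ℕ
      as-difference : ∀ x₁ x₂ x₃ x₄ → (+ c ℤ.* + x₁ ℤ.+ + c ℤ.* + x₂) ℤ.- (+ c ℤ.* + x₃ ℤ.+ + c ℤ.* + x₄) ≡
        + (c ℕ.* (x₁ ℕ.+ x₂)) ℤ.- + (c ℕ.* (x₃ ℕ.+ x₄))
      as-difference x₁ x₂ x₃ x₄ = cong₂ ℤ._-_
        (trans (sym (ℤ.*-distribˡ-+ (+ c) (+ x₁) (+ x₂))) (sym (ℤ.pos-* c (x₁ ℕ.+ x₂))))
        (trans (sym (ℤ.*-distribˡ-+ (+ c) (+ x₃) (+ x₄))) (sym (ℤ.pos-* c (x₃ ℕ.+ x₄))))
      ≡⇒∣ : ∀ {x y} → x ≡ y → + N ∣ (+ c ℤ.* + x) ℤ.- (+ c ℤ.* + y)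
      ≡⇒∣ {x} refl = subst (+ N ∣_) (sym (ℤ.+-inverseʳ (+ c ℤ.* + x))) (divides (+ 0) refl)
      sums : ∀ {x₁ x₂ x₃ x₄} → x₁ ∈ mul c A → x₂ ∈ mul c A → x₃ ∈ mul c A → x₄ ∈ mul c A →
        + N ∣ (x₁ ℤ.+ x₂) ℤ.- (x₃ ℤ.+ x₄) → + N ∣ x₁ ℤ.- x₃ ⊎ + N ∣ x₂ ℤ.- x₃
      sums h₁ h₂ h₃ h₄ N∣
        with ∈-map⁻ (λ x → + c ℤ.* x) h₁ | ∈-map⁻ (λ x → + c ℤ.* x) h₂ | ∈-map⁻ (λ x → + c ℤ.* x) h₃ | ∈-map⁻ (λ x → + c ℤ.* x) h₄
      ... | y₁ , k₁ , refl | y₂ , k₂ , refl | y₃ , k₃ , refl | y₄ , k₄ , refl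
        with ∈-elements p k₁ | ∈-elements p k₂ | ∈-elements p k₃ | ∈-elements p k₄
      ... | i₁ , p₁ , refl | i₂ , p₂ , refl | i₃ , p₃ , refl | i₄ , p₄ , refl
        with sums-trivial p₁ p₂ p₃ p₄ (ℕ.*-cancelˡ-≡ _ _ c {{ℕ.>-nonZero 0<c}}
          (congruent⇒≡ (bound i₁ i₂) (bound i₃ i₄) (subst (+ N ∣_) (as-difference (elem i₁) (elem i₂) (elem i₃) (elem i₄)) N∣)))
      ... | inj₁ eq = inj₁ (≡⇒∣ eq)
      ... | inj₂ eq = inj₂ (≡⇒∣ eq)

    mul-1 : mul 1 A ≡ A
    mul-1 = trans (map-cong ℤ.*-identityˡ A) (map-id A)

    1≤a+b : 1 ℕ.≤ a ℕ.+ b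
    1≤a+b = ℕ.≤-trans 1≤a (ℕ.m≤m+n a b)

    sidonA : Sidon A
    sidonA = subst Sidon mul-1 (sidon-mul 1 ℕ.≤-refl 1≤a+b)

    ∑*δ≤ : ∀ {c} y → 0# ≤ c → ∑ A (λ x → c * δ (x ℤ.- y)) ≤ c
    ∑*δ≤ {c} y 0≤c = ≤-trans (≤-reflexive (∑-* A c _))
      (≤-trans (*-monoˡ 0≤c (Sidon.distinct sidonA y)) (≤-reflexive (*-identityʳ c)))

    -- Every trivial pattern fixes x₁ from x₃, x₄, x₅ and then x₂ from these and x₁. The remaining
    -- coincidence is left in `f`, so two free variables survive and each pattern has at most m²
    -- solutions.
    ∑-pinned : ∀ (f : ℤ → ℤ → ℤ → R) (g : ℤ → ℤ → ℤ → ℤ) (h : ℤ → ℤ → ℤ → ℤ → ℤ) → (∀ x₅ x₃ x₄ → 0# ≤ f x₅ x₃ x₄) →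
      ∑ (quintuples A) (λ (x₅ , x₃ , x₄ , x₁ , x₂) → f x₅ x₃ x₄ * δ (x₁ ℤ.- g x₅ x₃ x₄) * δ (x₂ ℤ.- h x₅ x₃ x₄ x₁))
        ≤ ∑ A (λ x₅ → ∑ A (λ x₃ → ∑ A (λ x₄ → f x₅ x₃ x₄)))
    ∑-pinned f g h 0≤f = ≤-trans (≤-reflexive (∑-quintuples A _)) (∑-mono A (λ x₅ → ∑-mono A (λ x₃ → ∑-mono A (λ x₄ →
      ≤-trans (∑-mono A (λ x₁ → ∑*δ≤ (h x₅ x₃ x₄ x₁) (0≤* (0≤f x₅ x₃ x₄) (0≤δ _)))) (∑*δ≤ (g x₅ x₃ x₄) (0≤f x₅ x₃ x₄))))))

    0≤m : 0# ≤ m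
    0≤m = 0≤len A

    ∑-x₃≡x₅ : ∑ A (λ x₅ → ∑ A (λ x₃ → ∑ A (λ x₄ → δ (x₃ ℤ.- x₅)))) ≤ m * m
    ∑-x₃≡x₅ = ≤-trans (∑-mono A (λ x₅ → ≤-trans (≤-reflexive (∑-cong A (λ x₃ → ∑-const A (δ (x₃ ℤ.- x₅)))))
      (∑*δ≤ x₅ 0≤m))) (≤-reflexive (∑-const A m))

    ∑-x₄≡x₃ : ∑ A (λ x₅ → ∑ A (λ x₃ → ∑ A (λ x₄ → δ (x₄ ℤ.- x₃)))) ≤ m * m
    ∑-x₄≡x₃ = ≤-trans (∑-mono A (λ x₅ → ∑-mono A (λ x₃ → Sidon.distinct sidonA x₃))) (≤-reflexive (∑-const A m))

    trivial₁ trivial₂ trivial₃ : Quintuple → R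
    trivial₁ (x₅ , x₃ , x₄ , x₁ , x₂) = δ (x₃ ℤ.- x₅) * δ (x₁ ℤ.- x₄) * δ (x₂ ℤ.- x₃)
    trivial₂ (x₅ , x₃ , x₄ , x₁ , x₂) = δ (x₃ ℤ.- x₅) * δ (x₁ ℤ.- x₃) * δ (x₂ ℤ.- x₄)
    trivial₃ (x₅ , x₃ , x₄ , x₁ , x₂) = δ (x₄ ℤ.- x₃) * δ (x₁ ℤ.- x₅) * δ (x₂ ℤ.- x₁)

    0≤trivial : ∀ x y z → 0# ≤ δ x * δ y * δ z
    0≤trivial x y z = 0≤* (0≤* (0≤δ x) (0≤δ y)) (0≤δ z)

    solution-trivial : ∀ {x} → x ∈ quintuples A → δ (form a b x ℤ.+ + 0) ≤ trivial₁ x + trivial₂ x + trivial₃ x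
    solution-trivial {x₅ , x₃ , x₄ , x₁ , x₂} x∈ =
      let h₁ , h₂ , h₃ , h₄ , h₅ = ∈-quintuples A x∈
      in indices (∈-elements p h₁) (∈-elements p h₂) (∈-elements p h₃) (∈-elements p h₄) (∈-elements p h₅)
      where
      Index : ℤ → Set
      Index x = ∃[ i ] (i ∈ₛ p × x ≡ + elem i)
      as-difference : ∀ x₁ x₂ x₃ x₄ x₅ → form a b (+ x₅ , + x₃ , + x₄ , + x₁ , + x₂) ℤ.+ + 0 ≡
        + (a ℕ.* x₁ ℕ.+ a ℕ.* x₂ ℕ.+ b ℕ.* x₃) ℤ.- + (a ℕ.* x₄ ℕ.+ (a ℕ.+ b) ℕ.* x₅)
      as-difference x₁ x₂ x₃ x₄ x₅ = trans (ℤ.+-identityʳ _) (cong₂ ℤ._-_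
        (cong₂ ℤ._+_ (cong₂ ℤ._+_ (sym (ℤ.pos-* a x₁)) (sym (ℤ.pos-* a x₂))) (sym (ℤ.pos-* b x₃)))
        (cong₂ ℤ._+_ (sym (ℤ.pos-* a x₄)) (sym (ℤ.pos-* (a ℕ.+ b) x₅))))
      2a+b<N : a ℕ.* n ℕ.+ a ℕ.* n ℕ.+ b ℕ.* n ℕ.< N
      2a+b<N = subst (a ℕ.* n ℕ.+ a ℕ.* n ℕ.+ b ℕ.* n ℕ.<_) (eq a b n)
        (ℕ.m<m+n (a ℕ.* n ℕ.+ a ℕ.* n ℕ.+ b ℕ.* n) (ℕ.*-mono-≤ {1} {a ℕ.+ (b ℕ.+ b)} (ℕ.≤-trans 1≤a (ℕ.m≤m+n a _)) 0<n))
        where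
        eq : ∀ a b n → a ℕ.* n ℕ.+ a ℕ.* n ℕ.+ b ℕ.* n ℕ.+ (a ℕ.+ (b ℕ.+ b)) ℕ.* n ≡ 3 ℕ.* (a ℕ.+ b) ℕ.* n
        eq = solve-ℕ
      left< : ∀ (i j k : Fin n) → a ℕ.* elem i ℕ.+ a ℕ.* elem j ℕ.+ b ℕ.* elem k ℕ.< N
      left< i j k = ℕ.≤-<-trans (ℕ.+-mono-≤ (ℕ.+-mono-≤ (ℕ.*-monoʳ-≤ a (value≤n i)) (ℕ.*-monoʳ-≤ a (value≤n j)))
          (ℕ.*-monoʳ-≤ b (value≤n k))) 2a+b<N
      right< : ∀ (i j : Fin n) → a ℕ.* elem i ℕ.+ (a ℕ.+ b) ℕ.* elem j ℕ.< N
      right< i j = ℕ.≤-<-trans (ℕ.+-mono-≤ (ℕ.*-monoʳ-≤ a (value≤n i)) (ℕ.*-monoʳ-≤ (a ℕ.+ b) (value≤n j)))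
        (subst (ℕ._< N) (eq a b n) 2a+b<N)
        where
        eq : ∀ a b n → a ℕ.* n ℕ.+ a ℕ.* n ℕ.+ b ℕ.* n ≡ a ℕ.* n ℕ.+ (a ℕ.+ b) ℕ.* n
        eq = solve-ℕ
      1≤δ≡ : ∀ {u v} → u ≡ v → 1# ≤ δ (+ u ℤ.- + v)
      1≤δ≡ {u} refl = 1≤δ _ (subst (+ N ∣_) (sym (ℤ.+-inverseʳ (+ u))) (divides (+ 0) refl))
      sum₃ : ∀ {u v w} → 0# ≤ u → 0# ≤ v → 0# ≤ w → 1# ≤ u ⊎ 1# ≤ v ⊎ 1# ≤ w → 1# ≤ u + v + w
      sum₃ 0≤u 0≤v 0≤w (inj₁ h) = +-mono (+-mono h 0≤v) 0≤w
      sum₃ 0≤u 0≤v 0≤w (inj₂ (inj₁ h)) = +-mono (+-mono 0≤u h) 0≤w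
      sum₃ 0≤u 0≤v 0≤w (inj₂ (inj₂ h)) = +-mono (+-mono 0≤u 0≤v) h
      patterns : ∀ x₁ x₂ x₃ x₄ x₅ → Trivial a b x₁ x₂ x₃ x₄ x₅ →
        let x = (+ x₅ , + x₃ , + x₄ , + x₁ , + x₂) in 1# ≤ trivial₁ x ⊎ 1# ≤ trivial₂ x ⊎ 1# ≤ trivial₃ x
      patterns x₁ x₂ x₃ x₄ x₅ (inj₁ (e₁ , e₂ , e₃)) = inj₁ (1≤* (1≤* (1≤δ≡ e₃) (1≤δ≡ e₁)) (1≤δ≡ e₂))
      patterns x₁ x₂ x₃ x₄ x₅ (inj₂ (inj₁ (e₁ , e₂ , e₃))) = inj₂ (inj₁ (1≤* (1≤* (1≤δ≡ e₃) (1≤δ≡ e₂)) (1≤δ≡ e₁)))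
      patterns x₁ x₂ x₃ x₄ x₅ (inj₂ (inj₂ (_ , e₁ , e₂ , e₃))) =
        inj₂ (inj₂ (1≤* (1≤* (1≤δ≡ (sym e₃)) (1≤δ≡ (trans e₁ e₂))) (1≤δ≡ (sym e₁))))
      indices : ∀ {x₁ x₂ x₃ x₄ x₅} → Index x₁ → Index x₂ → Index x₃ → Index x₄ → Index x₅ →
        let x = (x₅ , x₃ , x₄ , x₁ , x₂) in δ (form a b x ℤ.+ + 0) ≤ trivial₁ x + trivial₂ x + trivial₃ x
      indices (i₁ , p₁ , refl) (i₂ , p₂ , refl) (i₃ , p₃ , refl) (i₄ , p₄ , refl) (i₅ , p₅ , refl) =
        δ-≤ (form a b (+ elem i₅ , + elem i₃ , + elem i₄ , + elem i₁ , + elem i₂) ℤ.+ + 0)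
          (λ N∣ → sum₃ (0≤trivial _ _ _) (0≤trivial _ _ _) (0≤trivial _ _ _)
            (patterns (elem i₁) (elem i₂) (elem i₃) (elem i₄) (elem i₅)
              (free i₁ i₂ i₃ i₄ i₅ p₁ p₂ p₃ p₄ p₅ (congruent⇒≡ (left< i₁ i₂ i₃) (right< i₄ i₅)
                (subst (+ N ∣_) (as-difference (elem i₁) (elem i₂) (elem i₃) (elem i₄) (elem i₅)) N∣)))))
          (0≤+ (0≤+ (0≤trivial _ _ _) (0≤trivial _ _ _)) (0≤trivial _ _ _))

    few : T₀ (+ 0) ≤ nat 3 * (m * m)
    few = begin
      T₀ (+ 0)
        ≡⟨ T₀≡ (+ 0) ⟩
      ∑ A⁵ (λ x → δ (form a b x ℤ.+ + 0))
        ≤⟨ ∑-mono∈ A⁵ (λ x x∈ → solution-trivial x∈) ⟩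
      ∑ A⁵ (λ x → trivial₁ x + trivial₂ x + trivial₃ x)
        ≡⟨ trans (∑-+ A⁵ _ trivial₃) (cong₂ _+_ (∑-+ A⁵ trivial₁ trivial₂) refl) ⟩
      ∑ A⁵ trivial₁ + ∑ A⁵ trivial₂ + ∑ A⁵ trivial₃
        ≤⟨ +-mono (+-mono
             (≤-trans (∑-pinned (λ x₅ x₃ x₄ → δ (x₃ ℤ.- x₅)) (λ x₅ x₃ x₄ → x₄) (λ x₅ x₃ x₄ x₁ → x₃) (λ _ _ _ → 0≤δ _)) ∑-x₃≡x₅)
             (≤-trans (∑-pinned (λ x₅ x₃ x₄ → δ (x₃ ℤ.- x₅)) (λ x₅ x₃ x₄ → x₃) (λ x₅ x₃ x₄ x₁ → x₄) (λ _ _ _ → 0≤δ _)) ∑-x₃≡x₅))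
             (≤-trans (∑-pinned (λ x₅ x₃ x₄ → δ (x₄ ℤ.- x₃)) (λ x₅ x₃ x₄ → x₅) (λ x₅ x₃ x₄ x₁ → x₁) (λ _ _ _ → 0≤δ _)) ∑-x₄≡x₃) ⟩
      m * m + m * m + m * m
        ≡⟨ eq m ⟩
      nat 3 * (m * m) ∎
      where
      open ≤-Reasoning
      A⁵ : List Quintuple
      A⁵ = quintuples A
      eq : ∀ m → m * m + m * m + m * m ≡ nat 3 * (m * m)
      eq = solve-∀ ring

  -- Choice of the constants and the final bound

  module Bound (a b k : ℕ) (1≤a : 1 ℕ.≤ a) (1≤b : 1 ℕ.≤ b) (1≤k : 1 ℕ.≤ k)
    {D₀ d̂ : R} (1≤D₀ : 1# ≤ D₀) (1≤d̂ : 1# ≤ d̂)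
    (D≤D₀ : nat (3 ℕ.* (a ℕ.+ b) ℕ.* (k ℕ.* k)) ≤ D₀) (d≤d̂ : nat (3 ℕ.* (a ℕ.+ b)) ≤ d̂) where

    open Levels a b 1≤D₀ 1≤d̂

    loss : R
    loss = nat 2 * d̂ * period-loss D₀ (level steps)

    0≤loss : 0# ≤ loss
    0≤loss = 0≤* (0≤* 0≤nat (1≤⇒0≤ 1≤d̂)) (1≤⇒0≤ (1≤loss (level steps)))

    -- The summand 1 makes `m₀` positive, so that `n` is positive and `A` nonempty in `sparse`.
    m₀ : ℕ
    m₀ = ceil (threshold steps + loss + 1#)

    m₀≥ : threshold steps + loss + 1# ≤ nat m₀
    m₀≥ = ≤ceil (threshold steps + loss + 1#)

    1≤m₀ : 1 ℕ.≤ m₀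
    1≤m₀ = nat-cancel (≤-trans (≤by _ (eq (threshold steps) loss) (0≤+ (0≤threshold steps) 0≤loss)) m₀≥)
      where
      eq : ∀ t l → t + l + 1# - 1# ≡ t + l
      eq = solve-∀ ring

    -- Beyond this point a set with fewer than `m₀` elements satisfies the bound by its size alone.
    N₀ : ℕ
    N₀ = k ℕ.* k ℕ.* (m₀ ℕ.* m₀)

    sparse : ∀ {n} → N₀ ℕ.≤ n → (p : Subset n) → SolutionFree a b p → n ℕ.< k ℕ.* k ℕ.* (size p ℕ.* size p) → ¬ m₀ ℕ.≤ size p
    sparse {n} N₀≤n p free n< m₀≤ = impossible sidonA
        (≤-trans (≤by _ (eq₁ (threshold steps) loss) (0≤+ 0≤loss 0≤1)) large)
        (≤-trans (≤by _ (eq₂ (threshold steps) loss) (0≤+ (0≤threshold steps) 0≤1)) large)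
      where
      0<n : 0 ℕ.< n
      0<n = ℕ.≤-trans (ℕ.*-mono-≤ (ℕ.*-mono-≤ 1≤k 1≤k) (ℕ.*-mono-≤ 1≤m₀ 1≤m₀)) N₀≤n
      open Reduction a b n 1≤a 1≤b 0<n p free
      m≡ : m ≡ nat (size p)
      m≡ = len-elements p
      large : threshold steps + loss + 1# ≤ m
      large = subst (threshold steps + loss + 1# ≤_) (sym m≡) (≤-trans m₀≥ (nat-mono m₀≤))
      eq₁ : ∀ t l → t + l + 1# - t ≡ l + 1#
      eq₁ = solve-∀ ring
      eq₂ : ∀ t l → t + l + 1# - l ≡ t + 1#
      eq₂ = solve-∀ ring
      d : ℕ
      d = 3 ℕ.* (a ℕ.+ b)
      -- Here the assumed failure n < k² m² enters: multiplied by 3(a + b) it bounds the modulus by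
      -- D₀ m².
      N≤D₀m² : nat N ≤ D₀ * (m * m)
      N≤D₀m² = subst (λ s → nat N ≤ D₀ * (s * s)) (sym m≡)
        (≤-trans (nat-mono (ℕ.≤-trans (ℕ.*-monoʳ-≤ d (ℕ.<⇒≤ n<)) (ℕ.≤-reflexive (sym (ℕ.*-assoc d (k ℕ.* k) _)))))
        (≤-trans (≤-reflexive (trans (nat-* (d ℕ.* (k ℕ.* k)) _) (cong (nat (d ℕ.* (k ℕ.* k)) *_) (nat-* (size p) (size p)))))
          (*-monoʳ (0≤sq (nat (size p))) D≤D₀)))
      N≤d̂n : nat N ≤ d̂ * nat n
      N≤d̂n = ≤-trans (≤-reflexive (nat-* d n)) (*-monoʳ 0≤nat d≤d̂)
      1≤m : 1# ≤ m
      1≤m = subst (1# ≤_) (sym m≡) (nat-mono (ℕ.≤-trans 1≤m₀ m₀≤))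
      an≤N : a ℕ.* n ℕ.≤ N
      an≤N = c*n≤N (ℕ.m≤m+n a b)
      open Increment N a b n A 1≤a 0<n an≤N (sidon-mul a 1≤a (ℕ.m≤m+n a b)) (sidon-mul (a ℕ.+ b) 1≤a+b ℕ.≤-refl)
        (distinct-mul b 1≤b (ℕ.m≤n+m b a)) 1≤m 1≤D₀ 1≤d̂ N≤D₀m² N≤d̂n few using (impossible)

    bound : ∀ n → N₀ ℕ.≤ n → (p : Subset n) → SolutionFree a b p → k ℕ.* k ℕ.* (size p ℕ.* size p) ℕ.≤ n
    bound n N₀≤n p free with k ℕ.* k ℕ.* (size p ℕ.* size p) ℕ.≤? n | m₀ ℕ.≤? size p
    ... | yes h | _ = h
    ... | no ¬h | yes m₀≤ = ⊥-elim (sparse N₀≤n p free (ℕ.≰⇒> ¬h) m₀≤)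
    ... | no _ | no m₀≰ = ℕ.≤-trans (ℕ.*-monoʳ-≤ (k ℕ.* k) (ℕ.*-mono-≤ small small)) N₀≤n
      where
      small : size p ℕ.≤ m₀
      small = ℕ.<⇒≤ (ℕ.≰⇒> m₀≰)

  theorem : (a b : ℕ) → 1 ℕ.≤ a → 1 ℕ.≤ b → (k : ℕ) → 1 ℕ.≤ k →
    ∃[ N ] ((n : ℕ) → N ℕ.≤ n → (A : Subset n) → SolutionFree a b A → k ℕ.* k ℕ.* (size A ℕ.* size A) ℕ.≤ n)
  theorem a b 1≤a 1≤b k 1≤k = N₀ , bound
    where
    1≤d : 1 ℕ.≤ 3 ℕ.* (a ℕ.+ b)
    1≤d = ℕ.≤-trans 1≤a (ℕ.≤-trans (ℕ.m≤m+n a b) (ℕ.m≤n*m (a ℕ.+ b) 3))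
    1≤D : 1 ℕ.≤ 3 ℕ.* (a ℕ.+ b) ℕ.* (k ℕ.* k)
    1≤D = ℕ.*-mono-≤ 1≤d (ℕ.*-mono-≤ 1≤k 1≤k)
    open Bound a b k 1≤a 1≤b 1≤k (nat-mono 1≤D) (nat-mono 1≤d) ≤-refl ≤-refl

open import Data.Nat using (ℕ; _*_; _≤_)
open import Data.Fin.Subset using (Subset; ∣_∣)
open import Data.Product using (∃-syntax)

theorem1p16 : (a b : ℕ) → 1 ≤ a → 1 ≤ b →
    (k : ℕ) → 1 ≤ k →
    ∃[ N ] ((n : ℕ) → N ≤ n → (A : Subset n) → SolutionFree a b A →
    k * k * (∣ A ∣ * ∣ A ∣) ≤ n)
theorem1p16 = Proof.theorem
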